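{- Let $\mathcal M\models T$, $a\in M^k$ and $1\le i\le k$. The map $\iota_{a,i}^{+}$ is a homeomorphism from $\mathcal G_{a,i}^{+}$, equipped with the subspace topology induced by the $\mathcal K$-metric $d_{\mathcal G}$ on $\mathcal G_a$, onto $\mathfrak m_{\mathcal K}^{k-1}$, equipped with the sup metric $d_K(x,y)=\max_{1\le j\le k-1}|x_j-y_j|$. The analogous statement holds for $\iota_{a,i}^{ - }:\mathcal G_{a,i}^-\to\mathfrak m_{\mathcal K}^{k-1}$.
   Context: $T$ is a complete o-minimal theory expanding the theory of real closed ordered fields in a language $\mathcal L$, with quantifier elimination and universally axiomatizable; definable means definable with parameters. $\mathcal K=\mathcal H_{0^+}$ (underlying set $K$) is the Hardy field of germs at $0^+$ of $\mathcal L(M)$-definable unary functions, an ordered field containing $M$ as constant germs. $\mathfrak m_{\mathcal K}=\{x\in K:|x|<c\text{ for every }c\in M^{>0}\}$. Metric topologies over $K$ are generated by balls with radii in $K^{>0}$. A curve at $a$ is a continuous $\gamma:(0,1)\to M^k$ with $\lim_{t\to0}\gamma(t)=a$. $\gamma\sim\sigma$ if for some $\varepsilon>0$, $B(a,\varepsilon)\cap\gamma((0,1))=B(a,\varepsilon)\cap\sigma((0,1))$. Here $B(a,\varepsilon)$ is the ball for the sup metric $d$ on $M^k$. $\mathcal G_a$ is the set of classes $[\gamma]$ of $\mathcal L$-definable curves at $a$. Curve germs concern behaviour as $t\to0$: representatives are shrunk (restricted to small $t$ and reparametrized) so that $d(\gamma(t),a)$ is strictly increasing in $t$ (for nonconstant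 germs). $d_{\mathcal G}([\gamma],[\sigma])\in\mathcal K$ is the germ at $0^+$ of $t\mapsto D\bigl(B(a,t)\cap\gamma((0,1)),\,B(a,t)\cap\sigma((0,1))\bigr)$, where $D$ is the Hausdorff distance induced by $d$. $\mathcal G_{a,i}^{+}$ (resp. $\mathcal G_{a,i}^-$) is the set of germs in $\mathcal G_a$ whose representatives are eventually (as $t\to 0$) contained in $\{b\in M^k:b_i>a_i\}$ (resp. $b_i<a_i$). Write $a_{\widehat i}=(a_1,\ldots,a_{i-1},a_{i+1},\ldots,a_k)$ and $\operatorname{ins}_i(u,y)=(u_1,\ldots,u_{i-1},y,u_i,\ldots,u_{k-1})$. Each $[\gamma]\in\mathcal G_{a,i}^{+}$ has a unique normalized representative $\widehat\gamma(s)=\operatorname{ins}_i(u_\gamma(s),a_i+s)$, with $u_\gamma:(0,\varepsilon)\to M^{k-1}$ $\mathcal L(M)$-definable converging to $a_{\widehat i}$ as $s\to0^+$; set $\iota_{a,i}^{+}([\gamma])=[u_\gamma-a_{\widehat i}]_{\mathcal K}\in\mathfrak m_{\mathcal K}^{k-1}$. For $\mathcal G_{a,i}^{ - }$ use $\widehat\gamma(s)=\operatorname{ins}_i(u_\gamma(s),a_i-s)$ and $\iota_{a,i}^-([\gamma])=[u_\gamma-a_{\widehat i}]_{\mathcal K}$. -}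

module Defs where

open import Level using (Level; 0ℓ)
open import Data.Nat.Base as ℕ using (ℕ; zero; suc)
open import Data.Fin.Base as Fin using (Fin; zero; suc; _↑ˡ_; _↑ʳ_)
open import Data.Vec.Base as Vec
  using (Vec; []; _∷_; _++_; head; tail; lookup; map; zipWith; foldr′; insertAt; removeAt)
open import Data.Vec.Properties using (lookup-++ˡ; lookup-++ʳ)
open import Data.Vec.Relation.Binary.Pointwise.Inductive as Pointwise using ()
open import Data.List.Base using (List)
open import Data.List.Relation.Unary.Any using (Any)
open import Data.Sign.Base using (Sign)
open import Data.Product.Base using (Σ; ∃; _×_; _,_; proj₁; proj₂)
open import Data.Sum.Base using (_⊎_; inj₁; inj₂)
open import Data.Empty using (⊥; ⊥-elim)
open import Function.Base using (_∘_)
open import Function.Bundles using (_⇔_; mk⇔; Equivalence)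
open import Function.Structures using (IsInverse)
open import Relation.Nullary using (¬_)
open import Relation.Nullary.Construct.Add.Extrema using (_±; [_])
open import Relation.Unary using (Pred; _∈_; _∩_; _⊢_)
open import Relation.Binary.Bundles using (Setoid; StrictTotalOrder)
open import Relation.Binary.Definitions using (tri<; tri≈; tri>)
open import Relation.Binary.Structures using (IsStrictTotalOrder)
open import Relation.Binary.PropositionalEquality
  using (_≡_; _≢_; refl; sym; trans; cong; cong₂; subst)
import Relation.Binary.Construct.Add.Extrema.Strict as Extrema
import Relation.Binary.Properties.StrictTotalOrder as STOProperties
import Algebra.Construct.NaturalChoice.Max as Max
open import Algebra.Structures using (IsCommutativeRing)

private variable
  ℓ₁ ℓ₂ : Level
  k m n : ℕ

-- Languages with distinguished symbols for ordered rings.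
record Language : Set₁ where
  field
    Func Rel          : ℕ → Set
    zeroˢ oneˢ        : Func 0
    negˢ              : Func 1
    addˢ mulˢ         : Func 2
    ltˢ               : Rel 2

-- Variables are de Bruijn indices; a binder captures index zero.
data Term (L : Language) (n : ℕ) : Set where
  var  : Fin n → Term L n
  func : Language.Func L k → Vec (Term L n) k → Term L n

data Formula (L : Language) (n : ℕ) : Set where
  _≐_         : Term L n → Term L n → Formula L n
  rel         : Language.Rel L k → Vec (Term L n) k → Formula L n
  ⊥′          : Formula L n
  _∧_ _∨_ _⇒_ : Formula L n → Formula L n → Formula L n
  ∀′ ∃′       : Formula L (suc n) → Formula L n

Sentence : Language → Set
Sentence L = Formula L 0

Theory : Language → Set₁
Theory L = Pred (Sentence L) 0ℓ

record Structure (L : Language) : Set₁ where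
  open Language L
  field
    Carrier : Set
    ⟦_⟧ᶠ    : Func k → Vec Carrier k → Carrier
    ⟦_⟧ʳ    : Rel k → Vec Carrier k → Set

  0# 1# : Carrier
  0# = ⟦ zeroˢ ⟧ᶠ []
  1# = ⟦ oneˢ ⟧ᶠ []

  infix  8 -_
  infixl 7 _*_
  infixl 6 _+_ _-_
  infix  4 _<_

  -_ : Carrier → Carrier
  - x = ⟦ negˢ ⟧ᶠ (x ∷ [])

  _+_ _*_ _-_ : Carrier → Carrier → Carrier
  x + y = ⟦ addˢ ⟧ᶠ (x ∷ y ∷ [])
  x * y = ⟦ mulˢ ⟧ᶠ (x ∷ y ∷ [])
  x - y = x + (- y)

  _<_ : Carrier → Carrier → Set
  x < y = ⟦ ltˢ ⟧ʳ (x ∷ y ∷ [])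

  eval     : Term L n → Vec Carrier n → Carrier
  evalArgs : Vec (Term L n) k → Vec Carrier n → Vec Carrier k
  eval (var i)       v = lookup v i
  eval (func f ts)   v = ⟦ f ⟧ᶠ (evalArgs ts v)
  evalArgs []        v = []
  evalArgs (t ∷ ts)  v = eval t v ∷ evalArgs ts v

private variable
  L : Language

open Structure using (Carrier)

infix 3 _⊨_[_] _⊨ᵀ_

_⊨_[_] : (M : Structure L) → Formula L n → Vec (Carrier M) n → Set
M ⊨ s ≐ t    [ v ] = Structure.eval M s v ≡ Structure.eval M t v
M ⊨ rel R ts [ v ] = Structure.⟦_⟧ʳ M R (Structure.evalArgs M ts v)
M ⊨ ⊥′       [ v ] = ⊥
M ⊨ φ ∧ ψ    [ v ] = (M ⊨ φ [ v ]) × (M ⊨ ψ [ v ])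
M ⊨ φ ∨ ψ    [ v ] = (M ⊨ φ [ v ]) ⊎ (M ⊨ ψ [ v ])
M ⊨ φ ⇒ ψ    [ v ] = (M ⊨ φ [ v ]) → (M ⊨ ψ [ v ])
M ⊨ ∀′ φ     [ v ] = ∀ x → M ⊨ φ [ x ∷ v ]
M ⊨ ∃′ φ     [ v ] = ∃ λ x → M ⊨ φ [ x ∷ v ]

_⊨ᵀ_ : Structure L → Theory L → Set
M ⊨ᵀ T = ∀ φ → φ ∈ T → M ⊨ φ [ [] ]

data QuantifierFree {L : Language} {n : ℕ} : Formula L n → Set where
  eq  : ∀ {s t} → QuantifierFree (s ≐ t)
  rel : ∀ {R : Language.Rel L k} {ts} → QuantifierFree (rel R ts)
  bot : QuantifierFree ⊥′
  and : ∀ {φ ψ} → QuantifierFree φ → QuantifierFree ψ → QuantifierFree (φ ∧ ψ)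
  or  : ∀ {φ ψ} → QuantifierFree φ → QuantifierFree ψ → QuantifierFree (φ ∨ ψ)
  imp : ∀ {φ ψ} → QuantifierFree φ → QuantifierFree ψ → QuantifierFree (φ ⇒ ψ)

data Universal {L : Language} : Formula L n → Set where
  matrix : ∀ {φ : Formula L n} → QuantifierFree φ → Universal φ
  forAll : ∀ {φ : Formula L (suc n)} → Universal φ → Universal (∀′ φ)

-- Definable with parameters: the parameters p are appended to the free variables.
Definable : (M : Structure L) → Pred (Vec (Carrier M) n) 0ℓ → Set
Definable {L = L} {n = n} M A =
  ∃ λ m → Σ (Vec (Carrier M) m) λ p → Σ (Formula L (n ℕ.+ m)) λ φ →
    ∀ v → A v ⇔ (M ⊨ φ [ v ++ p ])

DefinableFunction : (M : Structure L) → (Carrier M → Carrier M) → Set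
DefinableFunction M f = Definable {n = 2} M (λ v → head (tail v) ≡ f (head v))

record IsRealClosedOrderedField (M : Structure L) : Set where
  open Structure M hiding (Carrier)

  -- The value at x of the monic polynomial whose lower coefficients are c₀, c₁, ….
  monic : Vec (Carrier M) n → Carrier M → Carrier M
  monic c x = foldr′ (λ cⱼ r → cⱼ + x * r) 1# c

  field
    isCommutativeRing  : IsCommutativeRing _≡_ _+_ _*_ -_ 0# 1#
    isStrictTotalOrder : IsStrictTotalOrder _≡_ _<_
    0≢1                : 0# ≢ 1#
    inverses           : ∀ x → x ≢ 0# → ∃ λ y → x * y ≡ 1#
    +-mono-<           : ∀ x y z → x < y → x + z < y + z
    *-pos              : ∀ x y → 0# < x → 0# < y → 0# < x * y
    squareRoots        : ∀ x → 0# < x → ∃ λ y → y * y ≡ x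
    oddDegreeRoots     : ∀ m (c : Vec (Carrier M) (suc (m ℕ.+ m))) → ∃ λ x → monic c x ≡ 0#

data Piece (A : Set) : Set where
  point    : A → Piece A
  interval : A ± → A ± → Piece A

IsOMinimal : Structure L → Set₁
IsOMinimal M = (A : Pred (Vec (Carrier M) 1) 0ℓ) → Definable M A →
  ∃ λ (ps : List (Piece (Carrier M))) → ∀ x → A (x ∷ []) ⇔ Any (x ∈ₚ_) ps
  where
  open Extrema (Structure._<_ M) using (_<±_)

  _∈ₚ_ : Carrier M → Piece (Carrier M) → Set
  x ∈ₚ point c      = x ≡ c
  x ∈ₚ interval l r = (l <± [ x ]) × ([ x ] <± r)

IsComplete : Theory L → Set₁
IsComplete {L} T =
    (∃ λ (M : Structure L) → M ⊨ᵀ T)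
  × (∀ (φ : Sentence L) → (∀ M → M ⊨ᵀ T → M ⊨ φ [ [] ])
                        ⊎ (∀ M → M ⊨ᵀ T → M ⊨ φ ⇒ ⊥′ [ [] ]))

HasQuantifierElimination : Theory L → Set₁
HasQuantifierElimination {L} T = ∀ {n} (φ : Formula L n) →
  ∃ λ (ψ : Formula L n) → QuantifierFree ψ ×
    (∀ M → M ⊨ᵀ T → ∀ v → (M ⊨ φ [ v ]) ⇔ (M ⊨ ψ [ v ]))

IsUniversallyAxiomatizable : Theory L → Set₁
IsUniversallyAxiomatizable {L} T =
  ∃ λ (U : Theory L) → (∀ φ → φ ∈ U → Universal φ) × (∀ M → (M ⊨ᵀ U) ⇔ (M ⊨ᵀ T))

record StandingAssumptions (T : Theory L) : Set₁ where
  field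
    complete                 : IsComplete T
    oMinimal                 : ∀ M → M ⊨ᵀ T → IsOMinimal M
    realClosed               : ∀ M → M ⊨ᵀ T → IsRealClosedOrderedField M
    quantifierElimination    : HasQuantifierElimination T
    universallyAxiomatizable : IsUniversallyAxiomatizable T

renameTerm  : (Fin m → Fin n) → Term L m → Term L n
renameTerms : (Fin m → Fin n) → Vec (Term L m) k → Vec (Term L n) k
renameTerm ρ (var i)      = var (ρ i)
renameTerm ρ (func f ts)  = func f (renameTerms ρ ts)
renameTerms ρ []          = []
renameTerms ρ (t ∷ ts)    = renameTerm ρ t ∷ renameTerms ρ ts

rename : (Fin m → Fin n) → Formula L m → Formula L n
rename ρ (s ≐ t)    = renameTerm ρ s ≐ renameTerm ρ t
rename ρ (rel R ts) = rel R (renameTerms ρ ts)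
rename ρ ⊥′         = ⊥′
rename ρ (φ ∧ ψ)    = rename ρ φ ∧ rename ρ ψ
rename ρ (φ ∨ ψ)    = rename ρ φ ∨ rename ρ ψ
rename ρ (φ ⇒ ψ)    = rename ρ φ ⇒ rename ρ ψ
rename ρ (∀′ φ)     = ∀′ (rename (Fin.lift 1 ρ) φ)
rename ρ (∃′ φ)     = ∃′ (rename (Fin.lift 1 ρ) φ)

module _ (M : Structure L) where
  open Structure M using (eval; evalArgs; ⟦_⟧ᶠ; ⟦_⟧ʳ)
  open Equivalence

  Agree : (Fin m → Fin n) → Vec (Carrier M) m → Vec (Carrier M) n → Set
  Agree ρ v w = ∀ i → lookup w (ρ i) ≡ lookup v i

  agree-lift : ∀ {ρ : Fin m → Fin n} {v w} x →
               Agree ρ v w → Agree (Fin.lift 1 ρ) (x ∷ v) (x ∷ w)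
  agree-lift x h zero    = refl
  agree-lift x h (suc i) = h i

  eval-rename     : ∀ {ρ : Fin m → Fin n} {v w} → Agree ρ v w →
                    (t : Term L m) → eval (renameTerm ρ t) w ≡ eval t v
  evalArgs-rename : ∀ {ρ : Fin m → Fin n} {v w} → Agree ρ v w →
                    (ts : Vec (Term L m) k) → evalArgs (renameTerms ρ ts) w ≡ evalArgs ts v
  eval-rename h (var i)         = h i
  eval-rename h (func f ts)     = cong ⟦ f ⟧ᶠ (evalArgs-rename h ts)
  evalArgs-rename h []          = refl
  evalArgs-rename h (t ∷ ts)    = cong₂ _∷_ (eval-rename h t) (evalArgs-rename h ts)

  ⊨-rename : ∀ {ρ : Fin m → Fin n} {v w} → Agree ρ v w →
             (φ : Formula L m) → (M ⊨ rename ρ φ [ w ]) ⇔ (M ⊨ φ [ v ])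
  ⊨-rename h (s ≐ t) = mk⇔
    (λ e → trans (sym (eval-rename h s)) (trans e (eval-rename h t)))
    (λ e → trans (eval-rename h s) (trans e (sym (eval-rename h t))))
  ⊨-rename h (rel R ts) = mk⇔
    (subst ⟦ R ⟧ʳ (evalArgs-rename h ts))
    (subst ⟦ R ⟧ʳ (sym (evalArgs-rename h ts)))
  ⊨-rename h ⊥′ = mk⇔ (λ z → z) (λ z → z)
  ⊨-rename h (φ ∧ ψ) = mk⇔
    (λ (x , y) → to (⊨-rename h φ) x , to (⊨-rename h ψ) y)
    (λ (x , y) → from (⊨-rename h φ) x , from (⊨-rename h ψ) y)
  ⊨-rename h (φ ∨ ψ) = mk⇔
    (λ { (inj₁ x) → inj₁ (to (⊨-rename h φ) x) ; (inj₂ y) → inj₂ (to (⊨-rename h ψ) y) })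
    (λ { (inj₁ x) → inj₁ (from (⊨-rename h φ) x) ; (inj₂ y) → inj₂ (from (⊨-rename h ψ) y) })
  ⊨-rename h (φ ⇒ ψ) = mk⇔
    (λ f x → to (⊨-rename h ψ) (f (from (⊨-rename h φ) x)))
    (λ f x → from (⊨-rename h ψ) (f (to (⊨-rename h φ) x)))
  ⊨-rename h (∀′ φ) = mk⇔
    (λ f x → to (⊨-rename (agree-lift x h) φ) (f x))
    (λ f x → from (⊨-rename (agree-lift x h) φ) (f x))
  ⊨-rename h (∃′ φ) = mk⇔
    (λ (x , y) → x , to (⊨-rename (agree-lift x h) φ) y)
    (λ (x , y) → x , from (⊨-rename (agree-lift x h) φ) y)

  -- Closure of the definable unary functions under a parameter-free definable operation.
  definable-lift₂ : (h : Carrier M → Carrier M → Carrier M) (χ : Formula L 3) →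
    (∀ x y z → (z ≡ h x y) ⇔ (M ⊨ χ [ x ∷ y ∷ z ∷ [] ])) →
    (f g : Carrier M → Carrier M) →
    DefinableFunction M f → DefinableFunction M g →
    DefinableFunction M (λ t → h (f t) (g t))
  definable-lift₂ h χ hχ f g (m , p , φ , hφ) (l , q , ψ , hψ) =
    m ℕ.+ l , p ++ q , ∃′ (∃′ (rename ρ φ ∧ (rename ρ′ ψ ∧ rename ρ″ χ))) ,
    λ { (t ∷ z ∷ []) → mk⇔ (fwd t z) (bwd t z) }
    where
    -- The environment is y ∷ x ∷ t ∷ z ∷ p ++ q, with x = f t, y = g t and z = h x y.
    ρ : Fin (2 ℕ.+ m) → Fin (4 ℕ.+ (m ℕ.+ l))
    ρ zero          = suc (suc zero)
    ρ (suc zero)    = suc zero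
    ρ (suc (suc i)) = suc (suc (suc (suc (i ↑ˡ l))))

    ρ′ : Fin (2 ℕ.+ l) → Fin (4 ℕ.+ (m ℕ.+ l))
    ρ′ zero          = suc (suc zero)
    ρ′ (suc zero)    = zero
    ρ′ (suc (suc i)) = suc (suc (suc (suc (m ↑ʳ i))))

    ρ″ : Fin 3 → Fin (4 ℕ.+ (m ℕ.+ l))
    ρ″ zero             = suc zero
    ρ″ (suc zero)       = zero
    ρ″ (suc (suc zero)) = suc (suc (suc zero))

    module _ (t z x y : Carrier M) where
      agree : Agree ρ (t ∷ x ∷ p) (y ∷ x ∷ t ∷ z ∷ p ++ q)
      agree zero          = refl
      agree (suc zero)    = refl
      agree (suc (suc i)) = lookup-++ˡ p q i

      agree′ : Agree ρ′ (t ∷ y ∷ q) (y ∷ x ∷ t ∷ z ∷ p ++ q)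
      agree′ zero          = refl
      agree′ (suc zero)    = refl
      agree′ (suc (suc i)) = lookup-++ʳ p q i

      agree″ : Agree ρ″ (x ∷ y ∷ z ∷ []) (y ∷ x ∷ t ∷ z ∷ p ++ q)
      agree″ zero             = refl
      agree″ (suc zero)       = refl
      agree″ (suc (suc zero)) = refl

    fwd : ∀ t z → z ≡ h (f t) (g t) →
          M ⊨ ∃′ (∃′ (rename ρ φ ∧ (rename ρ′ ψ ∧ rename ρ″ χ))) [ t ∷ z ∷ p ++ q ]
    fwd t z e = f t , g t ,
      from (⊨-rename (agree t z (f t) (g t)) φ) (to (hφ (t ∷ f t ∷ [])) refl) ,
      from (⊨-rename (agree′ t z (f t) (g t)) ψ) (to (hψ (t ∷ g t ∷ [])) refl) ,
      from (⊨-rename (agree″ t z (f t) (g t)) χ) (to (hχ (f t) (g t) z) e)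

    bwd : ∀ t z →
          M ⊨ ∃′ (∃′ (rename ρ φ ∧ (rename ρ′ ψ ∧ rename ρ″ χ))) [ t ∷ z ∷ p ++ q ] →
          z ≡ h (f t) (g t)
    bwd t z (x , y , a , b , c) =
      trans (from (hχ x y z) (to (⊨-rename (agree″ t z x y) χ) c))
        (cong₂ h (from (hφ (t ∷ x ∷ [])) (to (⊨-rename (agree t z x y) φ) a))
                 (from (hψ (t ∷ y ∷ [])) (to (⊨-rename (agree′ t z x y) ψ) b)))

-- A topology is given by its predicate "is open".
Topology : Set → (ℓ : Level) → Set _
Topology X ℓ = Pred (Pred X 0ℓ) ℓ

Continuous : {X Y : Set} → Topology X ℓ₁ → Topology Y ℓ₂ → (X → Y) → Set _
Continuous OpenX OpenY f = ∀ V → OpenY V → OpenX (f ⊢ V)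

Subspace : {X Y : Set} → Topology X 0ℓ → (Y → X) → Topology Y _
Subspace OpenX incl V = ∃ λ U → OpenX U × (∀ y → V y ⇔ U (incl y))

IsHomeomorphism : (S T : Setoid 0ℓ 0ℓ) →
  Topology (Setoid.Carrier S) ℓ₁ → Topology (Setoid.Carrier T) ℓ₂ →
  (Setoid.Carrier S → Setoid.Carrier T) → Set _
IsHomeomorphism S T OpenS OpenT f = ∃ λ g →
  IsInverse (Setoid._≈_ S) (Setoid._≈_ T) f g ×
  Continuous OpenS OpenT f × Continuous OpenT OpenS g

module Germs (M : Structure L) (isRCF : IsRealClosedOrderedField M) where
  open Structure M using (0#; _<_; _+_; _-_)
  open IsRealClosedOrderedField isRCF using (isStrictTotalOrder)

  strictTotalOrder : StrictTotalOrder 0ℓ 0ℓ 0ℓ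
  strictTotalOrder = record { isStrictTotalOrder = isStrictTotalOrder }

  open StrictTotalOrder strictTotalOrder using (compare) renaming (trans to <-trans)
  open STOProperties strictTotalOrder using (_≤_; totalOrder)
  open Max totalOrder using (_⊔_; x≤y⇒x⊔y≈y; x≤y⇒y⊔x≈y)

  ∣_∣ : Carrier M → Carrier M
  ∣ x ∣ = x ⊔ (0# - x)

  dist : Vec (Carrier M) k → Vec (Carrier M) k → Carrier M
  dist x y = foldr′ _⊔_ 0# (zipWith (λ xⱼ yⱼ → ∣ xⱼ - yⱼ ∣) x y)

  ball : Vec (Carrier M) k → Carrier M → Pred (Vec (Carrier M) k) 0ℓ
  ball a ε b = dist b a < ε

  Ioo : Carrier M → Pred (Carrier M) 0ℓ
  Ioo ε t = (0# < t) × (t < ε)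

  Eventually : Pred (Carrier M) 0ℓ → Set
  Eventually P = ∃ λ ε → (0# < ε) × (∀ t → t ∈ Ioo ε → P t)

  min-pos : ∀ {ε δ} → 0# < ε → 0# < δ →
            ∃ λ η → (0# < η) × (∀ {t} → t < η → (t < ε) × (t < δ))
  min-pos {ε} {δ} 0<ε 0<δ with compare ε δ
  ... | tri< ε<δ _ _  = ε , 0<ε , λ t<ε → t<ε , <-trans t<ε ε<δ
  ... | tri≈ _ refl _ = ε , 0<ε , λ t<ε → t<ε , t<ε
  ... | tri> _ _ δ<ε  = δ , 0<δ , λ t<δ → <-trans t<δ δ<ε , t<δ

  eventually-map₂ : ∀ {P Q R : Pred (Carrier M) 0ℓ} →
                    (∀ {t} → P t → Q t → R t) → Eventually P → Eventually Q → Eventually R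
  eventually-map₂ f (_ , 0<ε , p) (_ , 0<δ , q) with min-pos 0<ε 0<δ
  ... | η , 0<η , h = η , 0<η , λ t (0<t , t<η) →
    f (p t (0<t , proj₁ (h t<η))) (q t (0<t , proj₂ (h t<η)))

  -- Representatives of germs at 0⁺.  Totality of fn loses nothing: a definable function on
  -- (0, ε) has the same germ as its extension by 0#.
  record 𝒦 : Set where
    field
      fn        : Carrier M → Carrier M
      definable : DefinableFunction M fn

  open 𝒦 public using (fn)

  infix 4 _≈ᴷ_ _<ᴷ_

  _≈ᴷ_ _<ᴷ_ : 𝒦 → 𝒦 → Set
  x ≈ᴷ y = Eventually λ t → fn x t ≡ fn y t
  x <ᴷ y = Eventually λ t → fn x t < fn y t

  const : Carrier M → 𝒦
  const c = record
    { fn        = λ _ → c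
    ; definable = 1 , c ∷ [] , var (suc zero) ≐ var (suc (suc zero)) ,
                  λ { (t ∷ y ∷ []) → mk⇔ (λ e → e) (λ e → e) }
    }

  infixl 6 _-ᴷ_ _⊔ᴷ_

  _-ᴷ_ : 𝒦 → 𝒦 → 𝒦
  x -ᴷ y = record
    { fn        = λ t → fn x t - fn y t
    ; definable = definable-lift₂ M _-_
        (var (suc (suc zero)) ≐
          func (Language.addˢ L) (var zero ∷ func (Language.negˢ L) (var (suc zero) ∷ []) ∷ []))
        (λ _ _ _ → mk⇔ (λ e → e) (λ e → e)) (fn x) (fn y) (𝒦.definable x) (𝒦.definable y)
    }

  _⊔ᴷ_ : 𝒦 → 𝒦 → 𝒦
  x ⊔ᴷ y = record
    { fn        = λ t → fn x t ⊔ fn y t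
    ; definable = definable-lift₂ M _⊔_
        ((lt ∧ (var (suc (suc zero)) ≐ var (suc zero)))
          ∨ ((lt ⇒ ⊥′) ∧ (var (suc (suc zero)) ≐ var zero)))
        (λ _ _ _ → mk⇔ fwd bwd) (fn x) (fn y) (𝒦.definable x) (𝒦.definable y)
    }
    where
    lt : Formula L 3
    lt = rel (Language.ltˢ L) (var zero ∷ var (suc zero) ∷ [])

    ≮⇒⊔ : ∀ {u v} → ¬ (u < v) → u ⊔ v ≡ u
    ≮⇒⊔ {u} {v} u≮v with compare u v
    ... | tri< u<v _ _ = ⊥-elim (u≮v u<v)
    ... | tri≈ _ u≡v _ = x≤y⇒y⊔x≈y (inj₂ (sym u≡v))
    ... | tri> _ _ v<u = x≤y⇒y⊔x≈y (inj₁ v<u)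

    fwd : ∀ {u v z} → z ≡ u ⊔ v → ((u < v) × z ≡ v) ⊎ (¬ (u < v) × z ≡ u)
    fwd {u} {v} e with compare u v
    ... | tri< u<v _ _ = inj₁ (u<v , trans e (x≤y⇒x⊔y≈y (inj₁ u<v)))
    ... | tri≈ u≮v _ _ = inj₂ (u≮v , trans e (≮⇒⊔ u≮v))
    ... | tri> u≮v _ _ = inj₂ (u≮v , trans e (≮⇒⊔ u≮v))

    bwd : ∀ {u v z} → ((u < v) × z ≡ v) ⊎ (¬ (u < v) × z ≡ u) → z ≡ u ⊔ v
    bwd (inj₁ (u<v , refl)) = sym (x≤y⇒x⊔y≈y (inj₁ u<v))
    bwd (inj₂ (u≮v , refl)) = sym (≮⇒⊔ u≮v)

  ∣_∣ᴷ : 𝒦 → 𝒦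
  ∣ x ∣ᴷ = x ⊔ᴷ (const 0# -ᴷ x)

  distᴷ : Vec 𝒦 n → Vec 𝒦 n → 𝒦
  distᴷ x y = foldr′ _⊔ᴷ_ (const 0#) (zipWith (λ xⱼ yⱼ → ∣ xⱼ -ᴷ yⱼ ∣ᴷ) x y)

  𝒦-setoid : Setoid 0ℓ 0ℓ
  𝒦-setoid = record
    { Carrier       = 𝒦
    ; _≈_           = _≈ᴷ_
    ; isEquivalence = record
      { refl  = ε₀ , 0<ε₀ , λ _ _ → refl
      ; sym   = λ (ε , 0<ε , h) → ε , 0<ε , λ t t∈ → sym (h t t∈)
      ; trans = eventually-map₂ trans
      }
    }
    where
    positive : ∃ λ ε → 0# < ε
    positive with compare 0# (Structure.1# M)
    ... | tri< 0<1 _ _ = Structure.1# M , 0<1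
    ... | tri≈ _ 0≡1 _ = ⊥-elim (IsRealClosedOrderedField.0≢1 isRCF 0≡1)
    ... | tri> _ _ 1<0 = Structure.-_ M (Structure.1# M) ,
      subst₂-< (proj₂ R.-‿inverse _) (R.+-identityˡ _)
        (IsRealClosedOrderedField.+-mono-< isRCF _ _ _ 1<0)
      where
      module R = IsCommutativeRing (IsRealClosedOrderedField.isCommutativeRing isRCF)
      subst₂-< : ∀ {u v u′ v′} → u ≡ u′ → v ≡ v′ → u < v → u′ < v′
      subst₂-< refl refl h = h

    ε₀ = proj₁ positive
    0<ε₀ = proj₂ positive

  Infinitesimal : Pred 𝒦 0ℓ
  Infinitesimal x = ∀ c → 0# < c → ∣ x ∣ᴷ <ᴷ const c

  𝔪 : Set
  𝔪 = Σ 𝒦 Infinitesimal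

  𝔪^ : ℕ → Setoid 0ℓ 0ℓ
  𝔪^ n = record
    { Carrier       = Vec 𝔪 n
    ; _≈_           = Pointwise.Pointwise (λ x y → proj₁ x ≈ᴷ proj₁ y)
    ; isEquivalence = Pointwise.isEquivalence (record
        { refl  = λ {x} → Setoid.refl 𝒦-setoid {proj₁ x}
        ; sym   = λ {x} {y} → Setoid.sym 𝒦-setoid {proj₁ x} {proj₁ y}
        ; trans = λ {x} {y} {z} → Setoid.trans 𝒦-setoid {proj₁ x} {proj₁ y} {proj₁ z}
        }) n
    }

  -- 𝒦-metrics are given by their graphs: d x y r says that the distance from x to y is r.
  Metric : Set → Set₁
  Metric X = X → X → 𝒦 → Set

  metricTopology : ∀ {X : Set} → Metric X → Topology X 0ℓ
  metricTopology d U = ∀ x → U x →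
    ∃ λ r → (const 0# <ᴷ r) × (∀ y → (∃ λ e → d x y e × (e <ᴷ r)) → U y)

  𝔪-metric : Metric (Vec 𝔪 n)
  𝔪-metric x y e = distᴷ (map proj₁ x) (map proj₁ y) ≈ᴷ e

  IsSup IsInf : Pred (Carrier M) 0ℓ → Carrier M → Set
  IsSup S r = (∀ s → S s → s ≤ r) × (∀ b → (∀ s → S s → s ≤ b) → r ≤ b)
  IsInf S r = (∀ s → S s → r ≤ s) × (∀ b → (∀ s → S s → b ≤ s) → b ≤ r)

  IsDistTo : Pred (Vec (Carrier M) k) 0ℓ → Vec (Carrier M) k → Carrier M → Set
  IsDistTo B x = IsInf λ s → ∃ λ y → y ∈ B × s ≡ dist x y

  IsExcess : (A B : Pred (Vec (Carrier M) k) 0ℓ) → Carrier M → Set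
  IsExcess A B = IsSup λ s → ∃ λ x → x ∈ A × IsDistTo B x s

  IsHausdorffDistance : (A B : Pred (Vec (Carrier M) k) 0ℓ) → Carrier M → Set
  IsHausdorffDistance A B r =
    ∃ λ r₁ → ∃ λ r₂ → IsExcess A B r₁ × IsExcess B A r₂ × r ≡ r₁ ⊔ r₂

  -- Only the values on (0, ε) matter, the others are arbitrary.
  record IsCurve (ε : Carrier M) (a : Vec (Carrier M) k) (γ : Carrier M → Vec (Carrier M) k) :
                 Set where
    field
      definable  : Definable {n = suc k} M (λ v → head v ∈ Ioo ε × tail v ≡ γ (head v))
      continuous : ∀ t → t ∈ Ioo ε → ∀ η → 0# < η → ∃ λ δ → (0# < δ) ×
                     (∀ s → s ∈ Ioo ε → ∣ s - t ∣ < δ → dist (γ s) (γ t) < η)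
      limit      : ∀ η → 0# < η → ∃ λ δ → (0# < δ) ×
                     (∀ t → t ∈ Ioo ε → t < δ → dist (γ t) a < η)

  image : Carrier M → (Carrier M → Vec (Carrier M) k) → Pred (Vec (Carrier M) k) 0ℓ
  image ε γ b = ∃ λ t → t ∈ Ioo ε × b ≡ γ t

  SameGermAt : Vec (Carrier M) k → (A B : Pred (Vec (Carrier M) k) 0ℓ) → Set
  SameGermAt a A B = ∃ λ ε → (0# < ε) × (∀ b → b ∈ ball a ε → A b ⇔ B b)

  -- The representatives of germs in 𝒢 a.  They are already shrunk, so that near a the image
  -- reflects only the behaviour of the curve as t → 0.
  record Curve (a : Vec (Carrier M) k) : Set where
    field
      at      : Carrier M → Vec (Carrier M) k
      isCurve : IsCurve (Structure.1# M) a at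
      shrunk  : (∀ s t → s ∈ Ioo (Structure.1# M) → t ∈ Ioo (Structure.1# M) → s < t →
                   dist (at s) a < dist (at t) a)
              ⊎ (∀ t → t ∈ Ioo (Structure.1# M) → at t ≡ a)

  ⟪_⟫ : {a : Vec (Carrier M) k} → Curve a → Pred (Vec (Carrier M) k) 0ℓ
  ⟪ γ ⟫ = image (Structure.1# M) (Curve.at γ)

  𝒢 : Vec (Carrier M) k → Setoid 0ℓ 0ℓ
  𝒢 a = record
    { Carrier       = Curve a
    ; _≈_           = λ γ σ → SameGermAt a ⟪ γ ⟫ ⟪ σ ⟫
    ; isEquivalence = record
      { refl  = let ε , 0<ε , _ = Setoid.refl 𝒦-setoid {const 0#}
                in ε , 0<ε , λ _ _ → mk⇔ (λ z → z) (λ z → z)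
      ; sym   = λ (ε , 0<ε , h) → ε , 0<ε , λ b b∈ →
                  mk⇔ (from (h b b∈)) (to (h b b∈))
      ; trans = λ (ε , 0<ε , g) (δ , 0<δ , h) → let η , 0<η , m = min-pos 0<ε 0<δ in
                  η , 0<η , λ b b∈ →
                    mk⇔ (to (h b (proj₂ (m b∈))) ∘ to (g b (proj₁ (m b∈))))
                        (from (g b (proj₁ (m b∈))) ∘ from (h b (proj₂ (m b∈))))
      }
    }
    where open Equivalence

  𝒢-metric : (a : Vec (Carrier M) k) → Metric (Curve a)
  𝒢-metric a γ σ e = Eventually λ t →
    IsHausdorffDistance (ball a t ∩ ⟪ γ ⟫) (ball a t ∩ ⟪ σ ⟫) (fn e t)

  Side : Sign → Carrier M → Pred (Carrier M) 0ℓ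
  Side Sign.+ aᵢ y = aᵢ < y
  Side Sign.- aᵢ y = y < aᵢ

  shift : Sign → Carrier M → Carrier M → Carrier M
  shift Sign.+ aᵢ s = aᵢ + s
  shift Sign.- aᵢ s = aᵢ - s

  -- 𝒢± a i Sign.+ and 𝒢± a i Sign.- are the germs on either side of the hyperplane bᵢ = aᵢ.
  𝒢± : Vec (Carrier M) k → Fin k → Sign → Setoid 0ℓ 0ℓ
  𝒢± a i sgn = record
    { Carrier       = Σ (Curve a) λ γ →
                        Eventually λ t → Side sgn (lookup a i) (lookup (Curve.at γ t) i)
    ; _≈_           = λ γ δ → Setoid._≈_ (𝒢 a) (proj₁ γ) (proj₁ δ)
    ; isEquivalence = record
      { refl  = λ {γ} → Setoid.refl (𝒢 a) {proj₁ γ}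
      ; sym   = λ {γ} {δ} → Setoid.sym (𝒢 a) {proj₁ γ} {proj₁ δ}
      ; trans = λ {γ} {δ} {ζ} → Setoid.trans (𝒢 a) {proj₁ γ} {proj₁ δ} {proj₁ ζ}
      }
    }

  𝒢±-topology : (a : Vec (Carrier M) k) (i : Fin k) (sgn : Sign) →
                Topology (Setoid.Carrier (𝒢± a i sgn)) _
  𝒢±-topology a i sgn = Subspace (metricTopology (𝒢-metric a)) proj₁

  𝔪-topology : (n : ℕ) → Topology (Vec 𝔪 n) 0ℓ
  𝔪-topology n = metricTopology 𝔪-metric

  -- u : (0, ε) → Mⁿ gives a normalized representative s ↦ insᵢ (u s, aᵢ ± s) of the germ of γ.
  record IsNormalizedBy (a : Vec (Carrier M) (suc n)) (i : Fin (suc n)) (sgn : Sign) (γ : Curve a)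
                        (ε : Carrier M) (u : Carrier M → Vec (Carrier M) n) : Set where
    field
      0<ε        : 0# < ε
      isCurve    : IsCurve ε (removeAt a i) u
      represents : SameGermAt a ⟪ γ ⟫
                     (image ε (λ s → insertAt (u s) i (shift sgn (lookup a i) s)))

  -- ι [γ] = [u - a_î] for a normalized representative u of [γ].  As such u exist and have a unique
  -- germ, this determines ι up to equality in 𝔪^ n.
  IsNormalization : (a : Vec (Carrier M) (suc n)) (i : Fin (suc n)) (sgn : Sign) →
                    (Setoid.Carrier (𝒢± a i sgn) → Vec 𝔪 n) → Set
  IsNormalization a i sgn ι = ∀ γ → ∃ λ ε → ∃ λ u →
    IsNormalizedBy a i sgn (proj₁ γ) ε u ×
    Eventually (λ s → map (λ x → fn (proj₁ x) s) (ι γ) ≡ zipWith _-_ (u s) (removeAt a i))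

{-# OPTIONS --safe #-}
module Submission where

-- A germ on one side of the hyperplane bᵢ = aᵢ is the germ at a of an arc
-- { insᵢ(a_î + x(s), aᵢ ± s) : s > 0 } with x ∈ 𝔪ⁿ, because the height along the curve is a positive
-- infinitesimal germ, hence eventually strictly increasing onto an interval, and so can serve as the
-- parameter.  For the topologies the curves are compared at equal distance from a instead: then
-- truncating them by balls around a does no harm to Hausdorff distances.  The distance to a is a
-- positive infinitesimal germ as well, so passing between the two parametrizations costs a modulus of
-- continuity, and such moduli can be chosen definably, as half a supremum, hence lie in 𝒦.
--
-- The monotonicity theorem is needed for infinitesimal germs only, where it follows directly from the
-- facts that a definable subset of the line contains or avoids an interval to the right of each point
-- and that it has an infimum when it is nonempty and bounded below.

open import Level using (0ℓ)
open import Axiom.ExcludedMiddle using (ExcludedMiddle)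
open import Data.Nat.Base as ℕ using (ℕ; zero; suc)
open import Data.Fin.Base using (Fin; zero; suc; _↑ˡ_; _↑ʳ_; punchIn; punchOut)
open import Data.Fin.Properties using (_≟_; punchIn-punchOut)
open import Data.Vec.Base
  using (Vec; []; _∷_; _++_; head; tail; lookup; tabulate; insertAt; removeAt; map; zipWith)
open import Data.Vec.Properties
  using (lookup-++ˡ; lookup-++ʳ; lookup∘tabulate; tabulate∘lookup; tabulate-cong; lookup-zipWith;
         lookup-map; insertAt-lookup; insertAt-punchIn; insertAt-removeAt; removeAt-insertAt)
open import Data.Vec.Relation.Binary.Pointwise.Inductive using (Pointwise; []; _∷_)
open import Data.List.Base using ([]; _∷_)
open import Data.List.Relation.Unary.Any as Any using (Any; here; there)
open import Data.Sign.Base using (Sign)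
open import Data.Product.Base as Product using (∃; _×_; _,_; proj₁; proj₂)
open import Data.Sum.Base as Sum using (_⊎_; inj₁; inj₂; [_,_]′)
open import Data.Empty using (⊥; ⊥-elim)
open import Function.Base using (_∘_; id)
open import Function.Bundles using (_⇔_; mk⇔; Equivalence)
open import Function.Structures using (IsInverse)
open import Relation.Nullary using (¬_; Dec; yes; no)
open import Relation.Nullary.Construct.Add.Extrema using ([_]; ⊥±; ⊤±)
open import Relation.Unary using (_∩_)
open import Relation.Binary.Bundles using (Setoid; StrictTotalOrder)
open import Relation.Binary.Definitions using (tri<; tri≈; tri>)
open import Relation.Binary.PropositionalEquality
  using (_≡_; refl; sym; trans; cong; cong₂; subst; subst₂; module ≡-Reasoning)
import Relation.Binary.Construct.Add.Extrema.Strict as Extrema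
import Relation.Binary.Properties.StrictTotalOrder as STOProperties
import Algebra.Construct.NaturalChoice.Max as Max
open import Algebra.Structures using (IsCommutativeRing)
open import Defs

-- The metric on `𝔪` compares two arcs at equal height, whereas the Hausdorff distance at `t`
-- involves all their points at distance less than `t` from `a`. The height never exceeds the
-- distance to `a`, so smallness in distance gives smallness in height for free; only the converse
-- passage costs something. Bounding every modulus by `t` makes it infinitesimal, so that `rising`
-- applies to it and an estimate at one scale carries over to larger scales. In the passage from
-- Hausdorff distance back to coordinates, the second curve may a priori be constant or leave the
-- chosen side. A point at distance `τ` from `a` is examined in the ball of radius `τ + τ`, well
-- inside its boundary. The tolerances are kept below the height of the point of the first curve,
-- which prevents crossing the hyperplane, and below half the scale, which rules out the constant
-- curve. Hence being on one side is an open condition, and continuity can be proved with open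
-- subsets of the whole space of germs.

-- Closure properties of definable sets and functions.

module Definability {L : Language} (M : Structure L) where
  open Structure M renaming (Carrier to C)
  open Equivalence

  private variable
    k m n l : ℕ
    P Q : Vec C n → Set
    f g h : Vec C n → C

  Def : (Vec C n → Set) → Set
  Def = Definable M

  -- The value is variable zero, where `∃ᵈ` can eliminate it. The record wrapper lets `f` be
  -- inferred from the type `Fun f`.
  record Fun (f : Vec C n → C) : Set where
    constructor fun
    field graph : Def (λ v → lookup v zero ≡ f (tail v))

  open Fun

  Def₁ : (C → Set) → Set
  Def₁ A = Def {1} (λ v → A (lookup v zero))

  Def₂ : (C → C → Set) → Set
  Def₂ R = Def {2} (λ v → R (lookup v zero) (lookup v (suc zero)))

  -- Two formulas are combined over the concatenation of their parameter tuples. The recursion on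
  -- `n` keeps the free variables shared and moves only the parameter indices.
  paramˡ : ∀ n → Fin (n ℕ.+ m) → Fin (n ℕ.+ (m ℕ.+ l))
  paramˡ zero    i       = i ↑ˡ _
  paramˡ (suc n) zero    = zero
  paramˡ (suc n) (suc i) = suc (paramˡ n i)

  paramʳ : ∀ n m → Fin (n ℕ.+ l) → Fin (n ℕ.+ (m ℕ.+ l))
  paramʳ zero    m i       = m ↑ʳ i
  paramʳ (suc n) m zero    = zero
  paramʳ (suc n) m (suc i) = suc (paramʳ n m i)

  agree-paramˡ : (v : Vec C n) (p : Vec C m) (q : Vec C l) →
                 Agree M (paramˡ n) (v ++ p) (v ++ (p ++ q))
  agree-paramˡ []      p q i       = lookup-++ˡ p q i
  agree-paramˡ (x ∷ v) p q zero    = refl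
  agree-paramˡ (x ∷ v) p q (suc i) = agree-paramˡ v p q i

  agree-paramʳ : (v : Vec C n) (p : Vec C m) (q : Vec C l) →
                 Agree M (paramʳ n m) (v ++ q) (v ++ (p ++ q))
  agree-paramʳ []      p q i       = lookup-++ʳ p q i
  agree-paramʳ (x ∷ v) p q zero    = refl
  agree-paramʳ (x ∷ v) p q (suc i) = agree-paramʳ v p q i

  abstract
    resp : (∀ v → P v ⇔ Q v) → Def P → Def Q
    resp h (m , p , φ , hφ) = m , p , φ , λ v → mk⇔
      (to (hφ v) ∘ from (h v)) (to (h v) ∘ from (hφ v))

    module _ {P Q : Vec C n → Set} (_∙_ : Set → Set → Set)
             (_∙ᶠ_ : ∀ {j} → Formula L j → Formula L j → Formula L j)
             (sound : ∀ {j} (φ ψ : Formula L j) v →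
                      (M ⊨ φ ∙ᶠ ψ [ v ]) ≡ ((M ⊨ φ [ v ]) ∙ (M ⊨ ψ [ v ])))
             (congruent : ∀ {A A′ B B′} → A ⇔ A′ → B ⇔ B′ → (A ∙ B) ⇔ (A′ ∙ B′)) where

      connective : Def P → Def Q → Def (λ v → P v ∙ Q v)
      connective (m , p , φ , hφ) (l , q , ψ , hψ) =
        m ℕ.+ l , p ++ q , (rename (paramˡ n) φ ∙ᶠ rename (paramʳ n m) ψ) , λ v →
          subst (_ ⇔_) (sym (sound (rename (paramˡ n) φ) (rename (paramʳ n m) ψ) (v ++ (p ++ q))))
            (congruent (flip⇔ (⊨-rename M (agree-paramˡ v p q) φ) (hφ v))
                       (flip⇔ (⊨-rename M (agree-paramʳ v p q) ψ) (hψ v)))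
        where
        flip⇔ : ∀ {A B D : Set} → B ⇔ D → A ⇔ D → A ⇔ B
        flip⇔ e e′ = mk⇔ (from e ∘ to e′) (from e′ ∘ to e)

    infixr 7 _×ᵈ_
    infixr 6 _⊎ᵈ_
    infixr 5 _→ᵈ_

    _×ᵈ_ : Def P → Def Q → Def (λ v → P v × Q v)
    _×ᵈ_ = connective _×_ _∧_ (λ _ _ _ → refl)
      λ e e′ → mk⇔ (Product.map (to e) (to e′)) (Product.map (from e) (from e′))

    _⊎ᵈ_ : Def P → Def Q → Def (λ v → P v ⊎ Q v)
    _⊎ᵈ_ = connective _⊎_ _∨_ (λ _ _ _ → refl)
      λ e e′ → mk⇔ (Sum.map (to e) (to e′)) (Sum.map (from e) (from e′))

    _→ᵈ_ : Def P → Def Q → Def (λ v → P v → Q v)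
    _→ᵈ_ = connective (λ A B → A → B) _⇒_ (λ _ _ _ → refl)
      λ e e′ → mk⇔ (λ h → to e′ ∘ h ∘ from e) (λ h → from e′ ∘ h ∘ to e)

    ⊥ᵈ : Def {n} (λ _ → ⊥)
    ⊥ᵈ = 0 , [] , ⊥′ , λ v → mk⇔ id id

    ¬ᵈ_ : Def P → Def (λ v → ¬ P v)
    ¬ᵈ d = d →ᵈ ⊥ᵈ

    ∃ᵈ : Def P → Def (λ v → ∃ λ x → P (x ∷ v))
    ∃ᵈ (m , p , φ , hφ) = m , p , ∃′ φ , λ v →
      mk⇔ (λ (x , y) → x , to (hφ (x ∷ v)) y) (λ (x , y) → x , from (hφ (x ∷ v)) y)

    ∀ᵈ : Def P → Def (λ v → ∀ x → P (x ∷ v))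
    ∀ᵈ (m , p , φ , hφ) = m , p , ∀′ φ , λ v →
      mk⇔ (λ h x → to (hφ (x ∷ v)) (h x)) (λ h x → from (hφ (x ∷ v)) (h x))

    allᵈ : {R : Fin k → Vec C n → Set} → (∀ j → Def (R j)) → Def (λ v → ∀ j → R j v)
    allᵈ {zero}  d = resp (λ v → mk⇔ (λ _ ()) (λ _ ())) (⊥ᵈ →ᵈ ⊥ᵈ)
    allᵈ {suc k} d = resp
      (λ v → mk⇔ (λ { (r , rs) zero → r ; (r , rs) (suc j) → rs j }) (λ r → r zero , r ∘ suc))
      (d zero ×ᵈ allᵈ (d ∘ suc))

    anyᵈ : ∀ k {R : Vec C (k ℕ.+ n) → Set} → Def R → Def (λ v → ∃ λ (b : Vec C k) → R (b ++ v))
    anyᵈ zero    d = resp (λ v → mk⇔ ([] ,_) (λ { ([] , r) → r })) d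
    anyᵈ (suc k) d = resp
      (λ v → mk⇔ (λ (b , x , r) → x ∷ b , r) (λ { (x ∷ b , r) → b , x , r }))
      (anyᵈ k (∃ᵈ d))

    reindex : (ρ : Fin m → Fin n) → Def P → Def (λ v → P (tabulate (lookup v ∘ ρ)))
    reindex {m} {n} ρ (l , p , φ , hφ) = l , p , rename (ρ⁺ _ ρ) φ , λ v →
      let e = ⊨-rename M (agree _ ρ v p) φ in
      mk⇔ (from e ∘ to (hφ _)) (from (hφ _) ∘ to e)
      where
      ρ⁺ : ∀ m → (Fin m → Fin n) → Fin (m ℕ.+ l) → Fin (n ℕ.+ l)
      ρ⁺ zero    ρ i       = n ↑ʳ i
      ρ⁺ (suc m) ρ zero    = ρ zero ↑ˡ l
      ρ⁺ (suc m) ρ (suc i) = ρ⁺ m (ρ ∘ suc) i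

      agree : ∀ m (ρ : Fin m → Fin n) v p → Agree M (ρ⁺ m ρ) (tabulate (lookup v ∘ ρ) ++ p) (v ++ p)
      agree zero    ρ v p i       = lookup-++ʳ v p i
      agree (suc m) ρ v p zero    = lookup-++ˡ v p (ρ zero)
      agree (suc m) ρ v p (suc i) = agree m (ρ ∘ suc) v p i

    weaken : Def P → Def (λ v → P (lookup v zero ∷ tail (tail v)))
    weaken {P = P} d = resp
      (λ { (x ∷ y ∷ v) → subst (λ w → P (x ∷ tabulate (lookup v)) ⇔ P (x ∷ w)) (tabulate∘lookup v) (mk⇔ id id) })
      (reindex (λ { zero → zero ; (suc i) → suc (suc i) }) d)

    -- Substitution is expressed by quantifying over a value equal to `f v`, which also covers
    -- functions that are not given by terms.
    subst₁ : Def P → Fun f → Def (λ v → P (f v ∷ v))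
    subst₁ {P = P} d fᵈ = resp
      (λ v → mk⇔ (λ { (x , refl , y) → y }) (λ y → _ , refl , y)) (∃ᵈ (graph fᵈ ×ᵈ d))

    weakenᶠ : Fun f → Fun (f ∘ tail)
    weakenᶠ fᵈ = fun (weaken (graph fᵈ))

    apply₁ : (A : C → Set) → Def₁ A → Fun f → Def (λ v → A (f v))
    apply₁ A d fᵈ = subst₁ (reindex (λ _ → zero) d) fᵈ

    apply₂ : (R : C → C → Set) → Def₂ R → Fun f → Fun g → Def (λ v → R (f v) (g v))
    apply₂ R d fᵈ gᵈ = subst₁ (subst₁ (reindex (λ { zero → suc zero ; (suc _) → zero }) d) (weakenᶠ gᵈ)) fᵈ

    apply₃ : (R : C → C → C → Set) →
             Def {3} (λ v → R (lookup v zero) (lookup v (suc zero)) (lookup v (suc (suc zero)))) →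
             Fun f → Fun g → Fun h → Def (λ v → R (f v) (g v) (h v))
    apply₃ R d fᵈ gᵈ hᵈ = subst₁ (subst₁ (subst₁
      (reindex (λ { zero → suc (suc zero) ; (suc zero) → suc zero ; (suc (suc _)) → zero }) d)
      (weakenᶠ (weakenᶠ hᵈ))) (weakenᶠ gᵈ)) fᵈ

    eq₂ : Def₂ _≡_
    eq₂ = 0 , [] , (var zero ≐ var (suc zero)) , λ { (x ∷ y ∷ []) → mk⇔ id id }

    lt₂ : Def₂ _<_
    lt₂ = 0 , [] , rel (Language.ltˢ L) (var zero ∷ var (suc zero) ∷ []) ,
      λ { (x ∷ y ∷ []) → mk⇔ id id }

    infix 8 _≡ᵈ_ _<ᵈ_ _≤ᵈ_

    _≡ᵈ_ : Fun f → Fun g → Def (λ v → f v ≡ g v)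
    _≡ᵈ_ = apply₂ _≡_ eq₂

    _<ᵈ_ : Fun f → Fun g → Def (λ v → f v < g v)
    _<ᵈ_ = apply₂ _<_ lt₂

    _≤ᵈ_ : Fun f → Fun g → Def (λ v → f v < g v ⊎ f v ≡ g v)
    fᵈ ≤ᵈ gᵈ = fᵈ <ᵈ gᵈ ⊎ᵈ fᵈ ≡ᵈ gᵈ

    Fun-resp : (∀ v → f v ≡ g v) → Fun f → Fun g
    Fun-resp e (fun d) = fun (resp (λ v → mk⇔ (λ h → trans h (e (tail v))) (λ h → trans h (sym (e (tail v))))) d)

    # : (i : Fin n) → Fun (λ v → lookup v i)
    # i = fun (0 , [] , (var zero ≐ var (suc (i ↑ˡ 0))) ,
      λ { (x ∷ v) → mk⇔ (λ e → trans e (sym (lookup-++ˡ v [] i)))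
                        (λ e → trans e (lookup-++ˡ v [] i)) })

    constᵈ : (c : C) → Fun {n} (λ _ → c)
    constᵈ {n} c = fun (1 , c ∷ [] , (var zero ≐ var (suc (n ↑ʳ zero))) ,
      λ { (x ∷ v) → mk⇔ (λ e → trans e (sym (lookup-++ʳ v (c ∷ []) zero)))
                        (λ e → trans e (lookup-++ʳ v (c ∷ []) zero)) })

    graph⇒Fun₁ : (u : C → C) → Def₂ (λ x z → z ≡ u x) → Fun f → Fun (λ v → u (f v))
    graph⇒Fun₁ u d fᵈ = fun (apply₂ (λ x z → z ≡ u x) d (weakenᶠ fᵈ) (# zero))

    graph⇒Fun₂ : (_∙_ : C → C → C) →
                 Def {3} (λ v → lookup v (suc (suc zero)) ≡ (lookup v zero ∙ lookup v (suc zero))) →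
                 Fun f → Fun g → Fun (λ v → f v ∙ g v)
    graph⇒Fun₂ _∙_ d fᵈ gᵈ =
      fun (apply₃ (λ x y z → z ≡ (x ∙ y)) d (weakenᶠ fᵈ) (weakenᶠ gᵈ) (# zero))

    infixl 9 _+ᵈ_ _-ᵈ_ _*ᵈ_

    _+ᵈ_ : Fun f → Fun g → Fun (λ v → f v + g v)
    _+ᵈ_ = graph⇒Fun₂ _+_ (0 , [] ,
      (var (suc (suc zero)) ≐ func (Language.addˢ L) (var zero ∷ var (suc zero) ∷ [])) ,
      λ { (x ∷ y ∷ z ∷ []) → mk⇔ id id })

    _*ᵈ_ : Fun f → Fun g → Fun (λ v → f v * g v)
    _*ᵈ_ = graph⇒Fun₂ _*_ (0 , [] ,
      (var (suc (suc zero)) ≐ func (Language.mulˢ L) (var zero ∷ var (suc zero) ∷ [])) ,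
      λ { (x ∷ y ∷ z ∷ []) → mk⇔ id id })

    _-ᵈ_ : Fun f → Fun g → Fun (λ v → f v - g v)
    _-ᵈ_ = graph⇒Fun₂ _-_ (0 , [] ,
      (var (suc (suc zero)) ≐ func (Language.addˢ L)
        (var zero ∷ func (Language.negˢ L) (var (suc zero) ∷ []) ∷ [])) ,
      λ { (x ∷ y ∷ z ∷ []) → mk⇔ id id })

    function : (u : C → C) → DefinableFunction M u → Fun f → Fun (λ v → u (f v))
    function u d = graph⇒Fun₁ u (resp (λ { (x ∷ z ∷ []) → mk⇔ id id }) d)

    Fun⇒function : {u : C → C} → Fun {1} (λ v → u (lookup v zero)) → DefinableFunction M u
    Fun⇒function (fun d) = resp (λ { (x ∷ z ∷ []) → mk⇔ id id })
      (reindex (λ { zero → suc zero ; (suc _) → zero }) d)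

-- Ordered field arithmetic, eventual statements, neighbourhoods and the sup metric.

module OrderedField {L : Language} (M : Structure L) (isRCF : IsRealClosedOrderedField M) where
  open Structure M renaming (Carrier to C) public
  open IsRealClosedOrderedField isRCF using (isCommutativeRing; +-mono-<; 0≢1; inverses; *-pos)
  open Germs M isRCF public
  open StrictTotalOrder strictTotalOrder using (compare; irrefl) renaming (trans to <-trans) public
  open STOProperties strictTotalOrder using (_≤_; totalOrder; antisym) renaming (trans to ≤-trans) public
  open Max totalOrder using (_⊔_; ⊔-comm; ⊔-assoc; ⊔-lub; x≤x⊔y; x≤y⊔x; x≤y⇒x⊔y≈y; x≤y⇒y⊔x≈y) public
  open IsCommutativeRing isCommutativeRing public
    using (+-comm; +-assoc; +-identityˡ; +-identityʳ; -‿inverseˡ; -‿inverseʳ)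
  module R = IsCommutativeRing isCommutativeRing

  private variable
    k n : ℕ
    c d u v w x y z : C
    P Q : C → Set

  ≤-refl : x ≤ x
  ≤-refl = inj₂ refl

  <-≤-trans : x < y → y ≤ z → x < z
  <-≤-trans p (inj₁ q)    = <-trans p q
  <-≤-trans p (inj₂ refl) = p

  ≤-<-trans : x ≤ y → y < z → x < z
  ≤-<-trans (inj₁ p)    q = <-trans p q
  ≤-<-trans (inj₂ refl) q = q

  <⊎≥ : ∀ x y → x < y ⊎ y ≤ x
  <⊎≥ x y with compare x y
  ... | tri< p _ _ = inj₁ p
  ... | tri≈ _ p _ = inj₂ (inj₂ (sym p))
  ... | tri> _ _ p = inj₂ (inj₁ p)

  <⇒≱ : x < y → ¬ (y ≤ x)
  <⇒≱ p q = irrefl refl (<-≤-trans p q)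

  ≮⇒≥ : ¬ (x < y) → y ≤ x
  ≮⇒≥ h = [ ⊥-elim ∘ h , id ]′ (<⊎≥ _ _)

  +-monoˡ-< : ∀ z → x < y → x + z < y + z
  +-monoˡ-< z = +-mono-< _ _ z

  +-monoʳ-< : ∀ z → x < y → z + x < z + y
  +-monoʳ-< z p = subst₂ _<_ (+-comm _ z) (+-comm _ z) (+-monoˡ-< z p)

  +-monoˡ-≤ : ∀ z → x ≤ y → x + z ≤ y + z
  +-monoˡ-≤ z (inj₁ p)    = inj₁ (+-monoˡ-< z p)
  +-monoˡ-≤ z (inj₂ refl) = ≤-refl

  +-monoʳ-≤ : ∀ z → x ≤ y → z + x ≤ z + y
  +-monoʳ-≤ z (inj₁ p)    = inj₁ (+-monoʳ-< z p)
  +-monoʳ-≤ z (inj₂ refl) = ≤-refl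

  +-cancelʳ-< : ∀ z → x + z < y + z → x < y
  +-cancelʳ-< z p = [ id , (λ q → ⊥-elim (<⇒≱ p (+-monoˡ-≤ z q))) ]′ (<⊎≥ _ _)

  +-cancelʳ-≤ : ∀ z → x + z ≤ y + z → x ≤ y
  +-cancelʳ-≤ z p = ≮⇒≥ λ q → <⇒≱ (+-monoˡ-< z q) p

  +-cancelʳ : ∀ z → x + z ≡ y + z → x ≡ y
  +-cancelʳ z p = antisym (+-cancelʳ-≤ z (inj₂ p)) (+-cancelʳ-≤ z (inj₂ (sym p)))

  +-cancelˡ-< : ∀ z → z + x < z + y → x < y
  +-cancelˡ-< z p = +-cancelʳ-< z (subst₂ _<_ (+-comm z _) (+-comm z _) p)

  +-exchange : ∀ x y z → x + (y + z) ≡ y + (x + z)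
  +-exchange x y z = trans (sym (+-assoc x y z)) (trans (cong (_+ z) (+-comm x y)) (+-assoc y x z))

  x-y+y≡x : ∀ x y → (x - y) + y ≡ x
  x-y+y≡x x y = trans (+-assoc x (- y) y) (trans (cong (x +_) (-‿inverseˡ y)) (+-identityʳ x))

  x+[y-x]≡y : ∀ x y → x + (y - x) ≡ y
  x+[y-x]≡y x y = trans (+-comm x _) (x-y+y≡x y x)

  x+y-y≡x : ∀ x y → (x + y) - y ≡ x
  x+y-y≡x x y = +-cancelʳ y (x-y+y≡x (x + y) y)

  x+y-x≡y : ∀ x y → (x + y) - x ≡ y
  x+y-x≡y x y = trans (cong (_- x) (+-comm x y)) (x+y-y≡x y x)

  0-[x-y]≡y-x : ∀ x y → 0# - (x - y) ≡ y - x
  0-[x-y]≡y-x x y = +-cancelʳ (x - y) (trans (x-y+y≡x 0# (x - y)) (sym (begin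
    (y - x) + (x - y)   ≡⟨ +-comm _ _ ⟩
    (x - y) + (y - x)   ≡⟨ +-assoc (x - y) y (- x) ⟨
    ((x - y) + y) - x   ≡⟨ cong (_- x) (x-y+y≡x x y) ⟩
    x - x               ≡⟨ -‿inverseʳ x ⟩
    0#                  ∎)))
    where open ≡-Reasoning

  x-[x-y]≡y : ∀ x y → x - (x - y) ≡ y
  x-[x-y]≡y x y = +-cancelʳ (x - y)
    (trans (x-y+y≡x x (x - y)) (sym (x+[y-x]≡y y x)))

  -‿mono-< : ∀ z → x < y → z - y < z - x
  -‿mono-< {x} {y} z p = +-cancelʳ-< y (subst₂ _<_ (sym (x-y+y≡x z y)) refl
    (subst (_< (z - x) + y) (x-y+y≡x z x) (+-monoʳ-< (z - x) p)))

  <⇒0<- : x < y → 0# < y - x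
  <⇒0<- {x} {y} p = +-cancelʳ-< x (subst₂ _<_ (sym (+-identityˡ x)) (sym (x-y+y≡x y x)) p)

  -- ∣ x - y ∣ ≤ c and ∣ x - y ∣ < c are handled in the following subtraction-free form.
  Close≤ Close< : C → C → C → Set
  Close≤ c x y = x ≤ c + y × y ≤ c + x
  Close< c x y = x < c + y × y < c + x

  sub-≤ : x ≤ c + y → x - y ≤ c
  sub-≤ {x} {c} {y} p = +-cancelʳ-≤ y (subst (_≤ c + y) (sym (x-y+y≡x x y)) p)

  ≤-sub : x - y ≤ c → x ≤ c + y
  ≤-sub {x} {y} {c} p = subst (_≤ c + y) (x-y+y≡x x y) (+-monoˡ-≤ y p)

  ∣-∣≤-intro : Close≤ c x y → ∣ x - y ∣ ≤ c
  ∣-∣≤-intro {c} {x} {y} (p , q) =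
    ⊔-lub (sub-≤ p) (subst (_≤ c) (sym (0-[x-y]≡y-x x y)) (sub-≤ q))

  ∣-∣≤-elim : ∣ x - y ∣ ≤ c → Close≤ c x y
  ∣-∣≤-elim {x} {y} {c} p =
    ≤-sub (≤-trans (x≤x⊔y _ _) p) ,
    ≤-sub (subst (_≤ c) (0-[x-y]≡y-x x y) (≤-trans (x≤y⊔x _ _) p))

  Close≤-<-trans : c < d → Close≤ c x y → Close< d x y
  Close≤-<-trans {x = x} {y} c<d (p , q) =
    ≤-<-trans p (+-monoˡ-< y c<d) , ≤-<-trans q (+-monoˡ-< x c<d)

  Close≤-trans : Close≤ c x y → Close≤ d y z → Close≤ (c + d) x z
  Close≤-trans {c} {x} {y} {d} {z} (p , q) (p′ , q′) =
    subst (x ≤_) (sym (+-assoc c d z)) (≤-trans p (+-monoʳ-≤ c p′)) ,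
    subst (z ≤_) (trans (+-exchange d c x) (sym (+-assoc c d x))) (≤-trans q′ (+-monoʳ-≤ d q))

  ∣-∣<-elim : ∣ x - y ∣ < c → Close< c x y
  ∣-∣<-elim p = Close≤-<-trans p (∣-∣≤-elim ≤-refl)

  ⊔-lub-< : x < z → y < z → x ⊔ y < z
  ⊔-lub-< {x} {z} {y} p q with <⊎≥ x y
  ... | inj₁ x<y = subst (_< z) (sym (x≤y⇒x⊔y≈y (inj₁ x<y))) q
  ... | inj₂ y≤x = subst (_< z) (sym (x≤y⇒y⊔x≈y y≤x)) p

  sub-< : x < c + y → x - y < c
  sub-< {x} {c} {y} p = +-cancelʳ-< y (subst (_< c + y) (sym (x-y+y≡x x y)) p)

  <-sub : x - y < c → x < c + y
  <-sub {x} {y} {c} p = subst (_< c + y) (x-y+y≡x x y) (+-monoˡ-< y p)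

  ∣-∣<-intro : Close< c x y → ∣ x - y ∣ < c
  ∣-∣<-intro {c} {x} {y} (p , q) =
    ⊔-lub-< (sub-< p) (subst (_< c) (sym (0-[x-y]≡y-x x y)) (sub-< q))

  0<1 : 0# < 1#
  0<1 with compare 0# 1#
  ... | tri< p _ _ = p
  ... | tri≈ _ p _ = ⊥-elim (0≢1 p)
  -- Here `0# - 1#` would be positive, and so would its square, which is `1#`.
  ... | tri> _ _ p = ⊥-elim (irrefl refl (<-trans p (subst (0# <_) 1≡ (*-pos _ _ q q))))
    where
    q : 0# < 0# - 1#
    q = <⇒0<- p
    1≡ : (0# - 1#) * (0# - 1#) ≡ 1#
    1≡ = +-cancelʳ (0# - 1#) (begin
      (0# - 1#) * (0# - 1#) + (0# - 1#)        ≡⟨ cong ((0# - 1#) * (0# - 1#) +_) (R.*-identityʳ _) ⟨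
      (0# - 1#) * (0# - 1#) + (0# - 1#) * 1#   ≡⟨ R.distribˡ _ _ _ ⟨
      (0# - 1#) * ((0# - 1#) + 1#)             ≡⟨ cong ((0# - 1#) *_) (x-y+y≡x 0# 1#) ⟩
      (0# - 1#) * 0#                           ≡⟨ R.zeroʳ _ ⟩
      0#                                       ≡⟨ x+[y-x]≡y 1# 0# ⟨
      1# + (0# - 1#)                           ∎)
      where open ≡-Reasoning

  -- Dilation by `δ` identifies `(0, 1)` with `(0, δ)`. It turns a short piece of an arc into a
  -- curve on the unit interval, as `Curve` prescribes.
  module Scaling {δ : C} (0<δ : 0# < δ) where
    *-monoʳ-< : x < y → δ * x < δ * y
    *-monoʳ-< {x} {y} x<y = subst₂ _<_ (+-identityʳ (δ * x))
      (trans (sym (R.distribˡ δ x (y - x))) (cong (δ *_) (x+[y-x]≡y x y)))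
      (+-monoʳ-< (δ * x) (*-pos δ (y - x) 0<δ (<⇒0<- x<y)))

    *-cancelʳ-< : δ * x < δ * y → x < y
    *-cancelʳ-< {x} {y} h with <⊎≥ x y
    ... | inj₁ x<y         = x<y
    ... | inj₂ (inj₁ y<x)  = ⊥-elim (<⇒≱ h (inj₁ (*-monoʳ-< y<x)))
    ... | inj₂ (inj₂ refl) = ⊥-elim (irrefl refl h)

    *-surjective : ∀ y → ∃ λ x → δ * x ≡ y
    *-surjective y = let r , δr≡1 = inverses δ (λ e → irrefl (sym e) 0<δ) in
      r * y , trans (sym (R.*-assoc δ r y)) (trans (cong (_* y) δr≡1) (R.*-identityˡ y))

    *-Ioo : Ioo 1# x → Ioo δ (δ * x)
    *-Ioo {x} (0<x , x<1) = subst (_< δ * x) (R.zeroʳ δ) (*-monoʳ-< 0<x) ,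
      subst (δ * x <_) (R.*-identityʳ δ) (*-monoʳ-< x<1)

    *-Ioo⁻¹ : Ioo δ (δ * x) → Ioo 1# x
    *-Ioo⁻¹ {x} (0<δx , δx<δ) = *-cancelʳ-< (subst (_< δ * x) (sym (R.zeroʳ δ)) 0<δx) ,
      *-cancelʳ-< (subst (δ * x <_) (sym (R.*-identityʳ δ)) δx<δ)

  x<x+c : 0# < c → x < x + c
  x<x+c {c} {x} p = subst (_< x + c) (+-identityʳ x) (+-monoʳ-< x p)

  x<c+x : 0# < c → x < c + x
  x<c+x {c} {x} p = subst (x <_) (+-comm x c) (x<x+c p)

  x-c<x : 0# < c → x - c < x
  x-c<x {c} {x} p = subst (x - c <_) (x-y+y≡x x c) (x<x+c p)

  +-pos : 0# < x → 0# < y → 0# < x + y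
  +-pos p q = <-trans p (x<x+c q)

  halve : ∀ x → ∃ λ h → h + h ≡ x
  halve x = r * x , (begin
    r * x + r * x     ≡⟨ R.distribʳ x r r ⟨
    (r + r) * x       ≡⟨ cong (_* x) (cong₂ _+_ (R.*-identityˡ r) (R.*-identityˡ r)) ⟨
    (1# * r + 1# * r) * x  ≡⟨ cong (_* x) (R.distribʳ r 1# 1#) ⟨
    ((1# + 1#) * r) * x    ≡⟨ cong (_* x) (proj₂ inv) ⟩
    1# * x            ≡⟨ R.*-identityˡ x ⟩
    x                 ∎)
    where
    open ≡-Reasoning
    inv = inverses (1# + 1#) λ e → irrefl (sym e) (+-pos 0<1 0<1)
    r = proj₁ inv

  double-cancel-< : x + x < y + y → x < y
  double-cancel-< {x} {y} p = [ id , (λ q → ⊥-elim (<⇒≱ p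
    (≤-trans (+-monoˡ-≤ y q) (+-monoʳ-≤ x q)))) ]′ (<⊎≥ x y)

  double-cancel : x + x ≡ y + y → x ≡ y
  double-cancel {x} {y} e with compare x y
  ... | tri< p _ _ = ⊥-elim (irrefl e (<-trans (+-monoˡ-< x p) (+-monoʳ-< y p)))
  ... | tri≈ _ p _ = p
  ... | tri> _ _ p = ⊥-elim (irrefl (sym e) (<-trans (+-monoˡ-< y p) (+-monoʳ-< x p)))

  abstract
    half-pos : 0# < x → ∃ λ h → h + h ≡ x × 0# < h × h < x
    half-pos {x} p with halve x
    ... | h , refl = h , refl , 0<h , x<x+c 0<h
      where
      0<h : 0# < h
      0<h = double-cancel-< (subst (_< h + h) (sym (+-identityʳ 0#)) p)

    dense : x < y → ∃ λ z → x < z × z < y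
    dense {x} {y} p with halve (x + y)
    ... | h , e = h , double-cancel-< (subst (x + x <_) (sym e) (+-monoʳ-< x p))
                    , double-cancel-< (subst (_< y + y) (sym e) (+-monoˡ-< y p))

    -- The last component passes strict lower bounds on to `z`; with `0#` for `w` it gives
    -- positivity.
    minimum : ∀ x y → ∃ λ z → z ≤ x × z ≤ y × (∀ w → w < x → w < y → w < z)
    minimum x y with <⊎≥ x y
    ... | inj₁ p = x , ≤-refl , inj₁ p , λ _ q _ → q
    ... | inj₂ p = y , p , ≤-refl , λ _ _ q → q

    maximum : ∀ x y → ∃ λ z → x ≤ z × y ≤ z × (∀ w → x < w → y < w → z < w)
    maximum x y with <⊎≥ x y
    ... | inj₁ p = y , inj₁ p , ≤-refl , λ _ _ q → q
    ... | inj₂ p = x , ≤-refl , p , λ _ q _ → q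

    ev-map : (∀ {t} → P t → Q t) → Eventually P → Eventually Q
    ev-map f (ε , 0<ε , h) = ε , 0<ε , λ t t∈ → f (h t t∈)

    ev-× : Eventually P → Eventually Q → Eventually (λ t → P t × Q t)
    ev-× = eventually-map₂ _,_

    ev-< : 0# < x → Eventually (_< x)
    ev-< {x} 0<x = x , 0<x , λ _ → proj₂

    ev-pos : Eventually (0# <_)
    ev-pos = 1# , 0<1 , λ _ → proj₁

    ev-all : {P : Fin k → C → Set} → (∀ j → Eventually (P j)) → Eventually (λ t → ∀ j → P j t)
    ev-all {zero}  h = 1# , 0<1 , λ _ _ ()
    ev-all {suc k} h = eventually-map₂
      (λ { p q zero → p ; p q (suc j) → q j }) (h zero) (ev-all (h ∘ suc))

    ev-witness : 0# < x → Eventually P → ∃ λ t → Ioo x t × P t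
    ev-witness {x} 0<x (ε , 0<ε , h) with min-pos 0<x 0<ε
    ... | η , 0<η , g with dense 0<η
    ...   | t , 0<t , t<η = t , (0<t , proj₁ (g t<η)) , h t (0<t , proj₂ (g t<η))

  -- Intervals with independent ends intersect easily and pull back along monotone maps;
  -- `near-radius` recovers a symmetric radius.
  Near : C → (C → Set) → Set
  Near p P = ∃ λ l → ∃ λ r → l < p × p < r × (∀ s → l < s → s < r → P s)

  abstract
    near-map : (∀ {s} → P s → Q s) → Near x P → Near x Q
    near-map f (l , r , l< , <r , h) = l , r , l< , <r , λ s p q → f (h s p q)

    near-× : Near x P → Near x Q → Near x (λ s → P s × Q s)
    near-× (l , r , l< , <r , h) (l′ , r′ , l′< , <r′ , h′) with maximum l l′ | minimum r r′
    ... | m , l≤ , l′≤ , lub | w , ≤r , ≤r′ , glb = m , w , lub _ l< l′< , glb _ <r <r′ , λ s p q →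
      h s (≤-<-trans l≤ p) (<-≤-trans q ≤r) , h′ s (≤-<-trans l′≤ p) (<-≤-trans q ≤r′)

    near-all : {P : Fin k → C → Set} → (∀ j → Near x (P j)) → Near x (λ s → ∀ j → P j s)
    near-all {zero} {x} h = x - 1# , x + 1# , x-c<x 0<1 , x<x+c 0<1 , λ _ _ _ ()
    near-all {suc k} h = near-map (λ { (p , q) zero → p ; (p , q) (suc j) → q j })
      (near-× (h zero) (near-all (h ∘ suc)))

    near-Ioo : x < y → y < z → Near y (λ s → x < s × s < z)
    near-Ioo p q = _ , _ , p , q , λ _ → _,_

    near-radius : Near x P → ∃ λ δ → 0# < δ × (∀ s → Close< δ s x → P s)
    near-radius {x} (l , r , l<x , x<r , h) with minimum (x - l) (r - x)
    ... | δ , δ≤ , δ≤′ , glb = δ , glb 0# (<⇒0<- l<x) (<⇒0<- x<r) , λ s (s< , <s) →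
      h s (+-cancelˡ-< δ (≤-<-trans (subst (δ + l ≤_) (x-y+y≡x x l) (+-monoˡ-≤ l δ≤)) <s))
          (<-≤-trans s< (subst (δ + x ≤_) (x-y+y≡x r x) (+-monoˡ-≤ x δ≤′)))

  dist≤-intro : (x y : Vec C k) → 0# ≤ c → (∀ j → Close≤ c (lookup x j) (lookup y j)) →
                dist x y ≤ c
  dist≤-intro []      []      0≤c h = 0≤c
  dist≤-intro (x ∷ u) (y ∷ v) 0≤c h =
    ⊔-lub (∣-∣≤-intro (h zero)) (dist≤-intro u v 0≤c (h ∘ suc))

  dist≤-elim : (x y : Vec C k) → dist x y ≤ c → ∀ j → Close≤ c (lookup x j) (lookup y j)
  dist≤-elim (x ∷ u) (y ∷ v) h zero    = ∣-∣≤-elim (≤-trans (x≤x⊔y _ _) h)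
  dist≤-elim (x ∷ u) (y ∷ v) h (suc j) = dist≤-elim u v (≤-trans (x≤y⊔x _ _) h) j

  dist<-intro : (x y : Vec C k) → 0# < c → (∀ j → Close< c (lookup x j) (lookup y j)) →
                dist x y < c
  dist<-intro []      []      0<c h = 0<c
  dist<-intro (x ∷ u) (y ∷ v) 0<c h =
    ⊔-lub-< (∣-∣<-intro (h zero)) (dist<-intro u v 0<c (h ∘ suc))

  dist<-elim : (x y : Vec C k) → dist x y < c → ∀ j → Close< c (lookup x j) (lookup y j)
  dist<-elim x y h j = Close≤-<-trans h (dist≤-elim x y ≤-refl j)

  0≤dist : (x y : Vec C k) → 0# ≤ dist x y
  0≤dist []      []      = ≤-refl
  0≤dist (x ∷ u) (y ∷ v) = ≤-trans (0≤dist u v) (x≤y⊔x _ _)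

  dist-refl : (x : Vec C k) → dist x x ≡ 0#
  dist-refl x = antisym
    (dist≤-intro x x ≤-refl λ j → let p = inj₂ (sym (+-identityˡ _)) in p , p) (0≤dist x x)

  dist-sym : (x y : Vec C k) → dist x y ≡ dist y x
  dist-sym x y = antisym (half x y) (half y x)
    where
    half : (x y : Vec C k) → dist x y ≤ dist y x
    half x y = dist≤-intro x y (0≤dist y x) λ j →
      let p , q = dist≤-elim y x ≤-refl j in q , p

  dist-triangle : (x y z : Vec C k) → dist x z ≤ dist x y + dist y z
  dist-triangle x y z = dist≤-intro x z
    (subst (_≤ dist x y + dist y z) (+-identityˡ 0#)
      (≤-trans (+-monoˡ-≤ 0# (0≤dist x y)) (+-monoʳ-≤ _ (0≤dist y z))))
    λ j → Close≤-trans (dist≤-elim x y ≤-refl j) (dist≤-elim y z ≤-refl j)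

  dist-insertAt : (u v : Vec C n) (i : Fin (suc n)) (y z : C) →
                  dist (insertAt u i y) (insertAt v i z) ≡ ∣ y - z ∣ ⊔ dist u v
  dist-insertAt u       v       zero    y z = refl
  dist-insertAt (x ∷ u) (w ∷ v) (suc i) y z = begin
    ∣ x - w ∣ ⊔ dist (insertAt u i y) (insertAt v i z)
      ≡⟨ cong (∣ x - w ∣ ⊔_) (dist-insertAt u v i y z) ⟩
    ∣ x - w ∣ ⊔ (∣ y - z ∣ ⊔ dist u v)  ≡⟨ ⊔-assoc ∣ x - w ∣ ∣ y - z ∣ (dist u v) ⟨
    (∣ x - w ∣ ⊔ ∣ y - z ∣) ⊔ dist u v  ≡⟨ cong (_⊔ dist u v) (⊔-comm ∣ x - w ∣ ∣ y - z ∣) ⟩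
    (∣ y - z ∣ ⊔ ∣ x - w ∣) ⊔ dist u v  ≡⟨ ⊔-assoc ∣ y - z ∣ ∣ x - w ∣ (dist u v) ⟩
    ∣ y - z ∣ ⊔ (∣ x - w ∣ ⊔ dist u v)  ∎
    where open ≡-Reasoning

-- Consequences of o-minimality: right germs, infima, uniform tolerances and semicontinuity.

module OMinimality (em : ExcludedMiddle 0ℓ) {L : Language} (M : Structure L)
  (isRCF : IsRealClosedOrderedField M) (oMinimal : IsOMinimal M) where

  open OrderedField M isRCF
  open Definability M
  open Extrema _<_ using (_<±_; [<]-injective; <±-asym; ⊥±<[_]; [_]<⊤±)
  open Extrema using ([_])
  open Equivalence

  private variable
    n : ℕ
    b c d p x z : C
    A B : C → Set

  by-contradiction : {X : Set} → (¬ X → ⊥) → X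
  by-contradiction {X} h with em {X}
  ... | yes x = x
  ... | no ¬x = ⊥-elim (h ¬x)

  -- The membership relation in `IsOMinimal` is local to that definition. This is a copy that can be
  -- referred to, and `sameUnion` carries the decomposition over to it.
  _∈ᵖ_ : C → Piece C → Set
  x ∈ᵖ point c      = x ≡ c
  x ∈ᵖ interval l r = (l <± [ x ]) × ([ x ] <± r)

  private
    sameUnion : {_∈′_ : C → Piece C → Set} → ∀ {ps} → (∀ x → A x ⇔ Any (x ∈′_) ps) →
                (∀ x c → (x ∈′ point c) ≡ (x ≡ c)) →
                (∀ x l r → (x ∈′ interval l r) ≡ ((l <± [ x ]) × ([ x ] <± r))) →
                ∀ x → A x ⇔ Any (x ∈ᵖ_) ps
    sameUnion {_∈′_ = _∈′_} h hp hi x = mk⇔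
      (Any.map (λ {q} → subst id (agree x q)) ∘ to (h x))
      (from (h x) ∘ Any.map (λ {q} → subst id (sym (agree x q))))
      where
      agree : ∀ x q → (x ∈′ q) ≡ (x ∈ᵖ q)
      agree x (point c)      = hp x c
      agree x (interval l r) = hi x l r

  pieces : Def₁ A → ∃ λ ps → ∀ x → A x ⇔ Any (x ∈ᵖ_) ps
  pieces dA with oMinimal _ dA
  ... | ps , h = ps , sameUnion h (λ _ _ → refl) (λ _ _ _ → refl)

  -- The local form of o-minimality. It is stable under unions and intersections, hence passes from
  -- the ends of single intervals to finite unions of pieces.
  RightGerm : C → (C → Set) → Set
  RightGerm p A = ∃ λ d → p < d ×
    ((∀ x → p < x → x < d → A x) ⊎ (∀ x → p < x → x < d → ¬ A x))

  rightGerm-⇔ : (∀ x → A x ⇔ B x) → RightGerm p A → RightGerm p B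
  rightGerm-⇔ e (d , p<d , inj₁ h) = d , p<d , inj₁ λ x q r → to (e x) (h x q r)
  rightGerm-⇔ e (d , p<d , inj₂ h) = d , p<d , inj₂ λ x q r → h x q r ∘ from (e x)

  rightGerm-× : RightGerm p A → RightGerm p B → RightGerm p (λ x → A x × B x)
  rightGerm-× (d , p<d , inj₂ h) _ = d , p<d , inj₂ λ x q r → h x q r ∘ proj₁
  rightGerm-× _ (d , p<d , inj₂ h) = d , p<d , inj₂ λ x q r → h x q r ∘ proj₂
  rightGerm-× {p} (d , p<d , inj₁ h) (e , p<e , inj₁ k) with minimum d e
  ... | m , ≤d , ≤e , glb = m , glb p p<d p<e , inj₁ λ x q r →
    h x q (<-≤-trans r ≤d) , k x q (<-≤-trans r ≤e)

  rightGerm-⊎ : RightGerm p A → RightGerm p B → RightGerm p (λ x → A x ⊎ B x)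
  rightGerm-⊎ (d , p<d , inj₁ h) _ = d , p<d , inj₁ λ x q r → inj₁ (h x q r)
  rightGerm-⊎ _ (d , p<d , inj₁ h) = d , p<d , inj₁ λ x q r → inj₂ (h x q r)
  rightGerm-⊎ {p} (d , p<d , inj₂ h) (e , p<e , inj₂ k) with minimum d e
  ... | m , ≤d , ≤e , glb = m , glb p p<d p<e , inj₂ λ x q r →
    [ h x q (<-≤-trans r ≤d) , k x q (<-≤-trans r ≤e) ]′

  rightGerm-always : (∀ x → p < x → A x) → RightGerm p A
  rightGerm-always {p} h = p + 1# , x<x+c 0<1 , inj₁ λ x q _ → h x q

  rightGerm-never : (∀ x → p < x → ¬ A x) → RightGerm p A
  rightGerm-never {p} h = p + 1# , x<x+c 0<1 , inj₂ λ x q _ → h x q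

  asym< : ∀ {x y} → x < y → ¬ (y < x)
  asym< q r = <⇒≱ q (inj₁ r)

  rightGerm-piece : ∀ p q → RightGerm p (_∈ᵖ q)
  rightGerm-piece p (point c) with <⊎≥ p c
  ... | inj₁ p<c = c , p<c , inj₂ λ { x _ x<c refl → irrefl refl x<c }
  ... | inj₂ c≤p = rightGerm-never λ { x p<x refl → <⇒≱ p<x c≤p }
  rightGerm-piece p (interval l r) = rightGerm-× (lower l) (upper r)
    where
    lower : ∀ l → RightGerm p (λ x → l <± [ x ])
    lower ⊥± = rightGerm-always λ x _ → ⊥±<[ x ]
    lower ⊤± = rightGerm-never λ _ _ ()
    lower [ c ] with <⊎≥ p c
    ... | inj₁ p<c = c , p<c , inj₂ λ x _ x<c h → asym< x<c ([<]-injective h)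
    ... | inj₂ c≤p = rightGerm-always λ x p<x → [ ≤-<-trans c≤p p<x ]
    upper : ∀ r → RightGerm p (λ x → [ x ] <± r)
    upper ⊥± = rightGerm-never λ x _ h → <±-asym asym< h ⊥±<[ x ]
    upper ⊤± = rightGerm-always λ x _ → [ x ]<⊤±
    upper [ c ] with <⊎≥ p c
    ... | inj₁ p<c = c , p<c , inj₁ λ x _ x<c → [ x<c ]
    ... | inj₂ c≤p = rightGerm-never λ x p<x h → <⇒≱ (<-trans p<x ([<]-injective h)) c≤p

  rightGerm : Def₁ A → ∀ p → RightGerm p A
  rightGerm dA p with pieces dA
  ... | ps , h = rightGerm-⇔ (λ x → mk⇔ (from (h x)) (to (h x))) (union ps)
    where
    union : ∀ ps → RightGerm p (λ x → Any (x ∈ᵖ_) ps)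
    union []       = rightGerm-never λ _ _ ()
    union (q ∷ ps) = rightGerm-⇔
      (λ x → mk⇔ [ here , there ]′ λ { (here h) → inj₁ h ; (there h) → inj₂ h })
      (rightGerm-⊎ (rightGerm-piece p q) (union ps))

  ev-dichotomy : Def₁ A → Eventually A ⊎ Eventually (λ t → ¬ A t)
  ev-dichotomy dA with rightGerm dA 0#
  ... | d , 0<d , inj₁ h = inj₁ (d , 0<d , λ t (p , q) → h t p q)
  ... | d , 0<d , inj₂ h = inj₂ (d , 0<d , λ t (p , q) → h t p q)

  private
    -- An interval without left end contradicts the lower bound: `m - 1#` lies in it and below `b`.
    -- Otherwise the left end is the infimum, as density provides points of the interval arbitrarily
    -- close to it.
    piece-inf : ∀ q → (∀ y → y ∈ᵖ q → b ≤ y) → x ∈ᵖ q → ∃ (IsInf (_∈ᵖ q))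
    piece-inf (point c) _ _ = c , (λ { _ refl → ≤-refl }) , λ b h → h c refl
    piece-inf {b} {x} (interval ⊥± r) h (_ , x<r) with minimum b x
    ... | m , m≤b , m≤x , _ = ⊥-elim (<⇒≱ (<-≤-trans (x-c<x 0<1) m≤b)
      (h (m - 1#) (⊥±<[ _ ] , below r x<r)))
      where
      below : ∀ r → [ x ] <± r → [ m - 1# ] <± r
      below ⊥± q    = ⊥-elim (<±-asym asym< q ⊥±<[ x ])
      below ⊤± _    = [ _ ]<⊤±
      below [ c ] q = [ <-trans (<-≤-trans (x-c<x 0<1) m≤x) ([<]-injective q) ]
    piece-inf {b} {x} (interval [ c ] r) h (c<x , x<r) = c ,
      (λ y (c<y , _) → inj₁ ([<]-injective c<y)) , λ b h → ≮⇒≥ λ c<b → contra b h c<b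
      where
      below : ∀ {y} r → y < x → [ x ] <± r → [ y ] <± r
      below ⊥± _ q    = ⊥-elim (<±-asym asym< q ⊥±<[ x ])
      below ⊤± _ _    = [ _ ]<⊤±
      below [ c ] p q = [ <-trans p ([<]-injective q) ]
      contra : ∀ b → (∀ y → y ∈ᵖ interval [ c ] r → b ≤ y) → ¬ (c < b)
      contra b h c<b with minimum b x
      ... | m , m≤b , m≤x , glb with dense (glb c c<b ([<]-injective c<x))
      ...   | y , c<y , y<m =
        <⇒≱ (<-≤-trans y<m m≤b) (h y ([ c<y ] , below r (<-≤-trans y<m m≤x) x<r))

    list-inf : ∀ ps → (∀ y → Any (y ∈ᵖ_) ps → b ≤ y) →
               (∀ y → ¬ Any (y ∈ᵖ_) ps) ⊎ ∃ (IsInf (λ y → Any (y ∈ᵖ_) ps))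
    list-inf []       h = inj₁ λ _ ()
    list-inf (q ∷ ps) h with em {∃ (_∈ᵖ q)} | list-inf ps (λ y → h y ∘ there)
    ... | no  e | inj₁ f = inj₁ λ { y (here p) → e (y , p) ; y (there p) → f y p }
    ... | no  e | inj₂ (m , lb , glb) = inj₂ (m ,
      (λ { y (here p) → ⊥-elim (e (y , p)) ; y (there p) → lb y p }) , λ b k → glb b λ y → k y ∘ there)
    ... | yes (x , x∈) | r with piece-inf q (λ y → h y ∘ here) x∈ | r
    ...   | m , lb , glb | inj₁ f = inj₂ (m ,
      (λ { y (here p) → lb y p ; y (there p) → ⊥-elim (f y p) }) , λ b k → glb b λ y → k y ∘ here)
    ...   | m , lb , glb | inj₂ (m′ , lb′ , glb′) with <⊎≥ m m′
    ...     | inj₁ m<m′ = inj₂ (m ,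
      (λ { y (here p) → lb y p ; y (there p) → ≤-trans (inj₁ m<m′) (lb′ y p) }) ,
      λ b k → glb b λ y → k y ∘ here)
    ...     | inj₂ m′≤m = inj₂ (m′ ,
      (λ { y (here p) → ≤-trans m′≤m (lb y p) ; y (there p) → lb′ y p }) ,
      λ b k → glb′ b λ y → k y ∘ there)

  IsInf-⇔ : (∀ x → A x ⇔ B x) → IsInf A c → IsInf B c
  IsInf-⇔ e (lb , glb) = (λ s → lb s ∘ from (e s)) , λ b h → glb b λ s → h s ∘ to (e s)

  IsSup-⇔ : (∀ x → A x ⇔ B x) → IsSup A c → IsSup B c
  IsSup-⇔ e (ub , lub) = (λ s → ub s ∘ from (e s)) , λ b h → lub b λ s → h s ∘ to (e s)

  abstract
    inf-exists : Def₁ A → A x → (∀ y → A y → b ≤ y) → ∃ (IsInf A)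
    inf-exists {x = x} dA Ax h with pieces dA
    ... | ps , e with list-inf ps (λ y → h y ∘ from (e y))
    ...   | inj₁ f       = ⊥-elim (f x (to (e x) Ax))
    ...   | inj₂ (m , i) = m , IsInf-⇔ (λ y → mk⇔ (from (e y)) (to (e y))) i

    sup-exists : Def₁ A → A x → (∀ y → A y → y ≤ b) → ∃ (IsSup A)
    sup-exists {A} {x} {b} dA Ax h
      -- The supremum is obtained as the infimum of the definable set of upper bounds, which `x`
      -- bounds from below.
      with inf-exists {λ u → ∀ y → A y → y ≤ u} {b = x}
             (∀ᵈ (apply₁ A dA (# zero) →ᵈ # zero ≤ᵈ # (suc zero))) h (λ u k → k x Ax)
    ... | m , lb , glb = m , (λ s As → glb s λ u k → k s As) , lb

    below-inf : IsInf A c → c < d → ∃ λ x → A x × x < d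
    below-inf {A} {c} {d} (_ , glb) c<d with em {∃ λ x → A x × x < d}
    ... | yes h = h
    ... | no ¬h = ⊥-elim (<⇒≱ c<d (glb d λ s As → ≮⇒≥ λ s<d → ¬h (s , As , s<d)))

    above-sup : IsSup A c → d < c → ∃ λ x → A x × d < x
    above-sup {A} {c} {d} (_ , lub) d<c with em {∃ λ x → A x × d < x}
    ... | yes h = h
    ... | no ¬h = ⊥-elim (<⇒≱ d<c (lub d λ s As → ≮⇒≥ λ s<d → ¬h (s , As , s<d)))

    IsSup-unique : IsSup A c → IsSup A d → c ≡ d
    IsSup-unique (ub , lub) (ub′ , lub′) = antisym (lub _ ub′) (lub′ _ ub)

  module _ {Q : Vec C (suc n) → Set} {r : Vec C n → C} where
    IsInfᵈ : Def Q → Fun r → Def (λ v → IsInf (λ x → Q (x ∷ v)) (r v))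
    IsInfᵈ dQ dr = ∀ᵈ (dQ →ᵈ weakenᶠ dr ≤ᵈ # zero)
      ×ᵈ ∀ᵈ (∀ᵈ (weaken dQ →ᵈ # (suc zero) ≤ᵈ # zero) →ᵈ # zero ≤ᵈ weakenᶠ dr)

    IsSupᵈ : Def Q → Fun r → Def (λ v → IsSup (λ x → Q (x ∷ v)) (r v))
    IsSupᵈ dQ dr = ∀ᵈ (dQ →ᵈ # zero ≤ᵈ weakenᶠ dr)
      ×ᵈ ∀ᵈ (∀ᵈ (weaken dQ →ᵈ # zero ≤ᵈ # (suc zero)) →ᵈ weakenᶠ dr ≤ᵈ # zero)

  abstract
    -- Outside the domain of R the value is 0#.
    fromGraph : (R : C → C → Set) → Def₂ R → (∀ {t z z′} → R t z → R t z′ → z ≡ z′) →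
                ∃ λ x → ∀ {t z} → R t z → fn x t ≡ z
    fromGraph R dR unique = record { fn = f ; definable = resp
        (λ { (t ∷ z ∷ []) → mk⇔ (bwd t z) (fwd t z) })
        (dR ⊎ᵈ (¬ᵈ ∃ᵈ (apply₂ R dR (# (suc zero)) (# zero)) ×ᵈ # (suc zero) ≡ᵈ constᵈ 0#)) } ,
      λ {t} r → value t r em
      where
      pick : ∀ t → Dec (∃ (R t)) → C
      pick t (yes (z , _)) = z
      pick t (no _)        = 0#

      f : C → C
      f t = pick t em

      value : ∀ t {z} → R t z → (d : Dec (∃ (R t))) → pick t d ≡ z
      value t r (yes (_ , r′)) = unique r′ r
      value t r (no ¬r)        = ⊥-elim (¬r (_ , r))

      bwd : ∀ t z → R t z ⊎ (¬ (∃ (R t)) × z ≡ 0#) → z ≡ f t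
      bwd t z (inj₁ r) = sym (value t r em)
      bwd t z (inj₂ (¬r , e)) with em {∃ (R t)}
      ... | yes r = ⊥-elim (¬r r)
      ... | no _  = e

      fwd : ∀ t z → z ≡ f t → R t z ⊎ (¬ (∃ (R t)) × z ≡ 0#)
      fwd t z e with em {∃ (R t)}
      ... | yes (y , r) = inj₁ (subst (R t) (sym e) r)
      ... | no ¬r       = inj₂ (¬r , e)

  fnᵈ : (f : 𝒦) {g : Vec C n → C} → Fun g → Fun (λ v → fn f (g v))
  fnᵈ f = function (fn f) (𝒦.definable f)

  -- `W p c` is read as: the tolerance `c` works at `p`.
  DownClosed : (C → C → Set) → Set
  DownClosed W = ∀ {p c c′} → 0# < c′ → c′ ≤ c → W p c → W p c′

  -- A substitute for the monotonicity theorem.  If no W(-, c) contains an interval, the first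
  -- point of any W(-, c) is attained, and such record points fill some (0, δ); on (0, δ) the
  -- tolerance witnessing a record at w then works at all later points.
  uniform-tolerance :
    (W : C → C → Set) → Def₂ W → DownClosed W →
    0# < z → (∀ p → Ioo z p → ∃ λ c → 0# < c × W p c) →
    ∃ λ c → ∃ λ l → ∃ λ r → 0# < c × 0# < l × l < r × r < z × (∀ p → l < p → p < r → W p c)
  uniform-tolerance {z} W dW down 0<z some = by-contradiction λ ¬h → Contra.contra ¬h (rightGerm dRecord 0#)
    where
    Record : C → Set
    Record m = ∃ λ c → 0# < c × W m c × (∀ y → 0# < y → y < m → ¬ W y c)

    dRecord : Def₁ Record
    dRecord = ∃ᵈ (constᵈ 0# <ᵈ # zero ×ᵈ apply₂ W dW (# (suc zero)) (# zero) ×ᵈ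
      ∀ᵈ (constᵈ 0# <ᵈ # zero →ᵈ # zero <ᵈ # (suc (suc zero)) →ᵈ
        ¬ᵈ apply₂ W dW (# zero) (# (suc zero))))

    module Contra (¬h : ¬ (∃ λ c → ∃ λ l → ∃ λ r →
                    0# < c × 0# < l × l < r × r < z × (∀ p → l < p → p < r → W p c))) where
      record-below : ∀ x → Ioo z x → ∃ λ m → 0# < m × m ≤ x × Record m
      record-below x x∈ with some x x∈
      ... | c , 0<c , w with inf-exists {λ y → Ioo z y × W y c} {b = 0#}
            ((constᵈ 0# <ᵈ # zero ×ᵈ # zero <ᵈ constᵈ z) ×ᵈ apply₂ W dW (# zero) (constᵈ c))
            (x∈ , w) (λ y ((0<y , _) , _) → inj₁ 0<y)
      ... | m , lb , glb with rightGerm {λ y → Ioo z y × W y c}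
            ((constᵈ 0# <ᵈ # zero ×ᵈ # zero <ᵈ constᵈ z) ×ᵈ apply₂ W dW (# zero) (constᵈ c)) m
      ...   | d , m<d , inj₁ all with dense m<d
      ...     | l , m<l , l<d with dense l<d
      ...       | r , l<r , r<d = ⊥-elim (¬h (c , l , r , 0<c ,
          proj₁ (proj₁ (all l m<l l<d)) , l<r , proj₂ (proj₁ (all r (<-trans m<l l<r) r<d)) ,
          λ p l<p p<r → proj₂ (all p (<-trans m<l l<p) (<-trans p<r r<d))))
      -- The set has points arbitrarily close to its infimum `m`, but none in `(m, d)`; so `m`
      -- itself belongs to it.
      record-below x x∈ | c , 0<c , w | m , lb , glb | d , m<d , inj₂ none
        with em {Ioo z m × W m c}
      ... | yes ((0<m , m<z) , w′) = m , 0<m , lb x (x∈ , w) , c , 0<c , w′ ,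
        λ y 0<y y<m w″ → <⇒≱ y<m (lb y ((0<y , <-trans y<m m<z) , w″))
      ... | no ¬m with below-inf {λ y → Ioo z y × W y c} (lb , glb) m<d
      ...   | y , y∈ , y<d with lb y y∈
      ...     | inj₁ m<y  = ⊥-elim (none y m<y y<d y∈)
      ...     | inj₂ refl = ⊥-elim (¬m y∈)

      contra : RightGerm 0# Record → ⊥
      contra (δ , 0<δ , germ) with min-pos 0<z 0<δ
      ... | η , 0<η , h with dense 0<η
      contra (δ , 0<δ , inj₂ none) | η , 0<η , h | x , 0<x , x<η
        with record-below x (0<x , proj₁ (h x<η))
      ... | m , 0<m , m≤x , rec = none m 0<m (proj₂ (h (≤-<-trans m≤x x<η))) rec
      contra (δ , 0<δ , inj₁ all) | η , 0<η , h | w , 0<w , w<η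
        with all w 0<w (proj₂ (h w<η)) | dense w<η
      ... | c , 0<c , Wwc , _ | r , w<r , r<η = ¬h (c , w , r , 0<c , 0<w , w<r , proj₁ (h r<η) , later)
        where
        later : ∀ p → w < p → p < r → W p c
        later p w<p p<r with all p (<-trans 0<w w<p) (proj₂ (h (<-trans p<r r<η)))
        ... | c′ , 0<c′ , Wpc′ , first with <⊎≥ c c′
        ...   | inj₁ c<c′ = down 0<c (inj₁ c<c′) Wpc′
        -- For `c′ ≤ c`, the tolerance `c′` would already work at the earlier point `w`, although
        -- `p` is the first point for `c′`.
        ...   | inj₂ c′≤c = ⊥-elim (first w 0<w w<p (down 0<c′ c′≤c Wwc))

  LowerSemicontinuous : (C → C) → C → Set
  LowerSemicontinuous f p = ∀ c → 0# < c → Near p λ s → f p < c + f s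

  module _ (f : 𝒦) where
    private
      -- For positive `c` this is the failure of lower semicontinuity at `p` with tolerance `c`.
      Drop : C → C → Set
      Drop p c = ∀ l r → l < p → p < r → ∃ λ s → l < s × s < r × c + fn f s ≤ fn f p

      dDrop : Def₂ Drop
      dDrop = ∀ᵈ (∀ᵈ (# (suc zero) <ᵈ # (suc (suc zero)) →ᵈ # (suc (suc zero)) <ᵈ # zero →ᵈ
        ∃ᵈ (# (suc (suc zero)) <ᵈ # zero ×ᵈ # zero <ᵈ # (suc zero) ×ᵈ
          (# (suc (suc (suc (suc zero)))) +ᵈ fnᵈ f (# zero)) ≤ᵈ fnᵈ f (# (suc (suc (suc zero)))))))

      drop-down : DownClosed Drop
      drop-down _ c′≤c W l r l<p p<r with W l r l<p p<r
      ... | s , l<s , s<r , j = s , l<s , s<r , ≤-trans (+-monoˡ-≤ _ c′≤c) j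

      ¬drop : ∀ {p} → ¬ (∃ λ c → 0# < c × Drop p c) → LowerSemicontinuous (fn f) p
      ¬drop {p} none c 0<c with em {Near p λ s → fn f p < c + fn f s}
      ... | yes h = h
      ... | no ¬h = ⊥-elim (none (c , 0<c , drop))
        where
        drop : Drop p c
        drop l r l<p p<r with em {∃ λ s → l < s × s < r × c + fn f s ≤ fn f p}
        ... | yes h = h
        ... | no ¬s = ⊥-elim (¬h (l , r , l<p , p<r , λ s l<s s<r →
          [ id , (λ q → ⊥-elim (¬s (s , l<s , s<r , q))) ]′ (<⊎≥ _ _)))

      -- At a point whose value is within `c` of the infimum over the interval, a drop by `c` lands
      -- below that infimum.
      ¬uniform-drop : ∀ {c l r} → 0# < c → l < r → (∀ s → l < s → s < r → b ≤ fn f s) →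
                      ¬ (∀ p → l < p → p < r → Drop p c)
      ¬uniform-drop {b} {c} {l} {r} 0<c l<r bounded W =
        let q , l<q , q<r = dense l<r
            m , inf = inf-exists {Value} {b = b} dValue (q , l<q , q<r , refl)
              (λ { _ (s , l<s , s<r , e) → subst (b ≤_) (sym e) (bounded s l<s s<r) })
            v , (s , l<s , s<r , e) , v< = below-inf inf (x<c+x 0<c)
            s′ , l<s′ , s′<r , fs′≤ = W s l<s s<r l r l<s s<r
        in <⇒≱ (+-cancelˡ-< c (≤-<-trans fs′≤ (subst (_< c + m) e v<)))
               (proj₁ inf (fn f s′) (s′ , l<s′ , s′<r , refl))
        where
        Value : C → Set
        Value v = ∃ λ s → l < s × s < r × v ≡ fn f s
        dValue : Def₁ Value
        dValue = ∃ᵈ (constᵈ l <ᵈ # zero ×ᵈ # zero <ᵈ constᵈ r ×ᵈ # (suc zero) ≡ᵈ fnᵈ f (# zero))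

    -- The set of points with some drop is definable, so otherwise all small points have one. Then
    -- `uniform-tolerance` yields the same drop on a whole interval, which boundedness below
    -- forbids.
    ev-lowerSemicontinuous : Eventually (λ t → b ≤ fn f t) →
                             Eventually (LowerSemicontinuous (fn f))
    ev-lowerSemicontinuous {b} (ζ , 0<ζ , bounded) = [ drops , ev-map ¬drop ]′ (ev-dichotomy dAny)
      where
      AnyDrop : C → Set
      AnyDrop p = ∃ λ c → 0# < c × Drop p c

      dAny : Def₁ AnyDrop
      dAny = ∃ᵈ (constᵈ 0# <ᵈ # zero ×ᵈ apply₂ Drop dDrop (# (suc zero)) (# zero))

      drops : Eventually AnyDrop → Eventually (LowerSemicontinuous (fn f))
      drops (ε , 0<ε , all) =
        let η , 0<η , h = min-pos 0<ζ 0<ε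
            c , l , r , 0<c , 0<l , l<r , r<η , W = uniform-tolerance Drop dDrop drop-down 0<η
              (λ p (0<p , p<η) → all p (0<p , proj₂ (h p<η)))
        in ⊥-elim (¬uniform-drop 0<c l<r
          (λ s l<s s<r → bounded s (<-trans 0<l l<s , proj₁ (h (<-trans s<r r<η)))) W)

-- Continuity and monotonicity of germs, and definable moduli.

module GermsOfFunctions (em : ExcludedMiddle 0ℓ) {L : Language} (M : Structure L)
  (isRCF : IsRealClosedOrderedField M) (oMinimal : IsOMinimal M) where

  open OrderedField M isRCF
  open Definability M
  open OMinimality em M isRCF oMinimal

  private variable
    b c d x y z : C

  UpperSemicontinuous ContinuousAt : (C → C) → C → Set
  UpperSemicontinuous f p = ∀ c → 0# < c → Near p λ s → f s < c + f p
  ContinuousAt f p = ∀ c → 0# < c → Near p λ s → Close< c (f s) (f p)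

  ev-upperSemicontinuous : (f : 𝒦) → Eventually (λ t → fn f t ≤ b) →
                           Eventually (UpperSemicontinuous (fn f))
  ev-upperSemicontinuous {b} f h = ev-map
    (λ lsc c 0<c → near-map flip (lsc c 0<c))
    (ev-lowerSemicontinuous (const 0# -ᴷ f) {0# - b} (ev-map -‿anti-≤ h))
    where
    -‿anti-≤ : x ≤ b → 0# - b ≤ 0# - x
    -‿anti-≤ (inj₁ p)    = inj₁ (-‿mono-< 0# p)
    -‿anti-≤ (inj₂ refl) = ≤-refl

    flip : 0# - x < c + (0# - y) → y < c + x
    flip {x} {c} {y} p = subst₂ _<_ lhs (cong (_+ x) rhs) (+-monoˡ-< x (+-monoʳ-< y p))
      where
      open ≡-Reasoning
      lhs : (y + (0# - x)) + x ≡ y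
      lhs = trans (+-assoc y _ x) (trans (cong (y +_) (x-y+y≡x 0# x)) (+-identityʳ y))
      rhs : y + (c + (0# - y)) ≡ c
      rhs = trans (+-exchange y c _) (trans (cong (c +_) (x+[y-x]≡y y 0#)) (+-identityʳ c))

  ev-continuous : (f : 𝒦) → Eventually (λ t → b ≤ fn f t) → Eventually (λ t → fn f t ≤ d) →
                  Eventually (ContinuousAt (fn f))
  ev-continuous f lower upper = eventually-map₂
    (λ lsc usc c 0<c → near-× (usc c 0<c) (lsc c 0<c))
    (ev-lowerSemicontinuous f lower) (ev-upperSemicontinuous f upper)

  Small : (C → C) → Set
  Small f = ∀ c → 0# < c → Eventually λ t → f t < c

  -- Together the fields make `f` an increasing bijection of `(0, x)` onto `(0, f x)` for every `x`
  -- in `(0, z)`; `attains` replaces the intermediate value theorem.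
  record Rising (f : C → C) (z : C) : Set where
    field
      0<z        : 0# < z
      positive   : Ioo z x → 0# < f x
      increasing : 0# < x → x < y → y < z → f x < f y
      attains    : Ioo z x → 0# < y → y < f x → ∃ λ s → 0# < s × s < x × f s ≡ y

    abstract
      reflects-< : Ioo z x → Ioo z y → f x < f y → x < y
      reflects-< {x} {y} (0<x , x<z) (0<y , y<z) h with <⊎≥ x y
      ... | inj₁ x<y         = x<y
      ... | inj₂ (inj₂ refl) = ⊥-elim (irrefl refl h)
      ... | inj₂ (inj₁ y<x)  = ⊥-elim (<⇒≱ h (inj₁ (increasing 0<y y<x x<z)))

      injective : Ioo z x → Ioo z y → f x ≡ f y → x ≡ y
      injective {x} {y} (0<x , x<z) (0<y , y<z) h with <⊎≥ x y
      ... | inj₁ x<y        = ⊥-elim (irrefl h (increasing 0<x x<y y<z))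
      ... | inj₂ (inj₂ y≡x) = sym y≡x
      ... | inj₂ (inj₁ y<x) = ⊥-elim (irrefl (sym h) (increasing 0<y y<x x<z))

      -- Two points `l′ < x < r′` of the neighbourhood are chosen inside `(0, z)`. A tolerance below
      -- both increments `f x - f l′` and `f r′ - f x` then confines `s` between them.
      inverse-continuous : Ioo z x → {P : C → Set} → Near x P →
                           ∃ λ c → 0# < c × (∀ s → Ioo z s → Close< c (f s) (f x) → P s)
      inverse-continuous {x} (0<x , x<z) near =
        let l , r , l<x , x<r , h = near-× (near-Ioo 0<x x<z) near
            l′ , l<l′ , l′<x = dense l<x
            r′ , x<r′ , r′<r = dense x<r
            (0<l′ , l′<z) , _ = h l′ l<l′ (<-trans l′<x x<r)
            (0<r′ , r′<z) , _ = h r′ (<-trans l<x x<r′) r′<r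
            c , c∈ , c< , c<′ = ev-witness 0<1 (ev-× (ev-< (<⇒0<- (increasing 0<l′ l′<x x<z)))
                                                      (ev-< (<⇒0<- (increasing 0<x x<r′ r′<z))))
            0<c = proj₁ c∈
        in c , 0<c , λ s s∈ (fs< , fx<) →
           let c+fl′<fx = subst (c + f l′ <_) (x-y+y≡x (f x) (f l′)) (+-monoˡ-< (f l′) c<)
               c+fx<fr′ = subst (c + f x <_) (x-y+y≡x (f r′) (f x)) (+-monoˡ-< (f x) c<′)
           in proj₂ (h s
             (<-trans l<l′ (reflects-< (0<l′ , l′<z) s∈ (+-cancelˡ-< c (<-trans c+fl′<fx fx<))))
             (<-trans (reflects-< s∈ (0<r′ , r′<z) (<-trans fs< c+fx<fr′)) r′<r))

      ev-attains : Eventually (λ y → ∃ λ s → Ioo z s × f s ≡ y)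
      ev-attains =
        let t , 0<t , t<z = dense 0<z in
        f t , positive (0<t , t<z) , λ y (0<y , y<ft) →
          let s , 0<s , s<t , e = attains (0<t , t<z) 0<y y<ft in s , (0<s , <-trans s<t t<z) , e

  abstract
    Rising-shrink : ∀ {f} → 0# < y → y ≤ z → Rising f z → Rising f y
    Rising-shrink 0<y y≤z r = record
      { 0<z        = 0<y
      ; positive   = λ (0<x , x<y) → Rising.positive r (0<x , <-≤-trans x<y y≤z)
      ; increasing = λ 0<x x<x′ x′<y → Rising.increasing r 0<x x<x′ (<-≤-trans x′<y y≤z)
      ; attains    = λ (0<x , x<y) → Rising.attains r (0<x , <-≤-trans x<y y≤z)
      }

  -- Infinitesimality makes the set where f ≥ v start at a positive point, and semicontinuity
  -- makes that point belong to it.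
  module _ (f : 𝒦) (small : Small (fn f)) where
    first-reaching : (∀ p → Ioo z p → UpperSemicontinuous (fn f) p) →
                     ∀ {t v} → Ioo z t → 0# < v → v ≤ fn f t →
                     ∃ λ m → 0# < m × m ≤ t × v ≤ fn f m × (∀ s → 0# < s → s < m → fn f s < v)
    first-reaching {z} usc {t} {v} (0<t , t<z) 0<v v≤ft =
      m , 0<m , m≤t , v≤fm , λ s 0<s s<m → [ id , (λ v≤fs → ⊥-elim (<⇒≱ s<m
        (proj₁ inf s (0<s , ≤-trans (inj₁ s<m) m≤t , v≤fs)))) ]′ (<⊎≥ _ _)
      where
      Reached : C → Set
      Reached s = 0# < s × s ≤ t × v ≤ fn f s

      dReached : Def₁ Reached
      dReached = constᵈ 0# <ᵈ # zero ×ᵈ # zero ≤ᵈ constᵈ t ×ᵈ constᵈ v ≤ᵈ fnᵈ f (# zero)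

      has-inf : ∃ (IsInf Reached)
      has-inf = inf-exists dReached (0<t , ≤-refl , v≤ft) (λ _ → inj₁ ∘ proj₁)

      m = proj₁ has-inf
      inf = proj₂ has-inf

      m≤t : m ≤ t
      m≤t = proj₁ inf t (0<t , ≤-refl , v≤ft)

      0<m : 0# < m
      0<m = let ε , 0<ε , h = small v 0<v in
        <-≤-trans 0<ε (proj₂ inf ε λ s (0<s , _ , v≤fs) → ≮⇒≥ λ s<ε → <⇒≱ (h s (0<s , s<ε)) v≤fs)

      v≤fm : v ≤ fn f m
      v≤fm = ≮⇒≥ λ fm<v →
        let l , r , l<m , m<r , h = usc m (0<m , ≤-<-trans m≤t t<z) (v - fn f m) (<⇒0<- fm<v)
            s , s∈ , s<r = below-inf inf m<r
        in <⇒≱ (subst (fn f s <_) (x-y+y≡x v (fn f m)) (h s (<-≤-trans l<m (proj₁ inf s s∈)) s<r))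
               (proj₂ (proj₂ s∈))

    private
      Record : C → Set
      Record t = ∀ s → 0# < s → s < t → fn f s < fn f t

      dRecord : Def₁ Record
      dRecord = ∀ᵈ (constᵈ 0# <ᵈ # zero →ᵈ # zero <ᵈ # (suc zero) →ᵈ
        fnᵈ f (# zero) <ᵈ fnᵈ f (# (suc zero)))

    abstract
      -- The first point at which `f` reaches the value `fn f t` exceeds all earlier values, and
      -- such points occur arbitrarily close to `0#`. By the dichotomy all small points are then of
      -- this kind, so `f` increases.
      rising : Eventually (λ t → 0# < fn f t) → ∃ (Rising (fn f))
      rising positive = combine (ev-× positive (ev-× semicontinuous (ev-increasing (ev-dichotomy dRecord))))
        where
        semicontinuous : Eventually λ p → LowerSemicontinuous (fn f) p × UpperSemicontinuous (fn f) p
        semicontinuous = ev-×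
          (ev-lowerSemicontinuous f (ev-map inj₁ positive))
          (ev-upperSemicontinuous f (ev-map inj₁ (small 1# 0<1)))

        ev-increasing : Eventually Record ⊎ Eventually (λ t → ¬ Record t) → Eventually Record
        ev-increasing (inj₁ h) = h
        ev-increasing (inj₂ h) =
          let η , 0<η , all = ev-× positive (ev-× semicontinuous h)
              t , 0<t , t<η = dense 0<η
              m , 0<m , m≤t , ft≤fm , first = first-reaching
                (λ p p∈ → proj₂ (proj₁ (proj₂ (all p p∈)))) (0<t , t<η)
                (proj₁ (all t (0<t , t<η))) ≤-refl
          in ⊥-elim (proj₂ (proj₂ (all m (0<m , ≤-<-trans m≤t t<η)))
                      λ s 0<s s<m → <-≤-trans (first s 0<s s<m) ft≤fm)

        combine : Eventually (λ t → 0# < fn f t ×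
                    (LowerSemicontinuous (fn f) t × UpperSemicontinuous (fn f) t) × Record t) →
                  ∃ (Rising (fn f))
        combine (z , 0<z , all) = z , record
          { 0<z        = 0<z
          ; positive   = λ t∈ → proj₁ (all _ t∈)
          ; increasing = λ 0<s s<t t<z → proj₂ (proj₂ (all _ (<-trans 0<s s<t , t<z))) _ 0<s s<t
          ; attains    = attains
          }
          where
          attains : ∀ {t v} → Ioo z t → 0# < v → v < fn f t → ∃ λ s → 0# < s × s < t × fn f s ≡ v
          attains {t} {v} (0<t , t<z) 0<v v<ft =
            let m , 0<m , m≤t , v≤fm , first = first-reaching
                  (λ p p∈ → proj₂ (proj₁ (proj₂ (all p p∈)))) (0<t , t<z) 0<v (inj₁ v<ft)
                -- Just before `m` the values are below `v`, so by lower semicontinuity `f` cannot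
                -- jump over `v` at `m`.
                fm≤v : fn f m ≤ v
                fm≤v = ≮⇒≥ λ v<fm →
                  let l , r , l<m , m<r , h = proj₁ (proj₁ (proj₂ (all m (0<m , ≤-<-trans m≤t t<z))))
                                                (fn f m - v) (<⇒0<- v<fm)
                      k , l≤k , 0≤k , lub = maximum l 0#
                      s , k<s , s<m = dense (lub m l<m 0<m)
                  in irrefl refl (<-trans (h s (≤-<-trans l≤k k<s) (<-trans s<m m<r))
                       (subst ((fn f m - v) + fn f s <_) (x-y+y≡x (fn f m) v)
                         (+-monoʳ-< (fn f m - v) (first s (≤-<-trans 0≤k k<s) s<m))))
                fm≡v = antisym fm≤v v≤fm
            in m , 0<m ,
               [ id , (λ t≤m → ⊥-elim (irrefl (sym (trans (cong (fn f) (antisym t≤m m≤t)) fm≡v)) v<ft)) ]′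
                 (<⊎≥ m t) ,
               fm≡v

  module _ (W : C → C → Set) (dW : Def₂ W) where
    private
      -- The bound `c ≤ t` makes the supremum exist and the chosen germ infinitesimal. The supremum
      -- itself may fail to be admissible, but some admissible tolerance exceeds its half, which is
      -- then admissible by downward closure.
      Admissible : C → C → Set
      Admissible t c = 0# < c × c ≤ t × W t c

      HalfSup : C → C → Set
      HalfSup t h = IsSup (Admissible t) (h + h)

      dHalfSup : Def₂ HalfSup
      dHalfSup = IsSupᵈ
        (constᵈ 0# <ᵈ # zero ×ᵈ # zero ≤ᵈ # (suc zero) ×ᵈ apply₂ W dW (# (suc zero)) (# zero))
        (# (suc zero) +ᵈ # (suc zero))

      halfSup : ∃ λ ω → ∀ {t h} → HalfSup t h → fn ω t ≡ h
      halfSup = fromGraph HalfSup dHalfSup λ r r′ → double-cancel (IsSup-unique r r′)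

    abstract
      tolerance : DownClosed W → Eventually (λ t → ∃ λ c → 0# < c × W t c) →
                ∃ λ ω → Eventually λ t → 0# < fn ω t × fn ω t ≤ t × W t (fn ω t)
      tolerance down (ε , 0<ε , some) = proj₁ halfSup , ε , 0<ε , λ t t∈ →
        let h , h≡ , good = half-sup t t∈ in
        subst (λ c → 0# < c × c ≤ t × W t c) (sym (proj₂ halfSup h≡)) good
        where
        half-sup : ∀ t → Ioo ε t → ∃ λ h → HalfSup t h × Admissible t h
        half-sup t (0<t , t<ε) =
          let c₀ , 0<c₀ , w₀ = some t (0<t , t<ε)
              c , c≤c₀ , c≤t , glb = minimum c₀ t
              0<c = glb 0# 0<c₀ 0<t
              c∈ = 0<c , c≤t , down 0<c c≤c₀ w₀
              σ , sup = sup-exists {A = Admissible t} {b = t}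
                (constᵈ 0# <ᵈ # zero ×ᵈ # zero ≤ᵈ constᵈ t ×ᵈ apply₂ W dW (constᵈ t) (# zero))
                c∈ (λ _ → proj₁ ∘ proj₂)
              h , h+h≡σ , 0<h , h<σ = half-pos (<-≤-trans 0<c (proj₁ sup c c∈))
              c′ , (_ , c′≤t , w′) , h<c′ = above-sup sup h<σ
          in h , subst (IsSup (Admissible t)) (sym h+h≡σ) sup ,
             0<h , ≤-trans (inj₁ h<c′) c′≤t , down 0<h (inj₁ h<c′) w′

  abstract
    -- A positive germ in `𝒦` need be neither small nor increasing. An admissible tolerance for
    -- `c < fn r t` is both, and can therefore bound contributions from all smaller scales at once.
    rising-below : (r : 𝒦) → const 0# <ᴷ r → ∃ λ ω → ∃ λ z → Rising (fn ω) z ×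
                   (∀ t → Ioo z t → fn ω t < fn r t × fn ω t ≤ t)
    rising-below r (ε , 0<ε , 0<r) =
      let ω , δ , 0<δ , ωtol = tolerance (λ t c → c < fn r t) (# (suc zero) <ᵈ fnᵈ r (# zero))
            (λ _ c′≤c c<r → ≤-<-trans c′≤c c<r) (ε , 0<ε , λ t t∈ → dense (0<r t t∈))
          z₀ , rise = rising ω
            (λ c 0<c → eventually-map₂ (λ (_ , ω≤t , _) t<c → ≤-<-trans ω≤t t<c) (δ , 0<δ , ωtol) (ev-< 0<c))
            (ev-map proj₁ (δ , 0<δ , ωtol))
          w , w≤z , w≤δ , glb = minimum z₀ δ
      in ω , w , Rising-shrink (glb 0# (Rising.0<z rise) 0<δ) w≤z rise , λ t (0<t , t<w) →
         let _ , ω≤t , ω<r = ωtol t (0<t , <-≤-trans t<w w≤δ) in ω<r , ω≤t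

-- Definable paths and their relation to curves.

module DefinablePaths (em : ExcludedMiddle 0ℓ) {L : Language} (M : Structure L)
  (isRCF : IsRealClosedOrderedField M) (oMinimal : IsOMinimal M) where

  open OrderedField M isRCF
  open Definability M
  open OMinimality em M isRCF oMinimal
  open GermsOfFunctions em M isRCF oMinimal

  private variable
    k n : ℕ

  _⊔ᵈ_ : ∀ {f g : Vec C n → C} → Fun f → Fun g → Fun (λ v → f v ⊔ g v)
  _⊔ᵈ_ = graph⇒Fun₂ _⊔_ (resp
    (λ { (x ∷ y ∷ z ∷ []) → mk⇔
      [ (λ (x<y , z≡y) → trans z≡y (sym (x≤y⇒x⊔y≈y (inj₁ x<y))))
      , (λ (y≤x , z≡x) → trans z≡x (sym (x≤y⇒y⊔x≈y y≤x))) ]′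
      (graph x y z (<⊎≥ x y)) })
    (# zero <ᵈ # (suc zero) ×ᵈ # (suc (suc zero)) ≡ᵈ # (suc zero)
      ⊎ᵈ # (suc zero) ≤ᵈ # zero ×ᵈ # (suc (suc zero)) ≡ᵈ # zero))
    where
    graph : ∀ x y z → x < y ⊎ y ≤ x → z ≡ x ⊔ y → (x < y × z ≡ y) ⊎ (y ≤ x × z ≡ x)
    graph x y z (inj₁ p) e = inj₁ (p , trans e (x≤y⇒x⊔y≈y (inj₁ p)))
    graph x y z (inj₂ p) e = inj₂ (p , trans e (x≤y⇒y⊔x≈y p))

  record FunVec (F : Vec C n → Vec C k) : Set where
    constructor funVec
    field component : ∀ j → Fun (λ v → lookup (F v) j)

  open FunVec

  constVecᵈ : (b : Vec C k) → FunVec {n} (λ _ → b)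
  constVecᵈ b = funVec λ j → constᵈ (lookup b j)

  distᵈ : {F G : Vec C n → Vec C k} → FunVec F → FunVec G → Fun (λ v → dist (F v) (G v))
  distᵈ {k = zero} {F} {G} dF dG = Fun-resp (λ v → sym (dist-empty (F v) (G v))) (constᵈ 0#)
    where
    dist-empty : (x y : Vec C 0) → dist x y ≡ 0#
    dist-empty [] [] = refl
  distᵈ {k = suc k} {F} {G} dF dG = Fun-resp (λ v → sym (dist-cons (F v) (G v)))
    ((diff ⊔ᵈ (constᵈ 0# -ᵈ diff)) ⊔ᵈ
      distᵈ {F = tail ∘ F} {tail ∘ G}
            (funVec λ j → Fun-resp (λ v → sym (lookup-tail (F v) j)) (component dF (suc j)))
            (funVec λ j → Fun-resp (λ v → sym (lookup-tail (G v) j)) (component dG (suc j))))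
    where
    diff = component dF zero -ᵈ component dG zero
    dist-cons : (x y : Vec C (suc k)) →
                dist x y ≡ ∣ lookup x zero - lookup y zero ∣ ⊔ dist (tail x) (tail y)
    dist-cons (_ ∷ _) (_ ∷ _) = refl
    lookup-tail : (x : Vec C (suc k)) (j : Fin k) → lookup (tail x) j ≡ lookup x (suc j)
    lookup-tail (_ ∷ _) j = refl

  record DefinablePath (F : C → Vec C k) : Set where
    constructor definablePath
    field coordinate : ∀ j → DefinableFunction M (λ t → lookup (F t) j)

  open DefinablePath

  pathᵈ : {F : C → Vec C k} {g : Vec C n → C} → DefinablePath F → Fun g → FunVec (λ v → F (g v))
  pathᵈ {F = F} dF dg = funVec λ j → function (λ t → lookup (F t) j) (coordinate dF j) dg

  distance : {F G : C → Vec C k} → DefinablePath F → DefinablePath G → 𝒦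
  distance {F = F} {G} dF dG = record
    { fn        = λ t → dist (F t) (G t)
    ; definable = Fun⇒function {u = λ t → dist (F t) (G t)} (distᵈ (pathᵈ dF (# zero)) (pathᵈ dG (# zero)))
    }

  constant-path : (b : Vec C k) → DefinablePath (λ _ → b)
  constant-path b = definablePath λ j → 𝒦.definable (const (lookup b j))

  infix 4 _⟶_
  _⟶_ : (C → Vec C k) → Vec C k → Set
  F ⟶ b = Small (λ t → dist (F t) b)

  PathContinuousAt : (C → Vec C k) → C → Set
  PathContinuousAt F p = ∀ c → 0# < c → Near p λ s → dist (F s) (F p) < c

  abstract
    -- Convergence bounds every coordinate on both sides near `0#`, which is the hypothesis of
    -- `ev-continuous`; any positive constant would do in place of `1#`.
    ev-pathContinuous : {F : C → Vec C k} → DefinablePath F → {b : Vec C k} → F ⟶ b →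
                        Eventually (PathContinuousAt F)
    ev-pathContinuous {F = F} dF {b} F⟶b = ev-map
      (λ {p} h c 0<c → near-map (λ {s} → dist<-intro (F s) (F p) 0<c) (near-all λ j → h j c 0<c))
      (ev-all λ j → ev-continuous (record { fn = λ t → lookup (F t) j ; definable = coordinate dF j })
        (ev-map (λ {t} near → inj₁ (sub-< (subst (lookup b j <_) (+-comm 1# _)
          (proj₂ (dist<-elim (F t) b near j))))) (F⟶b 1# 0<1))
        (ev-map (λ {t} near → inj₁ (proj₁ (dist<-elim (F t) b near j))) (F⟶b 1# 0<1)))

  lookup-ext : {x y : Vec C k} → (∀ j → lookup x j ≡ lookup y j) → x ≡ y
  lookup-ext {x = x} {y} h =
    trans (sym (tabulate∘lookup x)) (trans (tabulate-cong h) (tabulate∘lookup y))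

  graph-definable : {F : C → Vec C k} → DefinablePath F → ∀ ε →
    Definable {n = suc k} M (λ v → Ioo ε (head v) × tail v ≡ F (head v))
  graph-definable {k} {F} dF ε = resp
    (λ { (t ∷ b) → mk⇔ (λ (t∈ , h) → t∈ , lookup-ext h) (λ { (t∈ , refl) → t∈ , λ j → refl }) })
    ((constᵈ 0# <ᵈ # zero ×ᵈ # zero <ᵈ constᵈ ε) ×ᵈ
      allᵈ (λ j → # (suc j) ≡ᵈ component (pathᵈ dF (# zero)) j))

  path-isCurve : {F : C → Vec C k} → DefinablePath F → {b : Vec C k} → F ⟶ b →
                 ∀ ε → (∀ t → Ioo ε t → PathContinuousAt F t) → IsCurve ε b F
  path-isCurve {F = F} dF F⟶b ε cont = record
    { definable  = graph-definable dF ε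
    ; continuous = λ t t∈ η 0<η → let δ , 0<δ , h = near-radius (cont t t∈ η 0<η) in
                     δ , 0<δ , λ s _ s-t → h s (∣-∣<-elim s-t)
    ; limit      = λ η 0<η → let δ , 0<δ , h = F⟶b η 0<η in
                     δ , 0<δ , λ t (0<t , _) t<δ → h t (0<t , t<δ)
    }

  -- The values of `γ` outside `(0, ε)` are arbitrary, so its coordinates need not be definable as
  -- total functions. Projecting the graph over `(0, ε)` and extending by `fromGraph` gives total
  -- definable coordinates.
  curve-path : ∀ {ε} {a : Vec C k} {γ : C → Vec C k} → IsCurve ε a γ →
               ∃ λ F → DefinablePath F × (∀ {t} → Ioo ε t → F t ≡ γ t)
  curve-path {k} {ε} {a} {γ} isCurve =
    (λ t → tabulate λ j → fn (proj₁ (coord j)) t) ,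
    definablePath (λ j → Fun⇒function {u = λ t → lookup (tabulate λ j → fn (proj₁ (coord j)) t) j}
      (Fun-resp (λ v → sym (lookup∘tabulate _ j)) (fnᵈ (proj₁ (coord j)) (# zero)))) ,
    λ {t} t∈ → trans (tabulate-cong λ j → proj₂ (coord j) (t∈ , refl)) (tabulate∘lookup (γ t))
    where
    Coordinate : Fin k → C → C → Set
    Coordinate j t z = Ioo ε t × z ≡ lookup (γ t) j

    -- The graph reads its variables in the order `(t, b)`, whereas quantifying over the tuple `b`
    -- puts them in the order `(b, t, z)`.
    ρ : Fin (suc k) → Fin (k ℕ.+ 2)
    ρ zero    = k ↑ʳ zero
    ρ (suc i) = i ↑ˡ 2

    Graph : Vec C (suc k) → Set
    Graph v = Ioo ε (head v) × tail v ≡ γ (head v)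

    ρ-graph : ∀ (b : Vec C k) t z →
              tabulate (lookup (b ++ (t ∷ z ∷ [])) ∘ ρ) ≡ t ∷ b
    ρ-graph b t z = cong₂ _∷_ (lookup-++ʳ b (t ∷ z ∷ []) zero)
      (trans (tabulate-cong (lookup-++ˡ b (t ∷ z ∷ []))) (tabulate∘lookup b))

    dCoordinate : ∀ j → Def₂ (Coordinate j)
    dCoordinate j = resp
      (λ { (t ∷ z ∷ []) → mk⇔
        (λ (b , g , e) → let t∈ , b≡ = subst Graph (ρ-graph b t z) g in
          t∈ , trans (sym (lookup-++ʳ b (t ∷ z ∷ []) (suc zero)))
            (trans e (trans (lookup-++ˡ b (t ∷ z ∷ []) j) (cong (λ u → lookup u j) b≡))))
        (λ (t∈ , e) → γ t , subst Graph (sym (ρ-graph (γ t) t z)) (t∈ , refl) ,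
          trans (lookup-++ʳ (γ t) (t ∷ z ∷ []) (suc zero))
            (trans e (sym (lookup-++ˡ (γ t) (t ∷ z ∷ []) j)))) })
      (anyᵈ k (reindex ρ (IsCurve.definable isCurve) ×ᵈ # (k ↑ʳ suc zero) ≡ᵈ # (j ↑ˡ 2)))

    coord : ∀ j → ∃ λ x → ∀ {t z} → Coordinate j t z → fn x t ≡ z
    coord j = fromGraph (Coordinate j) (dCoordinate j) λ (_ , e) (_ , e′) → trans e (sym e′)

  insertAtᵈ : {F : Vec C n → Vec C k} {g : Vec C n → C} → FunVec F → ∀ i → Fun g →
              FunVec (λ v → insertAt (F v) i (g v))
  insertAtᵈ {F = F} {g} dF i dg = funVec insert
    where
    insert : ∀ j → Fun (λ v → lookup (insertAt (F v) i (g v)) j)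
    insert j with i ≟ j
    ... | yes refl = Fun-resp (λ v → sym (insertAt-lookup (F v) i (g v))) dg
    ... | no i≢j   = Fun-resp
      (λ v → trans (sym (insertAt-punchIn (F v) i (g v) (punchOut i≢j)))
                   (cong (lookup (insertAt (F v) i (g v))) (punchIn-punchOut i≢j)))
      (component dF (punchOut i≢j))

-- Arcs parametrized by height.

module Arcs (em : ExcludedMiddle 0ℓ) {L : Language} (M : Structure L)
  (isRCF : IsRealClosedOrderedField M) (oMinimal : IsOMinimal M)
  {n : ℕ} (a : Vec (Structure.Carrier M) (suc n)) (i : Fin (suc n)) (sgn : Sign) where

  open OrderedField M isRCF
  open Definability M
  open OMinimality em M isRCF oMinimal
  open GermsOfFunctions em M isRCF oMinimal
  open DefinablePaths em M isRCF oMinimal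
  open Equivalence

  private variable
    k : ℕ
    c s t x y : C
    A B D : Vec C k → Set

  sameGerm-sym : {e : Vec C k} → SameGermAt e A B → SameGermAt e B A
  sameGerm-sym (ε , 0<ε , h) = ε , 0<ε , λ b b∈ → mk⇔ (from (h b b∈)) (to (h b b∈))

  sameGerm-trans : {e : Vec C k} → SameGermAt e A B → SameGermAt e B D → SameGermAt e A D
  sameGerm-trans (ε , 0<ε , g) (δ , 0<δ , h) with min-pos 0<ε 0<δ
  ... | η , 0<η , m = η , 0<η , λ b b∈ →
    mk⇔ (to (h b (proj₂ (m b∈))) ∘ to (g b (proj₁ (m b∈))))
        (from (g b (proj₁ (m b∈))) ∘ from (h b (proj₂ (m b∈))))

  aᵢ : C
  aᵢ = lookup a i

  â : Vec C n
  â = removeAt a i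

  private
    +-diff : ∀ e x y → (e + x) - (e + y) ≡ x - y
    +-diff e x y = +-cancelʳ (e + y) (trans (x-y+y≡x (e + x) (e + y))
      (sym (trans (+-exchange (x - y) e y) (cong (e +_) (x-y+y≡x x y)))))

    ∣-∣-swap : ∀ x y → ∣ x - y ∣ ≡ ∣ y - x ∣
    ∣-∣-swap x y = trans (⊔-comm (x - y) (0# - (x - y)))
      (cong₂ _⊔_ (0-[x-y]≡y-x x y) (sym (0-[x-y]≡y-x y x)))

    -‿diff : ∀ e x y → (e - x) - (e - y) ≡ y - x
    -‿diff e x y = +-cancelʳ (e - y) (trans (x-y+y≡x (e - x) (e - y)) (sym
      (trans (+-exchange (y - x) e (- y)) (cong (e +_) (trans (+-comm (y - x) (- y))
        (trans (sym (+-assoc (- y) y (- x))) (trans (cong (_- x) (-‿inverseˡ y)) (+-identityˡ (- x)))))))))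

  ∣shift-shift∣ : ∀ sgn e s t → ∣ shift sgn e s - shift sgn e t ∣ ≡ ∣ s - t ∣
  ∣shift-shift∣ Sign.+ e s t = cong ∣_∣ (+-diff e s t)
  ∣shift-shift∣ Sign.- e s t = trans (cong ∣_∣ (-‿diff e s t)) (∣-∣-swap t s)

  shift-0 : ∀ sgn e → shift sgn e 0# ≡ e
  shift-0 Sign.+ e = +-identityʳ e
  shift-0 Sign.- e = trans (sym (+-identityʳ (e - 0#))) (x-y+y≡x e 0#)

  shift-injective : ∀ sgn e → shift sgn e s ≡ shift sgn e t → s ≡ t
  shift-injective {s} {t} sgn e h =
    let p , q = ∣-∣≤-elim {s} {t} (inj₂ (trans (sym (∣shift-shift∣ sgn e s t))
                  (trans (cong (λ w → ∣ w - shift sgn e t ∣) h) ∣x-x∣≡0))) in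
    antisym (subst (s ≤_) (+-identityˡ t) p) (subst (t ≤_) (+-identityˡ s) q)
    where
    ∣x-x∣≡0 : ∣ x - x ∣ ≡ 0#
    ∣x-x∣≡0 {x} = trans (cong ∣_∣ (-‿inverseʳ x)) (trans (cong (0# ⊔_) (-‿inverseʳ 0#)) (x≤y⇒x⊔y≈y ≤-refl))

  side-shift : ∀ sgn e → 0# < s → Side sgn e (shift sgn e s)
  side-shift Sign.+ e 0<s = x<x+c 0<s
  side-shift Sign.- e 0<s = x-c<x 0<s

  shift⁻¹ : Sign → C → C → C
  shift⁻¹ Sign.+ e y = y - e
  shift⁻¹ Sign.- e y = e - y

  shift-shift⁻¹ : ∀ sgn e y → shift sgn e (shift⁻¹ sgn e y) ≡ y
  shift-shift⁻¹ Sign.+ e y = x+[y-x]≡y e y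
  shift-shift⁻¹ Sign.- e y = x-[x-y]≡y e y

  side⇒shift⁻¹-pos : ∀ sgn e → Side sgn e y → 0# < shift⁻¹ sgn e y
  side⇒shift⁻¹-pos Sign.+ e = <⇒0<-
  side⇒shift⁻¹-pos Sign.- e = <⇒0<-

  -- A perturbation by less than the height cannot reach the hyperplane.
  side-near : ∀ sgn e → c ≤ s → Close< c y (shift sgn e s) → Side sgn e y
  side-near {c} {s} {y} Sign.+ e c≤s (_ , h) =
    +-cancelˡ-< s (<-≤-trans (subst (_< c + y) (+-comm e s) h) (+-monoˡ-≤ y c≤s))
  side-near {s = s} {y} Sign.- e c≤s (h , _) =
    subst (y <_) (x+[y-x]≡y s e) (<-≤-trans h (+-monoˡ-≤ _ c≤s))

  shift⁻¹ᵈ : ∀ {m} {f : Vec C m → C} sgn e → Fun f → Fun (λ v → shift⁻¹ sgn e (f v))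
  shift⁻¹ᵈ Sign.+ e d = d -ᵈ constᵈ e
  shift⁻¹ᵈ Sign.- e d = constᵈ e -ᵈ d

  shiftᵈ : ∀ {m} {f : Vec C m → C} sgn e → Fun f → Fun (λ v → shift sgn e (f v))
  shiftᵈ Sign.+ e d = constᵈ e +ᵈ d
  shiftᵈ Sign.- e d = constᵈ e -ᵈ d

  dist-shift : (u v : Vec C n) (s t : C) →
               dist (insertAt u i (shift sgn aᵢ s)) (insertAt v i (shift sgn aᵢ t)) ≡ ∣ s - t ∣ ⊔ dist u v
  dist-shift u v s t = trans (dist-insertAt u v i _ _) (cong (_⊔ dist u v) (∣shift-shift∣ sgn aᵢ s t))

  -- As the point at height `0#` over `â`, `a` falls under `dist-shift`, which thus also computes
  -- distances to `a`.
  a-insertAt : a ≡ insertAt â i (shift sgn aᵢ 0#)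
  a-insertAt = trans (sym (insertAt-removeAt a i)) (cong (insertAt â i) (sym (shift-0 sgn aᵢ)))

  dist-to-a : (u : Vec C n) (s : C) → dist (insertAt u i (shift sgn aᵢ s)) a ≡ ∣ s - 0# ∣ ⊔ dist u â
  dist-to-a u s = trans (cong (dist (insertAt u i (shift sgn aᵢ s))) a-insertAt) (dist-shift u â s 0#)

  ≤dist-to-a : (u : Vec C n) (s : C) → s ≤ dist (insertAt u i (shift sgn aᵢ s)) a
  ≤dist-to-a u s = subst (s ≤_) (+-identityʳ _)
    (proj₁ (∣-∣≤-elim {s} {0#} (≤-trans (x≤x⊔y _ _) (inj₂ (sym (dist-to-a u s))))))

  base : Vec 𝔪 n → C → Vec C n
  base xs s = zipWith _+_ â (map (λ x → fn (proj₁ x) s) xs)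

  path : Vec 𝔪 n → C → Vec C (suc n)
  path xs s = insertAt (base xs s) i (shift sgn aᵢ s)

  -- No upper bound on `s` is imposed: the height is at most the distance to `a`, so points with
  -- large `s` stay away from `a` and do not affect the germ.
  arc : Vec 𝔪 n → Vec C (suc n) → Set
  arc xs b = ∃ λ s → 0# < s × b ≡ path xs s

  lookup-base : ∀ xs s j → lookup (base xs s) j ≡ lookup â j + fn (proj₁ (lookup xs j)) s
  lookup-base xs s j = trans (lookup-zipWith _+_ j â _) (cong (lookup â j +_) (lookup-map j _ xs))

  base-sub : ∀ xs s → zipWith _-_ (base xs s) â ≡ map (λ x → fn (proj₁ x) s) xs
  base-sub xs s = cancel â (map (λ x → fn (proj₁ x) s) xs)
    where
    cancel : (u v : Vec C k) → zipWith _-_ (zipWith _+_ u v) u ≡ v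
    cancel []      []      = refl
    cancel (x ∷ u) (y ∷ v) = cong₂ _∷_ (x+y-x≡y x y) (cancel u v)

  definable-base : ∀ xs → DefinablePath (base xs)
  definable-base xs = definablePath λ j → Fun⇒function {u = λ s → lookup (base xs s) j}
    (Fun-resp (λ v → sym (lookup-base xs (lookup v zero) j))
      (constᵈ (lookup â j) +ᵈ fnᵈ (proj₁ (lookup xs j)) (# zero)))

  definable-path : ∀ xs → DefinablePath (path xs)
  definable-path xs = definablePath λ j → Fun⇒function {u = λ s → lookup (path xs s) j}
    (FunVec.component (insertAtᵈ {F = λ v → base xs (lookup v zero)} (pathᵈ (definable-base xs) (# zero)) i
      (shiftᵈ sgn aᵢ (# zero))) j)

  base⟶â : ∀ xs → base xs ⟶ â
  base⟶â xs c 0<c = ev-map (λ {s} h → dist<-intro (base xs s) â 0<c λ j →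
      subst (λ w → Close< c w (lookup â j)) (sym (lookup-base xs s j)) (close (h j)))
    (ev-all λ j → proj₂ (lookup xs j) c 0<c)
    where
    close : ∀ {e x} → ∣ x ∣ < c → Close< c (e + x) e
    close {e} {x} h =
      subst ((e + x) <_) (+-comm e c) (+-monoʳ-< e (≤-<-trans (x≤x⊔y _ _) h)) ,
      subst₂ _<_ (+-identityʳ e) (+-exchange e c x) (+-monoʳ-< e
        (<-sub (≤-<-trans (x≤y⊔x _ _) h)))

  path⟶a : ∀ xs → path xs ⟶ a
  path⟶a xs c 0<c = eventually-map₂
    (λ {s} near (0<s , s<c) → subst (_< c) (sym (dist-to-a (base xs s) s))
      (⊔-lub-< (∣-∣<-intro (subst (s <_) (sym (+-identityʳ c)) s<c , +-pos 0<c 0<s)) near))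
    (base⟶â xs c 0<c) (ev-× ev-pos (ev-< 0<c))

  -- Translation by `â` cancels in the differences. With `path-same-height`, the metric of `𝔪` at
  -- `s` is thus the distance between the points of height `s` on the two arcs.
  fn-distᴷ : ∀ xs ys s → fn (distᴷ (map proj₁ xs) (map proj₁ ys)) s ≡ dist (base xs s) (base ys s)
  fn-distᴷ xs ys s = go â xs ys
    where
    go : (u : Vec C k) (xs ys : Vec 𝔪 k) → fn (distᴷ (map proj₁ xs) (map proj₁ ys)) s ≡
         dist (zipWith _+_ u (map (λ x → fn (proj₁ x) s) xs)) (zipWith _+_ u (map (λ x → fn (proj₁ x) s) ys))
    go []      []       []       = refl
    go (e ∷ u) (x ∷ xs) (y ∷ ys) =
      cong₂ _⊔_ (cong ∣_∣ (sym (+-diff e (fn (proj₁ x) s) (fn (proj₁ y) s)))) (go u xs ys)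

  dist-path : ∀ xs ys s t → dist (path xs s) (path ys t) ≡ ∣ s - t ∣ ⊔ dist (base xs s) (base ys t)
  dist-path xs ys s t = dist-shift (base xs s) (base ys t) s t

  base≤path : ∀ xs ys s t → dist (base xs s) (base ys t) ≤ dist (path xs s) (path ys t)
  base≤path xs ys s t = ≤-trans (x≤y⊔x _ _) (inj₂ (sym (dist-path xs ys s t)))

  height-close : ∀ xs ys {s t} → dist (path xs s) (path ys t) < c → Close< c s t
  height-close xs ys {s} {t} h = Close≤-<-trans h
    (∣-∣≤-elim {s} {t} (≤-trans (x≤x⊔y _ _) (inj₂ (sym (dist-path xs ys s t)))))

  path-same-height : ∀ xs ys s → dist (path xs s) (path ys s) ≡ dist (base xs s) (base ys s)
  path-same-height xs ys s = trans (dist-path xs ys s s)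
    (x≤y⇒x⊔y≈y (≤-trans (∣-∣≤-intro (let p = inj₂ (sym (+-identityˡ s)) in p , p))
      (0≤dist (base xs s) (base ys s))))

  radius : Vec 𝔪 n → C → C
  radius xs s = dist (path xs s) a

  height≤radius : ∀ xs s → s ≤ radius xs s
  height≤radius xs s = ≤dist-to-a (base xs s) s

  radius-close : ∀ xs ys {s t} → dist (path xs s) (path ys t) < c → Close< c (radius xs s) (radius ys t)
  radius-close {c} xs ys {s} {t} h =
    ≤-<-trans (dist-triangle (path xs s) (path ys t) a) (+-monoˡ-< _ h) ,
    ≤-<-trans (dist-triangle (path ys t) (path xs s) a)
      (+-monoˡ-< _ (subst (_< c) (dist-sym (path xs s) (path ys t)) h))

  record RegularOn (xs : Vec 𝔪 n) (z : C) : Set where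
    field
      rises      : Rising (radius xs) z
      continuous : ∀ t → Ioo z t → PathContinuousAt (path xs) t
    open Rising rises public

  abstract
    regular : ∀ xs → ∃ (RegularOn xs)
    regular xs =
      let z , rise = rising (distance (definable-path xs) (constant-path a)) (path⟶a xs)
                       (ev-map (λ 0<s → <-≤-trans 0<s (height≤radius xs _)) ev-pos)
          ε , 0<ε , cont = ev-pathContinuous (definable-path xs) (path⟶a xs)
          w , w≤z , w≤ε , glb = minimum z ε
      in w , record
        { rises      = Rising-shrink (glb 0# (Rising.0<z rise) 0<ε) w≤z rise
        ; continuous = λ t (0<t , t<w) → cont t (0<t , <-≤-trans t<w w≤ε)
        }

  _≋_ : Vec 𝔪 n → Vec 𝔪 n → Set
  _≋_ = Pointwise (λ x y → proj₁ x ≈ᴷ proj₁ y)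

  -- Coordinate `i` determines the height, so a common point of the two arcs has the same parameter
  -- on both and hence the same base point.
  arc-unique : ∀ {xs ys} → SameGermAt a (arc xs) (arc ys) → xs ≋ ys
  arc-unique {xs} {ys} (ε , 0<ε , h) = ext xs ys λ j →
    ev-map (λ e → e j) (eventually-map₂ coords (path⟶a xs ε 0<ε) ev-pos)
    where
    ext : (xs ys : Vec 𝔪 k) → (∀ j → proj₁ (lookup xs j) ≈ᴷ proj₁ (lookup ys j)) →
          Pointwise (λ x y → proj₁ x ≈ᴷ proj₁ y) xs ys
    ext []       []       e = []
    ext (x ∷ xs) (y ∷ ys) e = e zero ∷ ext xs ys (e ∘ suc)

    coords : dist (path xs s) a < ε → 0# < s →
             ∀ j → fn (proj₁ (lookup xs j)) s ≡ fn (proj₁ (lookup ys j)) s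
    coords {s} near 0<s j with to (h (path xs s) near) (s , 0<s , refl)
    ... | t , 0<t , e with shift-injective sgn aᵢ (trans (sym (insertAt-lookup (base xs s) i _))
                            (trans (cong (λ b → lookup b i) e) (insertAt-lookup (base ys t) i _)))
    ...   | refl = +-cancelʳ (lookup â j) (trans (+-comm _ _) (trans (sym (lookup-base xs s j))
      (trans (cong (λ u → lookup u j) base≡) (trans (lookup-base ys s j) (+-comm _ _)))))
      where
      base≡ : base xs s ≡ base ys s
      base≡ = trans (sym (removeAt-insertAt (base xs s) i _))
        (trans (cong (λ b → removeAt b i) e) (removeAt-insertAt (base ys s) i _))

  base-eventually : ∀ {xs ys} → xs ≋ ys → Eventually (λ s → base xs s ≡ base ys s)
  base-eventually e = ev-map (cong (zipWith _+_ â)) (go e)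
    where
    go : {xs ys : Vec 𝔪 k} → Pointwise (λ x y → proj₁ x ≈ᴷ proj₁ y) xs ys →
         Eventually (λ s → map (λ x → fn (proj₁ x) s) xs ≡ map (λ x → fn (proj₁ x) s) ys)
    go []       = 1# , 0<1 , λ _ _ → refl
    go (x ∷ xs) = eventually-map₂ (cong₂ _∷_) x (go xs)

  -- In the ball of radius `η` all heights are below `η`, where the parameter ranges and the base
  -- points of both descriptions agree.
  arc-image : ∀ {xs ε} {u : C → Vec C n} → 0# < ε → Eventually (λ s → base xs s ≡ u s) →
              SameGermAt a (arc xs) (image ε (λ s → insertAt (u s) i (shift sgn aᵢ s)))
  arc-image {xs} {ε} {u} 0<ε (δ , 0<δ , h) with min-pos 0<ε 0<δ
  ... | η , 0<η , m = η , 0<η , λ b b∈ → mk⇔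
    (λ { (s , 0<s , refl) → let s<ε , s<δ = m (≤-<-trans (height≤radius xs s) b∈) in
      s , (0<s , s<ε) , cong (λ w → insertAt w i (shift sgn aᵢ s)) (h s (0<s , s<δ)) })
    (λ { (s , (0<s , s<ε) , refl) → let s<ε , s<δ = m (≤-<-trans (≤dist-to-a (u s) s) b∈) in
      s , 0<s , cong (λ w → insertAt w i (shift sgn aᵢ s)) (sym (h s (0<s , s<δ))) })

  arc-cong : ∀ {xs ys} → xs ≋ ys → SameGermAt a (arc xs) (arc ys)
  arc-cong {xs} {ys} e = sameGerm-trans {B = image 1# (path ys)}
    (arc-image {u = base ys} 0<1 (base-eventually e))
    (sameGerm-sym {A = arc ys} (arc-image {u = base ys} 0<1 (1# , 0<1 , λ _ _ → refl)))

-- Bounding the Hausdorff distance of two arcs by their distance at equal height.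

module Estimates (em : ExcludedMiddle 0ℓ) {L : Language} (M : Structure L)
  (isRCF : IsRealClosedOrderedField M) (oMinimal : IsOMinimal M)
  {n : ℕ} (a : Vec (Structure.Carrier M) (suc n)) (i : Fin (suc n)) (sgn : Sign) where

  open OrderedField M isRCF
  open Definability M
  open OMinimality em M isRCF oMinimal
  open GermsOfFunctions em M isRCF oMinimal
  open DefinablePaths em M isRCF oMinimal
  open Arcs em M isRCF oMinimal a i sgn
  open Equivalence

  private variable
    k : ℕ
    v : C
    A A′ B B′ : Vec C k → Set

  IsDistTo-⇔ : (q : Vec C k) → (∀ y → B y ⇔ B′ y) → IsDistTo B q v → IsDistTo B′ q v
  IsDistTo-⇔ q h = IsInf-⇔ λ w → mk⇔ (λ (y , y∈ , e) → y , to (h y) y∈ , e)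
                                   (λ (y , y∈ , e) → y , from (h y) y∈ , e)

  IsExcess-⇔ : (∀ y → A y ⇔ A′ y) → (∀ y → B y ⇔ B′ y) → IsExcess A B v → IsExcess A′ B′ v
  IsExcess-⇔ h h′ = IsSup-⇔ λ w → mk⇔
    (λ (x , x∈ , d) → x , to (h x) x∈ , IsDistTo-⇔ x h′ d)
    (λ (x , x∈ , d) → x , from (h x) x∈ , IsDistTo-⇔ x (λ y → mk⇔ (from (h′ y)) (to (h′ y))) d)

  InBall : Vec 𝔪 n → C → C → Set
  InBall xs t s = 0# < s × radius xs s < t

  Ray : Vec 𝔪 n → C → Vec C (suc n) → Set
  Ray xs t y = ∃ λ s → InBall xs t s × y ≡ path xs s

  ray-⇔ : ∀ {xs} → SameGermAt a A (arc xs) →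
          Eventually (λ t → ∀ y → (ball a t ∩ A) y ⇔ Ray xs t y)
  ray-⇔ (ε , 0<ε , h) = ε , 0<ε , λ t (_ , t<ε) y → mk⇔
    (λ (y∈ , Ay) → let s , 0<s , y≡ = to (h y (<-trans y∈ t<ε)) Ay in
      s , (0<s , subst (λ y → dist y a < t) y≡ y∈) , y≡)
    (λ { (s , (0<s , s<t) , refl) → s<t , from (h y (<-trans s<t t<ε)) (s , 0<s , refl) })

  dist-to-ray : ∀ ys t {s} → InBall ys t s → (q : Vec C (suc n)) → ∃ (IsDistTo (Ray ys t) q)
  dist-to-ray ys t {s} s∈ q = inf-exists {b = 0#}
    (resp (λ v → mk⇔ (λ (s , s∈ , e) → path ys s , (s , s∈ , refl) , e)
                     (λ { (_ , (s , s∈ , refl) , e) → s , s∈ , e }))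
      (∃ᵈ ((constᵈ 0# <ᵈ # zero ×ᵈ radiusᵈ <ᵈ constᵈ t) ×ᵈ
        # (suc zero) ≡ᵈ distᵈ (constVecᵈ q) (pathᵈ (definable-path ys) (# zero)))))
    (path ys s , (s , s∈ , refl) , refl)
    (λ { _ (y , _ , refl) → 0≤dist q y })
    where
    radiusᵈ = distᵈ (pathᵈ (definable-path ys) (# zero)) (constVecᵈ a)

  module _ (xs ys : Vec 𝔪 n) where
    private
      -- Distances and excesses are rewritten with parameters of the arcs in place of points, so
      -- that quantifiers run over single elements and the excess is visibly definable in `t`.
      rayDistance : C → C → C → Set
      rayDistance t s w = ∃ λ s′ → InBall ys t s′ × w ≡ dist (path xs s) (path ys s′)

      rayExcess : C → C → Set
      rayExcess t e = IsSup (λ w → ∃ λ s → InBall xs t s × IsInf (rayDistance t s) w) e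

      -- The tuple of variables is (s′ , w′ , s , w , t) in rayDistance, and (w , t , e) in rayExcess.
      dRayExcess : Def₂ rayExcess
      dRayExcess = IsSupᵈ
        (∃ᵈ ((constᵈ 0# <ᵈ # zero ×ᵈ
               distᵈ (pathᵈ (definable-path xs) (# zero)) (constVecᵈ a) <ᵈ # (suc (suc zero))) ×ᵈ
          IsInfᵈ (∃ᵈ ((constᵈ 0# <ᵈ # zero ×ᵈ
                        distᵈ (pathᵈ (definable-path ys) (# zero)) (constVecᵈ a) <ᵈ # (suc (suc (suc (suc zero))))) ×ᵈ
              # (suc zero) ≡ᵈ distᵈ (pathᵈ (definable-path xs) (# (suc (suc zero))))
                                    (pathᵈ (definable-path ys) (# zero))))
            (# (suc zero))))
        (# (suc zero))

      ray-⇔-distance : ∀ t s w → (∃ λ y → Ray ys t y × w ≡ dist (path xs s) y) ⇔ rayDistance t s w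
      ray-⇔-distance t s w = mk⇔
        (λ { (_ , (s′ , s′∈ , refl) , e) → s′ , s′∈ , e })
        (λ (s′ , s′∈ , e) → path ys s′ , (s′ , s′∈ , refl) , e)

      ray-⇔-excess : ∀ t w → (∃ λ s → InBall xs t s × IsInf (rayDistance t s) w) ⇔
                             (∃ λ x → Ray xs t x × IsDistTo (Ray ys t) x w)
      ray-⇔-excess t w = mk⇔
        (λ (s , s∈ , d) → path xs s , (s , s∈ , refl) ,
          IsInf-⇔ (λ w → mk⇔ (from (ray-⇔-distance t s w)) (to (ray-⇔-distance t s w))) d)
        (λ { (_ , (s , s∈ , refl) , d) → s , s∈ , IsInf-⇔ (ray-⇔-distance t s) d })

    excess : ∃ λ x → ∀ {t e} → rayExcess t e → fn x t ≡ e
    excess = fromGraph rayExcess dRayExcess IsSup-unique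

    -- Matching every point with one at distance at most `b` bounds the set of distances, so the
    -- supremum exists, `s₀` providing an element. By uniqueness it is the value of the germ
    -- `excess`.
    excess-bound : ∀ {t s₀ b} → InBall xs t s₀ →
      (∀ s → InBall xs t s → ∃ λ s′ → InBall ys t s′ × dist (path xs s) (path ys s′) ≤ b) →
      IsExcess (Ray xs t) (Ray ys t) (fn (proj₁ excess) t) × fn (proj₁ excess) t ≤ b
    excess-bound {t} {s₀} {b} s₀∈ close =
      subst (λ e → IsExcess (Ray xs t) (Ray ys t) e × e ≤ b) (sym (proj₂ excess isSup))
        (IsSup-⇔ (ray-⇔-excess t) isSup , proj₂ isSup b bounded)
      where
      bounded : ∀ w → (∃ λ s → InBall xs t s × IsInf (rayDistance t s) w) → w ≤ b
      bounded w (s , s∈ , lb , _) = let s′ , s′∈ , d≤b = close s s∈ in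
        ≤-trans (lb _ (s′ , s′∈ , refl)) d≤b

      start : ∃ λ w → InBall xs t s₀ × IsInf (rayDistance t s₀) w
      start = let s′ , s′∈ , _ = close s₀ s₀∈
                  w , d = dist-to-ray ys t s′∈ (path xs s₀)
              in w , s₀∈ , IsInf-⇔ (ray-⇔-distance t s₀) d

      sup : ∃ (rayExcess t)
      sup = sup-exists {b = b}
        (∃ᵈ ((constᵈ 0# <ᵈ # zero ×ᵈ
               distᵈ (pathᵈ (definable-path xs) (# zero)) (constVecᵈ a) <ᵈ constᵈ t) ×ᵈ
          IsInfᵈ (∃ᵈ ((constᵈ 0# <ᵈ # zero ×ᵈ
                        distᵈ (pathᵈ (definable-path ys) (# zero)) (constVecᵈ a) <ᵈ constᵈ t) ×ᵈ
              # (suc zero) ≡ᵈ distᵈ (pathᵈ (definable-path xs) (# (suc (suc zero))))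
                                    (pathᵈ (definable-path ys) (# zero))))
            (# (suc zero))))
        (s₀ , proj₂ start) bounded

      isSup = proj₂ sup

  module _ (xs : Vec 𝔪 n) {z : C} (reg : RegularOn xs z) (r₁ : 𝒦) {z₁ : C}
           (r₁-rises : Rising (fn r₁) z₁) where
    open RegularOn reg using (rises; continuous)

    -- A modulus of continuity at `τ` for the path as a function of its radius. The extra summand
    -- `c` leaves room for the distance between the two curves at equal height.
    Good : C → C → Set
    Good τ c = ∀ s s′ → Ioo z s → Ioo z s′ → radius xs s ≡ τ → Close< c (radius xs s′) τ →
               dist (path xs s) (path xs s′) + c < fn r₁ τ

    dGood : Def₂ Good
    dGood = ∀ᵈ (∀ᵈ (
      (constᵈ 0# <ᵈ s ×ᵈ s <ᵈ constᵈ z) →ᵈ (constᵈ 0# <ᵈ s′ ×ᵈ s′ <ᵈ constᵈ z) →ᵈ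
      radiusᵈ s ≡ᵈ τ →ᵈ (radiusᵈ s′ <ᵈ (c +ᵈ τ) ×ᵈ τ <ᵈ (c +ᵈ radiusᵈ s′)) →ᵈ
      (distᵈ (pathᵈ (definable-path xs) s) (pathᵈ (definable-path xs) s′) +ᵈ c) <ᵈ fnᵈ r₁ τ))
      where
      s′ = # {4} zero
      s = # {4} (suc zero)
      τ = # {4} (suc (suc zero))
      c = # {4} (suc (suc (suc zero)))
      radiusᵈ : {f : Vec C 4 → C} → Fun f → Fun (λ v → radius xs (f v))
      radiusᵈ d = distᵈ (pathᵈ (definable-path xs) d) (constVecᵈ a)

    good-down : DownClosed Good
    good-down _ c′≤c g s s′ s∈ s′∈ e (p , q) = ≤-<-trans (+-monoʳ-≤ _ c′≤c)
      (g s s′ s∈ s′∈ e (<-≤-trans p (+-monoˡ-≤ _ c′≤c) , <-≤-trans q (+-monoˡ-≤ _ c′≤c)))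

    -- One half of `fn r₁ τ` is for the distance between the two points of the path, the other for
    -- `c`. Injectivity of the radius identifies `s` with `s₀`.
    some-good : ∀ {τ} → (∃ λ s → Ioo z s × radius xs s ≡ τ) → Ioo z₁ τ → ∃ λ c → 0# < c × Good τ c
    some-good (s₀ , s₀∈ , refl) τ∈ = c , 0<c , good
      where
      τ = radius xs s₀
      halves = half-pos (Rising.positive r₁-rises τ∈)
      h = proj₁ halves
      near = Rising.inverse-continuous rises s₀∈ (continuous s₀ s₀∈ h (proj₁ (proj₂ (proj₂ halves))))
      witness = ev-witness 0<1 (ev-× (ev-< (proj₁ (proj₂ near))) (ev-< (proj₁ (proj₂ (proj₂ halves)))))
      c = proj₁ witness
      0<c = proj₁ (proj₁ (proj₂ witness))
      c<c₁ = proj₁ (proj₂ (proj₂ witness))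
      c<h = proj₂ (proj₂ (proj₂ witness))

      good : Good τ c
      good s s′ s∈ s′∈ e (p , q) with Rising.injective rises s∈ s₀∈ e
      ... | refl = subst (dist (path xs s) (path xs s′) + c <_) (proj₁ (proj₂ halves))
          (<-trans (+-monoʳ-< (dist (path xs s) (path xs s′)) c<h) (+-monoˡ-< h d<h))
        where
        d<h : dist (path xs s) (path xs s′) < h
        d<h = subst (_< h) (dist-sym (path xs s′) (path xs s))
          (proj₂ (proj₂ near) s′ s′∈
            (<-trans p (+-monoˡ-< τ c<c₁) , <-trans q (+-monoˡ-< (radius xs s′) c<c₁)))

    good-tolerance : ∃ λ ω → Eventually λ t → 0# < fn ω t × fn ω t ≤ t × Good t (fn ω t)
    good-tolerance = tolerance Good dGood good-down
      (eventually-map₂ some-good (Rising.ev-attains rises)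
        (z₁ , Rising.0<z r₁-rises , λ _ t∈ → t∈))

  -- Both curves are compared at equal distance τ from a, so that truncating them by a ball around a
  -- is harmless.  The comparison goes through the point of the first curve that has the height of
  -- the point of the second one, whence a modulus of continuity for the inverse of the radius.
  module _ (xs : Vec 𝔪 n) {z : C} (reg : RegularOn xs z) (r r₁ : 𝒦) {z₁ : C}
           (r₁-rises : Rising (fn r₁) z₁) (r₁-below : ∀ t → Ioo z₁ t → fn r₁ t < fn r t × fn r₁ t ≤ t)
           (ω : 𝒦) (ωtol : Eventually λ t → 0# < fn ω t × fn ω t ≤ t × Good xs reg r₁ r₁-rises t (fn ω t))
    where
    open RegularOn reg using (rises)

    ω-rises : ∃ (Rising (fn ω))
    ω-rises = rising ω
      (λ c 0<c → eventually-map₂ (λ (_ , ω≤t , _) t<c → ≤-<-trans ω≤t t<c) ωtol (ev-< 0<c))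
      (ev-map proj₁ ωtol)

    module _ (ys : Vec 𝔪 n) (close : distᴷ (map proj₁ xs) (map proj₁ ys) <ᴷ ω) where
      same-radius : Eventually λ ζ → ∀ s s′ → 0# < s → 0# < s′ → radius xs s < ζ →
                    radius ys s′ ≡ radius xs s → dist (path xs s) (path ys s′) < fn r₁ (radius xs s)
      same-radius =
        let δ , 0<δ , all = ev-× ωtol (ev-× close (ev-× (ev-< (Rising.0<z rises))
                              (ev-< (Rising.0<z (proj₂ ω-rises)))))
        in δ , 0<δ , λ ζ (_ , ζ<δ) s s′ 0<s 0<s′ τ<ζ e →
        let τ = radius xs s
            s≤τ = height≤radius xs s
            s′≤τ = subst (s′ ≤_) e (height≤radius ys s′)
            τ<δ = <-trans τ<ζ ζ<δ
            (0<ωτ , _ , good) , _ , τ<z , τ<z₂ = all τ (<-≤-trans 0<s s≤τ , τ<δ)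
            _ , close′ , _ = all s′ (0<s′ , ≤-<-trans s′≤τ τ<δ)
            -- Closeness is known at height `s′`, the modulus is used at `τ`; since `s′ ≤ τ`,
            -- monotonicity of `ω` bridges the two.
            d<ω = <-≤-trans
              (subst (_< fn ω s′) (trans (fn-distᴷ xs ys s′) (sym (path-same-height xs ys s′))) close′)
              (monotone 0<s′ s′≤τ τ<z₂)
        in ≤-<-trans (dist-triangle (path xs s) (path xs s′) (path ys s′))
             (<-trans (+-monoʳ-< _ d<ω)
               (good s s′ (0<s , ≤-<-trans s≤τ τ<z) (0<s′ , ≤-<-trans s′≤τ τ<z) refl
                 (subst (Close< (fn ω τ) (radius xs s′)) e (radius-close xs ys d<ω))))
        where
        monotone : ∀ {s t} → 0# < s → s ≤ t → t < proj₁ ω-rises → fn ω s ≤ fn ω t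
        monotone 0<s (inj₁ s<t) t<z = inj₁ (Rising.increasing (proj₂ ω-rises) 0<s s<t t<z)
        monotone _ (inj₂ refl) _    = ≤-refl

      attained : ∀ xs → Eventually λ τ → ∃ λ s → 0# < s × radius xs s ≡ τ
      attained xs = ev-map (λ (s , (0<s , _) , e) → s , 0<s , e)
        (Rising.ev-attains (RegularOn.rises (proj₂ (regular xs))))

      e : 𝒦
      e = proj₁ (excess xs ys) ⊔ᴷ proj₁ (excess ys xs)

      Comparable : C → Set
      Comparable τ = (∀ s s′ → 0# < s → 0# < s′ → radius xs s < τ →
                       radius ys s′ ≡ radius xs s → dist (path xs s) (path ys s′) < fn r₁ (radius xs s)) ×
                     (∃ λ s → 0# < s × radius xs s ≡ τ) × (∃ λ s → 0# < s × radius ys s ≡ τ)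

      module _ (δ : C) (δ≤z₁ : δ ≤ z₁)
        (all : ∀ τ → Ioo δ τ → Comparable τ) (t : C) (t∈ : Ioo δ t) where

        -- Replaces the separate bounds at the radii below `t` by the single bound `fn r₁ t`.
        radius-increases : ∀ {τ} → 0# < τ → τ < t → fn r₁ τ ≤ fn r₁ t
        radius-increases 0<τ τ<t =
          inj₁ (Rising.increasing r₁-rises 0<τ τ<t (<-≤-trans (proj₂ t∈) δ≤z₁))

        nonempty : ∀ us → (∀ τ → Ioo δ τ → ∃ λ s → 0# < s × radius us s ≡ τ) → ∃ (InBall us t)
        nonempty us attain with dense (proj₁ t∈)
        ... | τ , 0<τ , τ<t with attain τ (0<τ , <-trans τ<t (proj₂ t∈))
        ...   | s , 0<s , refl = s , 0<s , τ<t

        forth : ∀ s → InBall xs t s →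
                ∃ λ s′ → InBall ys t s′ × dist (path xs s) (path ys s′) ≤ fn r₁ t
        forth s (0<s , s<t)
          with all (radius xs s) (<-≤-trans 0<s (height≤radius xs s) , <-trans s<t (proj₂ t∈))
        ... | _ , _ , s′ , 0<s′ , e′ = s′ , (0<s′ , subst (_< t) (sym e′) s<t) ,
          ≤-trans (inj₁ (proj₁ (all t t∈) s s′ 0<s 0<s′ s<t e′))
                  (radius-increases (<-≤-trans 0<s (height≤radius xs s)) s<t)

        back : ∀ s′ → InBall ys t s′ →
               ∃ λ s → InBall xs t s × dist (path ys s′) (path xs s) ≤ fn r₁ t
        back s′ (0<s′ , s′<t)
          with all (radius ys s′) (<-≤-trans 0<s′ (height≤radius ys s′) , <-trans s′<t (proj₂ t∈))
        ... | _ , (s , 0<s , e′) , _ = s , (0<s , s<t) ,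
          subst (_≤ fn r₁ t) (dist-sym (path xs s) (path ys s′))
            (≤-trans (inj₁ (proj₁ (all t t∈) s s′ 0<s 0<s′ s<t (sym e′)))
                     (radius-increases (<-≤-trans 0<s (height≤radius xs s)) s<t))
          where
          s<t : radius xs s < t
          s<t = subst (_< t) (sym e′) s′<t

        hausdorff-bound : IsHausdorffDistance (Ray xs t) (Ray ys t) (fn e t) × fn e t ≤ fn r₁ t
        hausdorff-bound = (_ , _ , proj₁ there′ , proj₁ back′ , refl) , ⊔-lub (proj₂ there′) (proj₂ back′)
          where
          there′ = excess-bound xs ys
            (proj₂ (nonempty xs (λ τ τ∈ → proj₁ (proj₂ (all τ τ∈))))) forth
          back′ = excess-bound ys xs
            (proj₂ (nonempty ys (λ τ τ∈ → proj₂ (proj₂ (all τ τ∈))))) back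

      hausdorff : Eventually λ t → IsHausdorffDistance (Ray xs t) (Ray ys t) (fn e t) × fn e t < fn r t
      hausdorff = combine (ev-× same-radius (ev-× (attained xs) (attained ys)))
        where
        combine : Eventually Comparable →
                  Eventually λ t → IsHausdorffDistance (Ray xs t) (Ray ys t) (fn e t) × fn e t < fn r t
        combine (ε , 0<ε , all) = let δ , δ≤ε , δ≤z₁ , glb = minimum ε z₁ in
          δ , glb 0# 0<ε (Rising.0<z r₁-rises) , λ t t∈ →
          let h , e≤r₁ = hausdorff-bound δ δ≤z₁
                           (λ τ (0<τ , τ<δ) → all τ (0<τ , <-≤-trans τ<δ δ≤ε)) t t∈
          in h , ≤-<-trans e≤r₁ (proj₁ (r₁-below t (proj₁ t∈ , <-≤-trans (proj₂ t∈) δ≤z₁)))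

      estimate : ∀ {A B} → SameGermAt a A (arc xs) → SameGermAt a B (arc ys) →
        ∃ λ e → (Eventually λ t → IsHausdorffDistance (ball a t ∩ A) (ball a t ∩ B) (fn e t)) × e <ᴷ r
      estimate A~ B~ = e , eventually-map₂
        (λ ((e₁ , e₂ , ex₁ , ex₂ , e≡) , _) (h , h′) → e₁ , e₂ ,
          IsExcess-⇔ (flip h) (flip h′) ex₁ , IsExcess-⇔ (flip h′) (flip h) ex₂ , e≡)
        hausdorff (ev-× (ray-⇔ A~) (ray-⇔ B~)) , ev-map proj₂ hausdorff
        where
        flip : (∀ y → A y ⇔ B y) → ∀ y → B y ⇔ A y
        flip h y = mk⇔ (from (h y)) (to (h y))

  -- This is continuity at `xs` of the inverse map. The sets `A` and `B` are any sets with the germs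
  -- of the arcs, so that images of curves can be inserted.
  path-estimate : ∀ xs r → const 0# <ᴷ r → ∃ λ ω → const 0# <ᴷ ω ×
    (∀ ys → distᴷ (map proj₁ xs) (map proj₁ ys) <ᴷ ω →
     ∀ {A B} → SameGermAt a A (arc xs) → SameGermAt a B (arc ys) →
     ∃ λ e → (Eventually λ t → IsHausdorffDistance (ball a t ∩ A) (ball a t ∩ B) (fn e t)) × e <ᴷ r)
  path-estimate xs r 0<r =
    let z , reg = regular xs
        r₁ , z₁ , r₁-rises , r₁-below = rising-below r 0<r
        ω , ωtol = good-tolerance xs reg r₁ r₁-rises
    in ω , ev-map proj₁ ωtol , estimate xs reg r r₁ r₁-rises r₁-below ω ωtol

-- Curves at small Hausdorff distance from an arc.

module Tracking (em : ExcludedMiddle 0ℓ) {L : Language} (M : Structure L)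
  (isRCF : IsRealClosedOrderedField M) (oMinimal : IsOMinimal M)
  {n : ℕ} (a : Vec (Structure.Carrier M) (suc n)) (i : Fin (suc n)) (sgn : Sign) where

  open OrderedField M isRCF
  open Definability M
  open OMinimality em M isRCF oMinimal
  open GermsOfFunctions em M isRCF oMinimal
  open DefinablePaths em M isRCF oMinimal
  open Arcs em M isRCF oMinimal a i sgn
  open Estimates em M isRCF oMinimal a i sgn
  open Equivalence

  Close<-mono : ∀ {c d x y} → c ≤ d → Close< c x y → Close< d x y
  Close<-mono {x = x} {y} c≤d (p , q) = <-≤-trans p (+-monoˡ-≤ y c≤d) , <-≤-trans q (+-monoˡ-≤ x c≤d)

  module _ (xs : Vec 𝔪 n) (r : 𝒦) where
    -- A path of another germ passing at distance < c from path xs s does so at a height t close to s,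
    -- and is then at distance < r from xs at t.
    Follows : C → C → Set
    Follows c s = c ≤ s × (∀ t → 0# < t → Close< c t s → dist (base xs t) (base xs s) + c < fn r t)

    follows-down : ∀ {c c′ s} → c′ ≤ c → Follows c s → Follows c′ s
    follows-down c′≤c (c≤s , h) = ≤-trans c′≤c c≤s , λ t 0<t close →
      ≤-<-trans (+-monoʳ-≤ _ c′≤c) (h t 0<t (Close<-mono c′≤c close))

    module _ {z : C} (reg : RegularOn xs z) where
      open RegularOn reg using (rises; continuous)

      -- At scale t only the points of the first curve at distance about t / 2 from a matter.
      GoodScale : C → C → Set
      GoodScale t c = ∃ λ τ → τ + τ ≡ t × c ≤ τ ×
        (∀ s → Ioo z s → Close< c (radius xs s) τ → Follows c s)

      -- The tuple of variables is (u , s , τ , t , c).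
      dGoodScale : Def₂ GoodScale
      dGoodScale = ∃ᵈ ((# zero +ᵈ # zero) ≡ᵈ # (suc zero) ×ᵈ # (suc (suc zero)) ≤ᵈ # zero ×ᵈ
        ∀ᵈ ((constᵈ 0# <ᵈ # zero ×ᵈ # zero <ᵈ constᵈ z) →ᵈ
            (radiusᵈ <ᵈ (# (suc (suc (suc zero))) +ᵈ # (suc zero)) ×ᵈ
             # (suc zero) <ᵈ (# (suc (suc (suc zero))) +ᵈ radiusᵈ)) →ᵈ
            (# (suc (suc (suc zero))) ≤ᵈ # zero ×ᵈ
             ∀ᵈ (constᵈ 0# <ᵈ # zero →ᵈ
               (# zero <ᵈ (# (suc (suc (suc (suc zero)))) +ᵈ # (suc zero)) ×ᵈ
                # (suc zero) <ᵈ (# (suc (suc (suc (suc zero)))) +ᵈ # zero)) →ᵈ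
               (distᵈ (pathᵈ (definable-base xs) (# zero)) (pathᵈ (definable-base xs) (# (suc zero)))
                 +ᵈ # (suc (suc (suc (suc zero))))) <ᵈ fnᵈ r (# zero)))))
        where
        radiusᵈ : Fun {4} (λ v → radius xs (lookup v zero))
        radiusᵈ = distᵈ (pathᵈ (definable-path xs) (# zero)) (constVecᵈ a)

      goodScale-down : DownClosed GoodScale
      goodScale-down _ c′≤c (τ , e , c≤τ , h) = τ , e , ≤-trans c′≤c c≤τ , λ s s∈ close →
        follows-down c′≤c (h s s∈ (Close<-mono c′≤c close))

      module _ (r₁ : 𝒦) {z₁ : C} (r₁-rises : Rising (fn r₁) z₁)
               (r₁<r : ∀ t → Ioo z₁ t → fn r₁ t < fn r t) where

        -- Of the four quarters `κ` of `fn r₁ h`, two pay for passing from `t` to `s` through `s₀`,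
        -- one for `c`, and one is spare. The height `h` lies below every `t` that occurs, so
        -- `fn r₁ h < fn r t` by monotonicity. The margins between `l`, `l′` and between `u′`, `u`
        -- exceed `c`, which keeps `t` in `(l, u)`.
        follows-between : ∀ {s₀ h κ κ′ l l′ u u′ c} →
          0# < h → κ + κ ≡ κ′ → κ′ + κ′ ≡ fn r₁ h → κ < κ′ →
          (∀ s → l < s → s < u → dist (path xs s) (path xs s₀) < κ × h < s × s < z₁) →
          0# < l′ → l < l′ → u′ < u → c < κ → c < l′ → c < l′ - l → c < u - u′ →
          ∀ s → l′ < s → s < u′ → Follows c s
        follows-between {s₀} {h} {κ} {κ′} {l} {l′} {u} {u′} {c}
          0<h κ+κ κ′+κ′ κ<κ′ near 0<l′ l<l′ u′<u c<κ c<l′ c<l c<u s l′<s s<u′ =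
          inj₁ (<-trans c<l′ l′<s) , λ t 0<t (t< , s<) →
            within t
              (near t (+-cancelˡ-< c (<-trans c+l<l′ (<-trans l′<s s<)))
                      (<-trans t< (<-trans (+-monoʳ-< c s<u′) c+u′<u)))
              (near s (<-trans l<l′ l′<s) (<-trans s<u′ u′<u))
          where
          c+l<l′ : c + l < l′
          c+l<l′ = subst (c + l <_) (x-y+y≡x l′ l) (+-monoˡ-< l c<l)
          c+u′<u : c + u′ < u
          c+u′<u = subst (c + u′ <_) (x-y+y≡x u u′) (+-monoˡ-< u′ c<u)

          within : ∀ t → dist (path xs t) (path xs s₀) < κ × h < t × t < z₁ →
                   dist (path xs s) (path xs s₀) < κ × h < s × s < z₁ →
                   dist (base xs t) (base xs s) + c < fn r t
          within t (dt , h<t , t<z₁) (ds , _) =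
            <-trans (subst (dist (base xs t) (base xs s) + c <_) κ′+κ′ sum<)
              (<-trans (Rising.increasing r₁-rises 0<h h<t t<z₁) (r₁<r t (<-trans 0<h h<t , t<z₁)))
            where
            d<κ′ : dist (base xs t) (base xs s) < κ′
            d<κ′ = ≤-<-trans (base≤path xs xs t s)
              (≤-<-trans (dist-triangle (path xs t) (path xs s₀) (path xs s))
                (subst (dist (path xs t) (path xs s₀) + dist (path xs s₀) (path xs s) <_) κ+κ
                  (<-trans (+-monoˡ-< (dist (path xs s₀) (path xs s)) dt)
                    (+-monoʳ-< κ (subst (_< κ) (dist-sym (path xs s) (path xs s₀)) ds)))))
            sum< : dist (base xs t) (base xs s) + c < κ′ + κ′
            sum< = <-trans (+-monoˡ-< c d<κ′) (+-monoʳ-< κ′ (<-trans c<κ κ<κ′))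

        follows-near : ∀ s₀ → Ioo z s₀ → s₀ < z₁ →
          ∃ λ c → 0# < c × (∀ s → Ioo z s → Close< c (radius xs s) (radius xs s₀) → Follows c s)
        follows-near s₀ s₀∈ s₀<z₁ =
          let h , 0<h , h<s₀ = dense (proj₁ s₀∈)
              κ′ , κ′+κ′ , 0<κ′ , _ = half-pos (Rising.positive r₁-rises (0<h , <-trans h<s₀ s₀<z₁))
              κ , κ+κ , 0<κ , κ<κ′ = half-pos 0<κ′
              l , u , l<s₀ , s₀<u , near = near-× (continuous s₀ s₀∈ κ 0<κ) (near-Ioo h<s₀ s₀<z₁)
              l′ , l<l′ , l′<s₀ = dense l<s₀
              u′ , s₀<u′ , u′<u = dense s₀<u
              0<l′ = <-trans 0<h (proj₁ (proj₂ (near l′ l<l′ (<-trans l′<s₀ s₀<u))))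
              c₁ , 0<c₁ , back = Rising.inverse-continuous rises s₀∈ (near-Ioo l′<s₀ s₀<u′)
              c , (0<c , _) , c<c₁ , c<κ , c<l′ , c<l , c<u = ev-witness 0<1
                (ev-× (ev-< 0<c₁) (ev-× (ev-< 0<κ) (ev-× (ev-< 0<l′)
                  (ev-× (ev-< (<⇒0<- l<l′)) (ev-< (<⇒0<- u′<u))))))
          in c , 0<c , λ s s∈ close →
             let l′<s , s<u′ = back s s∈ (Close<-mono (inj₁ c<c₁) close) in
             follows-between 0<h κ+κ κ′+κ′ κ<κ′ near 0<l′ l<l′ u′<u c<κ c<l′ c<l c<u s l′<s s<u′

        ev-goodScale : Eventually λ t → ∃ λ c → 0# < c × GoodScale t c
        ev-goodScale =
          let δ , 0<δ , all = ev-× (Rising.ev-attains rises) (ev-< (Rising.0<z r₁-rises)) in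
          δ , 0<δ , λ t (0<t , t<δ) →
            let τ , τ+τ , 0<τ , τ<t = half-pos 0<t
                (s₀ , s₀∈ , e) , τ<z₁ = all τ (0<τ , <-trans τ<t t<δ)
            in scale τ+τ 0<τ s₀ s₀∈ e τ<z₁
          where
          scale : ∀ {t τ} → τ + τ ≡ t → 0# < τ → ∀ s₀ → Ioo z s₀ → radius xs s₀ ≡ τ → τ < z₁ →
                  ∃ λ c → 0# < c × GoodScale t c
          scale {τ = τ} τ+τ 0<τ s₀ s₀∈ refl τ<z₁ =
            let c , 0<c , h = follows-near s₀ s₀∈ (≤-<-trans (height≤radius xs s₀) τ<z₁)
                d , d≤c , d≤τ , glb = minimum c τ
            in d , glb 0# 0<c 0<τ , τ , τ+τ , d≤τ , λ s s∈ close →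
               follows-down d≤c (h s s∈ (Close<-mono d≤c close))

        good-scale : ∃ λ ω → Eventually λ t → 0# < fn ω t × fn ω t ≤ t × GoodScale t (fn ω t)
        good-scale = tolerance GoodScale dGoodScale goodScale-down ev-goodScale

      Tracked : Vec C (suc n) → Set
      Tracked q = ∃ λ c → ∃ λ s → 0# < s × dist q (path xs s) < c × Follows c s

      tracked⇒side : ∀ q → Tracked q → Side sgn aᵢ (lookup q i)
      tracked⇒side q (c , s , 0<s , near , c≤s , _) = side-near sgn aᵢ c≤s
        (subst (Close< c (lookup q i)) (insertAt-lookup (base xs s) i (shift sgn aᵢ s))
          (dist<-elim q (path xs s) near i))

      -- The nearby point of the first arc has another height `s`; `Follows` provides the change of
      -- height to `t` and still leaves `c` for the distance between the curves.
      tracked⇒close : ∀ ys t → 0# < t → Tracked (path ys t) → dist (base xs t) (base ys t) < fn r t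
      tracked⇒close ys t 0<t (c , s , 0<s , near , c≤s , follow) =
        ≤-<-trans (dist-triangle (base xs t) (base xs s) (base ys t))
          (<-trans (+-monoʳ-< (dist (base xs t) (base xs s))
            (subst (_< c) (dist-sym (base ys t) (base xs s)) (≤-<-trans (base≤path ys xs t s) near)))
            (follow t 0<t (height-close ys xs near)))

      module _ (ω : 𝒦) (ωtol : Eventually λ t → 0# < fn ω t × fn ω t ≤ t × GoodScale t (fn ω t))
               {A S : Vec C (suc n) → Set} (A~ : SameGermAt a A (arc xs)) (e : 𝒦)
               (hausdorff : Eventually λ t → IsHausdorffDistance (ball a t ∩ A) (ball a t ∩ S) (fn e t))
               (e<ω : e <ᴷ ω) where

        Facts : C → Set
        Facts t = (∀ y → (ball a t ∩ A) y ⇔ Ray xs t y) ×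
                  IsHausdorffDistance (ball a t ∩ A) (ball a t ∩ S) (fn e t) ×
                  fn e t < fn ω t × GoodScale t (fn ω t) × t < z × (∃ λ s → Ioo z s × radius xs s ≡ t)

        facts : Eventually Facts
        facts = ev-× (ray-⇔ A~) (ev-× hausdorff (ev-× e<ω (ev-× (ev-map (proj₂ ∘ proj₂) ωtol)
          (ev-× (ev-< (Rising.0<z rises)) (Rising.ev-attains rises)))))

        -- The distance from `q` to the first set is at most the Hausdorff distance, hence strictly
        -- below `fn ω t`, so some point realizes a value below it even if the infimum is not
        -- attained.
        close-point : ∀ {t q w} → Facts t → (ball a t ∩ S) q → IsDistTo (ball a t ∩ A) q w →
                      ∃ λ y → Ray xs t y × dist q y < fn ω t
        close-point {t} {q} {w} (ray , (e₁ , e₂ , _ , (ub , _) , e≡) , e<ω , _) q∈ d =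
          let w≤e = subst (w ≤_) (sym e≡) (≤-trans (ub w (q , q∈ , d)) (x≤y⊔x e₁ e₂))
              v , (y , y∈ , v≡) , v<ω = below-inf d (≤-<-trans w≤e e<ω)
          in y , to (ray y) y∈ , subst (_< fn ω t) v≡ v<ω

        -- The ball of radius `t` with `τ + τ ≡ t` contains `q`. The point of the arc found near `q`
        -- has radius within `fn ω t` of `τ`, which is what `GoodScale` is about.
        track-at : ∀ {t τ s₀} q → Facts t → τ + τ ≡ t → 0# < τ → dist q a ≡ τ → S q →
                   0# < s₀ → radius xs s₀ ≡ τ → Tracked q
        track-at {t} {s₀ = s₀} q f@(ray , _ , _ , (τ′ , τ′+τ′ , _ , good) , t<z , _)
                 refl 0<τ refl Sq 0<s₀ e₀ =
          -- An excess bounds only those distances that exist, so the distance from `q` is produced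
          -- first; the point at parameter `s₀` makes the truncated arc nonempty.
          let w , d = dist-to-ray xs t (0<s₀ , subst (_< t) (sym e₀) (x<x+c 0<τ)) q
              y , (s , (0<s , s<t) , y≡) , near = close-point f (x<x+c 0<τ , Sq)
                (IsDistTo-⇔ q (λ y → mk⇔ (from (ray y)) (to (ray y))) d)
              near′ = subst (λ y → dist q y < fn ω t) y≡ near
          in fn ω t , s , 0<s , near′ ,
             good s (0<s , ≤-<-trans (height≤radius xs s) (<-trans s<t t<z))
               (subst (Close< (fn ω t) (radius xs s)) (double-cancel (sym τ′+τ′)) (close s near′))
          where
          close : ∀ s → dist q (path xs s) < fn ω t → Close< (fn ω t) (radius xs s) (dist q a)
          close s near =
            ≤-<-trans (dist-triangle (path xs s) q a)
              (+-monoˡ-< (dist q a) (subst (_< fn ω t) (dist-sym q (path xs s)) near)) ,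
            ≤-<-trans (dist-triangle q (path xs s) a) (+-monoˡ-< (radius xs s) near)

        track : Eventually λ ζ → ∀ q → S q → 0# < dist q a → dist q a < ζ → Tracked q
        track =
          let δ , 0<δ , all = facts
              η , η+η , 0<η , _ = half-pos 0<δ
          in η , 0<η , λ ζ (_ , ζ<η) q Sq 0<τ τ<ζ →
            let τ<η = <-trans τ<ζ ζ<η
                t<δ = subst (dist q a + dist q a <_) η+η
                        (<-trans (+-monoˡ-< (dist q a) τ<η) (+-monoʳ-< η τ<η))
                s₀ , (0<s₀ , _) , e₀ = proj₂ (proj₂ (proj₂ (proj₂ (proj₂
                  (all (dist q a) (0<τ , <-trans (x<x+c 0<τ) t<δ))))))
            in track-at q (all (dist q a + dist q a) (+-pos 0<τ 0<τ , t<δ)) refl 0<τ refl Sq 0<s₀ e₀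

        close-path : ∀ ys → SameGermAt a S (arc ys) → distᴷ (map proj₁ xs) (map proj₁ ys) <ᴷ r
        close-path ys (ε , 0<ε , S~) =
          let η , 0<η , h = ev-× track (ev-< 0<ε)
              ζ , 0<ζ , ζ<η = dense 0<η
              tracks , ζ<ε = h ζ (0<ζ , ζ<η)
          in eventually-map₂
            (λ {s} radius<ζ 0<s → subst (_< fn r s) (sym (fn-distᴷ xs ys s))
              (tracked⇒close ys s 0<s (tracks (path ys s)
                (from (S~ (path ys s) (<-trans radius<ζ ζ<ε)) (s , 0<s , refl))
                (<-≤-trans 0<s (height≤radius ys s)) radius<ζ)))
            (path⟶a ys ζ 0<ζ) ev-pos

        -- The point of A at distance t / 2 from a is too far from a itself.
        not-point : (∀ y → S y ⇔ (y ≡ a)) → ⊥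
        not-point S-point =
          let δ , 0<δ , all = facts
              t , 0<t , t<δ = dense 0<δ
              τ , τ+τ , 0<τ , τ<t = half-pos 0<t
              s₀ , (0<s₀ , _) , e₀ = proj₂ (proj₂ (proj₂ (proj₂ (proj₂ (all τ (0<τ , <-trans τ<t t<δ))))))
          in far τ+τ 0<τ τ<t 0<s₀ e₀ (all t (0<t , t<δ))
          where
          far : ∀ {t τ s} → τ + τ ≡ t → 0# < τ → τ < t → 0# < s → radius xs s ≡ τ → Facts t → ⊥
          far {t} {τ} {s} τ+τ 0<τ τ<t 0<s refl
              (ray , (e₁ , e₂ , (ub , _) , _ , e≡) , e<ω , (τ′ , τ′+τ′ , ω≤τ′ , _) , _) =
            <⇒≱ (<-≤-trans e<ω ω≤τ′) (subst₂ _≤_ (double-cancel (trans τ+τ (sym τ′+τ′))) (sym e≡)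
              (≤-trans (ub τ (path xs s , from (ray (path xs s)) (s , (0<s , τ<t) , refl) , isDist))
                       (x≤x⊔y e₁ e₂)))
            where
            isDist : IsDistTo (ball a t ∩ S) (path xs s) τ
            isDist =
              (λ { _ (y , (_ , Sy) , refl) → inj₂ (cong (dist (path xs s)) (sym (to (S-point y) Sy))) }) ,
              λ b h → h τ (a , (subst (_< t) (sym (dist-refl a)) (<-trans 0<τ τ<t) , from (S-point a) refl) , refl)

-- Passing between curve germs and arcs.

module CurveGerms (em : ExcludedMiddle 0ℓ) {L : Language} (M : Structure L)
  (isRCF : IsRealClosedOrderedField M) (oMinimal : IsOMinimal M)
  {n : ℕ} (a : Vec (Structure.Carrier M) (suc n)) (i : Fin (suc n)) (sgn : Sign) where

  open OrderedField M isRCF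
  open Definability M
  open OMinimality em M isRCF oMinimal
  open GermsOfFunctions em M isRCF oMinimal
  open DefinablePaths em M isRCF oMinimal
  open Arcs em M isRCF oMinimal a i sgn

  GermOf : Curve a → Vec 𝔪 n → Set
  GermOf γ xs = SameGermAt a ⟪ γ ⟫ (arc xs)

  module _ (xs : Vec 𝔪 n) {z δ : C} (reg : RegularOn xs z) (0<δ : 0# < δ) (δ<z : δ < z) where
    open Scaling 0<δ
    open RegularOn reg using (increasing; continuous)

    scaled : C → Vec C (suc n)
    scaled t = path xs (δ * t)

    definable-scaled : DefinablePath scaled
    definable-scaled = definablePath λ j → Fun⇒function {u = λ t → lookup (scaled t) j}
      (FunVec.component (pathᵈ (definable-path xs) (constᵈ δ *ᵈ # zero)) j)

    scaled⟶a : scaled ⟶ a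
    scaled⟶a c 0<c =
      let ε , 0<ε , h = path⟶a xs c 0<c
          ε′ , e = *-surjective ε
      in ε′ , *-cancelʳ-< (subst₂ _<_ (sym (R.zeroʳ δ)) (sym e) 0<ε) , λ t (0<t , t<ε′) →
         h (δ * t) (subst (_< δ * t) (R.zeroʳ δ) (*-monoʳ-< 0<t) , subst (δ * t <_) e (*-monoʳ-< t<ε′))

    scaled-Ioo : ∀ {t} → Ioo 1# t → Ioo z (δ * t)
    scaled-Ioo t∈ = let p , q = *-Ioo t∈ in p , <-trans q δ<z

    scaled-continuous : ∀ t → Ioo 1# t → PathContinuousAt scaled t
    scaled-continuous t t∈ c 0<c =
      let l , r , l< , <r , h = continuous (δ * t) (scaled-Ioo t∈) c 0<c
          l′ , el = *-surjective l
          r′ , er = *-surjective r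
      in l′ , r′ , *-cancelʳ-< (subst (_< δ * t) (sym el) l<) , *-cancelʳ-< (subst (δ * t <_) (sym er) <r) ,
         λ s l′<s s<r′ → h (δ * s) (subst (_< δ * s) el (*-monoʳ-< l′<s))
                                   (subst (δ * s <_) er (*-monoʳ-< s<r′))

    curve : Curve a
    curve = record
      { at      = scaled
      ; isCurve = path-isCurve definable-scaled scaled⟶a 1# scaled-continuous
      ; shrunk  = inj₁ λ s t s∈ t∈ s<t →
          increasing (proj₁ (scaled-Ioo s∈)) (*-monoʳ-< s<t) (proj₂ (scaled-Ioo t∈))
      }

    curve-side : Eventually λ t → Side sgn aᵢ (lookup (scaled t) i)
    curve-side = ev-map
      (λ {t} t∈ → subst (Side sgn aᵢ) (sym (insertAt-lookup (base xs (δ * t)) i _))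
        (side-shift sgn aᵢ (proj₁ (*-Ioo t∈))))
      (1# , 0<1 , λ _ t∈ → t∈)

    -- Cutting the arc at height `δ` loses nothing in the ball of radius `δ`, because the radius is
    -- at least the height.
    curve-germ : GermOf curve xs
    curve-germ = δ , 0<δ , λ b b∈ → mk⇔
      (λ (t , t∈ , e) → δ * t , proj₁ (*-Ioo t∈) , e)
      (λ { (s , 0<s , refl) →
        let t , e = *-surjective s
            s∈ = 0<s , ≤-<-trans (height≤radius xs s) b∈
        in t , *-Ioo⁻¹ (subst (Ioo δ) (sym e) s∈) , cong (path xs) (sym e) })

  arc-curve : Vec 𝔪 n → Setoid.Carrier (𝒢± a i sgn)
  arc-curve xs =
    let z , reg = regular xs
        δ , 0<δ , δ<z = dense (Rising.0<z (RegularOn.rises reg))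
    in curve xs reg 0<δ δ<z , curve-side xs reg 0<δ δ<z

  arc-curve-germ : ∀ xs → GermOf (proj₁ (arc-curve xs)) xs
  arc-curve-germ xs =
    let z , reg = regular xs
        δ , 0<δ , δ<z = dense (Rising.0<z (RegularOn.rises reg))
    in curve-germ xs reg 0<δ δ<z

  lookup-removeAt : ∀ {A : Set} (b : Vec A (suc n)) j → lookup (removeAt b i) j ≡ lookup b (punchIn i j)
  lookup-removeAt b j = trans (sym (insertAt-punchIn (removeAt b i) i (lookup b i) j))
    (cong (λ b → lookup b (punchIn i j)) (insertAt-removeAt b i))

  height : Vec C (suc n) → C
  height b = shift⁻¹ sgn aᵢ (lookup b i)

  insertAt-height : ∀ b → insertAt (removeAt b i) i (shift sgn aᵢ (height b)) ≡ b
  insertAt-height b = trans (cong (insertAt (removeAt b i) i) (shift-shift⁻¹ sgn aᵢ (lookup b i)))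
                            (insertAt-removeAt b i)

  height≤dist : ∀ b → height b ≤ dist b a
  height≤dist b = subst (λ b′ → height b ≤ dist b′ a) (insertAt-height b) (≤dist-to-a (removeAt b i) (height b))

  module _ {F : C → Vec C (suc n)} (dF : DefinablePath F) (F⟶a : F ⟶ a) {z : C}
           (rises : Rising (height ∘ F) z) where
    open Rising rises

    private
      Inverse : C → C → Set
      Inverse s t = Ioo z t × height (F t) ≡ s

      inverse : ∃ λ x → ∀ {s t} → Inverse s t → fn x s ≡ t
      inverse = fromGraph Inverse
        ((constᵈ 0# <ᵈ # (suc zero) ×ᵈ # (suc zero) <ᵈ constᵈ z) ×ᵈ
          shift⁻¹ᵈ sgn aᵢ (FunVec.component (pathᵈ dF (# (suc zero))) i) ≡ᵈ # zero)
        (λ (t∈ , e) (t′∈ , e′) → injective t∈ t′∈ (trans e (sym e′)))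

      param : C → C
      param = fn (proj₁ inverse)

      coordinate : Fin n → 𝒦
      coordinate j = record
        { fn        = λ s → lookup (F (param s)) (punchIn i j) - lookup a (punchIn i j)
        ; definable = Fun⇒function {u = λ s → lookup (F (param s)) (punchIn i j) - lookup a (punchIn i j)}
            (FunVec.component (pathᵈ dF (fnᵈ (proj₁ inverse) (# zero))) (punchIn i j)
              -ᵈ constᵈ (lookup a (punchIn i j)))
        }

      -- By `attains`, heights below that of `F t₁` come from parameters below `t₁`, where `F` is
      -- already close to `a`.
      coordinate-small : ∀ j → Infinitesimal (coordinate j)
      coordinate-small j c 0<c =
        let t₁ , (0<t₁ , t₁<z) , near = near-start
        in height (F t₁) , positive (0<t₁ , t₁<z) , λ s (0<s , s<) →
           let t , 0<t , t<t₁ , e = attains (0<t₁ , t₁<z) 0<s s<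
           in subst (λ t → ∣ lookup (F t) (punchIn i j) - lookup a (punchIn i j) ∣ < c)
                (sym (proj₂ inverse ((0<t , <-trans t<t₁ t₁<z) , e)))
                (∣-∣<-intro (dist<-elim (F t) a (near t 0<t t<t₁) (punchIn i j)))
        where
        near-start : ∃ λ t₁ → Ioo z t₁ × (∀ t → 0# < t → t < t₁ → dist (F t) a < c)
        near-start =
          let δ , 0<δ , near = F⟶a c 0<c
              t₁ , t₁∈ , t₁<δ = ev-witness 0<z (ev-< 0<δ)
          in t₁ , t₁∈ , λ t 0<t t<t₁ → near t (0<t , <-trans t<t₁ t₁<δ)

      components : Vec 𝔪 n
      components = tabulate λ j → coordinate j , coordinate-small j

      components-path : ∀ t → Ioo z t → path components (height (F t)) ≡ F t
      components-path t t∈ = trans (cong (λ u → insertAt u i (shift sgn aᵢ (height (F t)))) base≡)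
                                   (insertAt-height (F t))
        where
        param≡ : param (height (F t)) ≡ t
        param≡ = proj₂ inverse (t∈ , refl)

        base≡ : base components (height (F t)) ≡ removeAt (F t) i
        base≡ = lookup-ext λ j → begin
          lookup (base components (height (F t))) j
            ≡⟨ lookup-base components (height (F t)) j ⟩
          lookup â j + fn (proj₁ (lookup components j)) (height (F t))
            ≡⟨ cong₂ _+_ (lookup-removeAt a j)
                 (cong (λ x → fn (proj₁ x) (height (F t))) (lookup∘tabulate _ j)) ⟩
          lookup a (punchIn i j) + (lookup (F (param (height (F t)))) (punchIn i j) - lookup a (punchIn i j))
            ≡⟨ x+[y-x]≡y _ _ ⟩
          lookup (F (param (height (F t)))) (punchIn i j)
            ≡⟨ cong (λ t → lookup (F t) (punchIn i j)) param≡ ⟩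
          lookup (F t) (punchIn i j)
            ≡⟨ lookup-removeAt (F t) j ⟨
          lookup (removeAt (F t) i) j ∎
          where open ≡-Reasoning

    path-components : ∃ λ xs → ∀ t → Ioo z t → path xs (height (F t)) ≡ F t
    path-components = components , components-path

  module _ (γ : Curve a) (side : Eventually λ t → Side sgn aᵢ (lookup (Curve.at γ t) i)) where
    private
      Monotone : Set
      Monotone = ∀ s t → Ioo 1# s → Ioo 1# t → s < t → dist (Curve.at γ s) a < dist (Curve.at γ t) a

      -- The other alternative of `shrunk` fails: a curve constantly equal to `a` lies on neither
      -- side.
      monotone : Monotone
      monotone = [ id , (λ const → ⊥-elim (off const)) ]′ (Curve.shrunk γ)
        where
        side-irrefl : ∀ sgn {x} → ¬ Side sgn x x
        side-irrefl Sign.+ = irrefl refl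
        side-irrefl Sign.- = irrefl refl
        off : ¬ (∀ t → Ioo 1# t → Curve.at γ t ≡ a)
        off const = let t , t∈ , h = ev-witness 0<1 side in
          side-irrefl sgn (subst (λ b → Side sgn aᵢ (lookup b i)) (const t t∈) h)

      module _ {F : C → Vec C (suc n)} (F≡γ : ∀ {t} → Ioo 1# t → F t ≡ Curve.at γ t)
               {z : C} (z≤1 : z ≤ 1#) (rises : Rising (height ∘ F) z)
               (xs : Vec 𝔪 n) (xs-path : ∀ t → Ioo z t → path xs (height (F t)) ≡ F t) where
        open Rising rises

        -- A point of the curve in this ball is closer to `a` than the point at `t₁`, whose height
        -- is at most its distance; shrunkness then puts its parameter before `t₁`, so the curve
        -- does not return to `a`. A point of the arc in the ball has height below that of `F t₁`,
        -- which is attained before `t₁`.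
        curve⇔arc : ∀ t₁ → Ioo z t₁ → ∀ b → ball a (height (F t₁)) b → ⟪ γ ⟫ b ⇔ arc xs b
        curve⇔arc t₁ (0<t₁ , t₁<z) b b∈ = mk⇔ fwd bwd
          where
          t₁∈1 : Ioo 1# t₁
          t₁∈1 = 0<t₁ , <-≤-trans t₁<z z≤1

          fwd : ⟪ γ ⟫ b → arc xs b
          fwd (t , t∈ , refl) = height (F t) , positive t∈z , sym (trans (xs-path t t∈z) (F≡γ t∈))
            where
            near : dist (Curve.at γ t) a < dist (Curve.at γ t₁) a
            near = <-≤-trans b∈ (subst (λ b → height (F t₁) ≤ dist b a) (F≡γ t₁∈1) (height≤dist (F t₁)))
            t<t₁ : t < t₁
            t<t₁ with <⊎≥ t t₁
            ... | inj₁ t<t₁        = t<t₁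
            ... | inj₂ (inj₁ t₁<t) = ⊥-elim (<⇒≱ near (inj₁ (monotone t₁ t t₁∈1 t∈ t₁<t)))
            ... | inj₂ (inj₂ refl) = ⊥-elim (irrefl refl near)
            t∈z : Ioo z t
            t∈z = proj₁ t∈ , <-trans t<t₁ t₁<z

          bwd : arc xs b → ⟪ γ ⟫ b
          bwd (s , 0<s , refl) with attains (0<t₁ , t₁<z) 0<s (≤-<-trans (height≤radius xs s) b∈)
          ... | t , 0<t , t<t₁ , refl = t , t∈ , trans (xs-path t (0<t , <-trans t<t₁ t₁<z)) (F≡γ t∈)
            where
            t∈ : Ioo 1# t
            t∈ = 0<t , <-trans t<t₁ (proj₂ t₁∈1)

        germ : GermOf γ xs
        germ = let t₁ , t₁∈ = dense 0<z in
          height (F t₁) , positive t₁∈ , curve⇔arc t₁ t₁∈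

      heightᴷ : {F : C → Vec C (suc n)} → DefinablePath F → 𝒦
      heightᴷ {F} dF = record
        { fn        = height ∘ F
        ; definable = Fun⇒function {u = height ∘ F}
            (shift⁻¹ᵈ sgn aᵢ (FunVec.component (pathᵈ dF (# zero)) i))
        }

      components-of-path : (∃ λ F → DefinablePath F × (∀ {t} → Ioo 1# t → F t ≡ Curve.at γ t)) → ∃ (GermOf γ)
      components-of-path (F , dF , F≡γ) =
        let z₀ , rise = rising (heightᴷ dF)
              (λ c 0<c → ev-map (λ {t} → ≤-<-trans (height≤dist (F t))) (F⟶a c 0<c)) positive
            z , z≤z₀ , z≤1 , glb = minimum z₀ 1#
            rise′ = Rising-shrink (glb 0# (Rising.0<z rise) 0<1) z≤z₀ rise
            xs , xs-path = path-components dF F⟶a rise′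
        in xs , germ F≡γ z≤1 rise′ xs xs-path
        where
        F⟶a : F ⟶ a
        F⟶a c 0<c = let δ , 0<δ , h = IsCurve.limit (Curve.isCurve γ) c 0<c in
          eventually-map₂ (λ t∈ t<δ → subst (λ b → dist b a < c) (sym (F≡γ t∈)) (h _ t∈ t<δ))
            (1# , 0<1 , λ _ t∈ → t∈) (ev-< 0<δ)

        positive : Eventually λ t → 0# < height (F t)
        positive = eventually-map₂
          (λ t∈ h → side⇒shift⁻¹-pos sgn aᵢ (subst (λ b → Side sgn aᵢ (lookup b i)) (sym (F≡γ t∈)) h))
          (1# , 0<1 , λ _ t∈ → t∈) side

    curve-arc : ∃ (GermOf γ)
    curve-arc = components-of-path (curve-path (Curve.isCurve γ))

  -- The translate `base xs` is already a normalized representative; it only has to be cut to an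
  -- interval on which it is continuous.
  normalization : ∀ γ xs → GermOf γ xs → ∃ λ ε → ∃ λ u → IsNormalizedBy a i sgn γ ε u ×
    Eventually (λ s → map (λ x → fn (proj₁ x) s) xs ≡ zipWith _-_ (u s) â)
  normalization γ xs germ =
    let ε , 0<ε , cont = ev-pathContinuous (definable-base xs) (base⟶â xs) in
    ε , base xs , record
      { 0<ε        = 0<ε
      ; isCurve    = path-isCurve (definable-base xs) (base⟶â xs) ε cont
      ; represents = sameGerm-trans {B = arc xs} germ (arc-image {u = base xs} 0<ε (1# , 0<1 , λ _ _ → refl))
      } , 1# , 0<1 , λ s _ → sym (base-sub xs s)

  -- Continuity and invertibility of an arbitrary `ι` are derived from this property alone.
  normalization⇒germ : ∀ {ι} → IsNormalization a i sgn ι → ∀ γ → GermOf (proj₁ γ) (ι γ)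
  normalization⇒germ {ι} norm γ =
    let ε , u , isNorm , e = norm γ in
    sameGerm-trans {B = image ε (λ s → insertAt (u s) i (shift sgn aᵢ s))} (IsNormalizedBy.represents isNorm)
      (sameGerm-sym {A = arc (ι γ)} (arc-image {u = u} (IsNormalizedBy.0<ε isNorm)
        (ev-map (λ {s} e → trans (cong (zipWith _+_ â) e) (add-sub â (u s))) e)))
    where
    add-sub : ∀ {k} (u v : Vec C k) → zipWith _+_ u (zipWith _-_ v u) ≡ v
    add-sub []      []      = refl
    add-sub (x ∷ u) (y ∷ v) = cong₂ _∷_ (x+[y-x]≡y x y) (add-sub u v)

-- The homeomorphism.

module Homeomorphism (em : ExcludedMiddle 0ℓ) {L : Language} (M : Structure L)
  (isRCF : IsRealClosedOrderedField M) (oMinimal : IsOMinimal M)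
  {n : ℕ} (a : Vec (Structure.Carrier M) (suc n)) (i : Fin (suc n)) (sgn : Sign) where

  open OrderedField M isRCF
  open GermsOfFunctions em M isRCF oMinimal
  open Arcs em M isRCF oMinimal a i sgn
  open Estimates em M isRCF oMinimal a i sgn
  open Tracking em M isRCF oMinimal a i sgn
  open CurveGerms em M isRCF oMinimal a i sgn
  open Equivalence

  OnSide : Curve a → Set
  OnSide γ = Eventually λ t → Side sgn aᵢ (lookup (Curve.at γ t) i)

  -- The curve `σ` ranges over all germs at `a`, so besides continuity this shows that the germs on
  -- the given side form an open set. A constant `σ` is excluded by `not-point`, any other one by
  -- tracking.
  curve-estimate : ∀ (γ : Curve a) xs → GermOf γ xs → ∀ r → const 0# <ᴷ r → ∃ λ ω → const 0# <ᴷ ω ×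
    (∀ σ → (∃ λ e → 𝒢-metric a γ σ e × e <ᴷ ω) →
     OnSide σ × (∀ ys → GermOf σ ys → distᴷ (map proj₁ xs) (map proj₁ ys) <ᴷ r))
  curve-estimate γ xs germ r 0<r =
    let z , reg = regular xs
        r₁ , z₁ , r₁-rises , r₁-below = rising-below r 0<r
        ω , ωtol = good-scale xs r reg r₁ r₁-rises (λ t t∈ → proj₁ (r₁-below t t∈))
    in ω , ev-map proj₁ ωtol , λ σ (e , hausdorff , e<ω) →
       onSide σ (Curve.shrunk σ) (tracked⇒side xs r reg)
         (track xs r reg ω ωtol germ e hausdorff e<ω)
         (not-point xs r reg ω ωtol germ e hausdorff e<ω) ,
       close-path xs r reg ω ωtol germ e hausdorff e<ω
    where
    onSide : ∀ {T : Vec C (suc n) → Set} (σ : Curve a) →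
      (∀ s t → Ioo 1# s → Ioo 1# t → s < t → dist (Curve.at σ s) a < dist (Curve.at σ t) a)
        ⊎ (∀ t → Ioo 1# t → Curve.at σ t ≡ a) →
      (∀ q → T q → Side sgn aᵢ (lookup q i)) →
      Eventually (λ ζ → ∀ q → ⟪ σ ⟫ q → 0# < dist q a → dist q a < ζ → T q) →
      ¬ (∀ y → ⟪ σ ⟫ y ⇔ (y ≡ a)) → OnSide σ
    onSide σ (inj₂ const) _ _ ¬point = let t , 0<t , t<1 = dense 0<1 in
      ⊥-elim (¬point λ y → mk⇔ (λ (s , s∈ , e) → trans e (const s s∈))
        (λ e → t , (0<t , t<1) , trans e (sym (const t (0<t , t<1)))))
    onSide σ (inj₁ monotone) side (η , 0<η , tracks) _ =
      let ζ , 0<ζ , ζ<η = dense 0<η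
          δ , 0<δ , near = IsCurve.limit (Curve.isCurve σ) ζ 0<ζ
      in eventually-map₂
        (λ {t} t∈ t<δ → side (Curve.at σ t) (tracks ζ (0<ζ , ζ<η) (Curve.at σ t) (t , t∈ , refl)
          -- The point differs from `a` because its distance exceeds that of an earlier point.
          (let s , 0<s , s<t = dense (proj₁ t∈) in
            ≤-<-trans (0≤dist (Curve.at σ s) a) (monotone s t (0<s , <-trans s<t (proj₂ t∈)) t∈ s<t))
          (near t t∈ t<δ)))
        (1# , 0<1 , λ _ t∈ → t∈) (ev-< 0<δ)

  -- Open sets are predicates on representatives, but equal germs are at distance `0#` and so lie in
  -- every ball around each other. This matters because `ι` may depend on the proof that a curve is
  -- on the side.
  open-respects : ∀ {V : Vec 𝔪 n → Set} → 𝔪-topology n V → ∀ {xs ys} → xs ≋ ys → V xs → V ys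
  open-respects V-open {xs} {ys} xs≋ys v =
    let r , 0<r , h = V-open xs v in
    h ys (distᴷ (map proj₁ xs) (map proj₁ ys) , (1# , 0<1 , λ _ _ → refl) , eventually-map₂
      (λ {s} base≡ 0<r → subst (_< fn r s) (sym (trans (fn-distᴷ xs ys s)
        (trans (cong (λ u → dist u (base ys s)) base≡) (dist-refl (base ys s))))) 0<r)
      (base-eventually xs≋ys) 0<r)

  ι-exists : ∃ λ ι → IsNormalization a i sgn ι
  ι-exists = (λ (γ , side) → proj₁ (curve-arc γ side)) ,
    λ (γ , side) → normalization γ (proj₁ (curve-arc γ side)) (proj₂ (curve-arc γ side))

  module _ (ι : Setoid.Carrier (𝒢± a i sgn) → Vec 𝔪 n) (norm : IsNormalization a i sgn ι) where
    private
      germ : ∀ γ → GermOf (proj₁ γ) (ι γ)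
      germ = normalization⇒germ {ι} norm

      ι-cong : ∀ γ σ → SameGermAt a ⟪ proj₁ γ ⟫ ⟪ proj₁ σ ⟫ → ι γ ≋ ι σ
      ι-cong γ σ e = arc-unique (sameGerm-trans {A = arc (ι γ)} {B = ⟪ proj₁ γ ⟫} {D = arc (ι σ)}
        (sameGerm-sym {A = ⟪ proj₁ γ ⟫} (germ γ))
        (sameGerm-trans {A = ⟪ proj₁ γ ⟫} {B = ⟪ proj₁ σ ⟫} {D = arc (ι σ)} e (germ σ)))

      curve-same : ∀ γ σ {xs ys} → GermOf γ xs → GermOf σ ys → xs ≋ ys → SameGermAt a ⟪ γ ⟫ ⟪ σ ⟫
      curve-same γ σ {xs} {ys} hγ hσ e = sameGerm-trans {B = arc xs} hγ
        (sameGerm-trans {B = arc ys} (arc-cong e) (sameGerm-sym {A = ⟪ σ ⟫} hσ))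

      isInverse : IsInverse (Setoid._≈_ (𝒢± a i sgn)) _≋_ ι arc-curve
      isInverse = record
        { isLeftInverse = record
          { isCongruent = record
            { cong           = λ {γ} {σ} → ι-cong γ σ
            ; isEquivalence₁ = Setoid.isEquivalence (𝒢± a i sgn)
            ; isEquivalence₂ = Setoid.isEquivalence (𝔪^ n)
            }
          ; from-cong = λ {xs} {ys} → curve-same (proj₁ (arc-curve xs)) (proj₁ (arc-curve ys))
              (arc-curve-germ xs) (arc-curve-germ ys)
          ; inverseˡ  = λ {xs} {γ} e → arc-unique (sameGerm-trans {A = arc (ι γ)} {B = ⟪ proj₁ γ ⟫}
              (sameGerm-sym {A = ⟪ proj₁ γ ⟫} (germ γ))
              (sameGerm-trans {B = ⟪ proj₁ (arc-curve xs) ⟫} e (arc-curve-germ xs)))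
          }
        ; inverseʳ = λ {γ} {xs} e → curve-same (proj₁ (arc-curve xs)) (proj₁ γ)
            (arc-curve-germ xs) (germ γ) e
        }

      ι-continuous : Continuous (𝒢±-topology a i sgn) (𝔪-topology n) ι
      ι-continuous V V-open = U , U-open , λ (γ , side) → mk⇔ (λ v → side , v)
        (λ (side′ , v) → open-respects {V} V-open
          (ι-cong (γ , side′) (γ , side) (Setoid.refl (𝒢 a) {γ})) v)
        where
        -- The subspace topology asks for a subset of the whole of `𝒢 a`; being on the side is part
        -- of it and is open by `curve-estimate`.
        U : Curve a → Set
        U γ = ∃ λ side → V (ι (γ , side))

        U-open : metricTopology (𝒢-metric a) U
        U-open γ (side , v) =
          let r , 0<r , ball⊆V = V-open (ι (γ , side)) v
              ω , 0<ω , estimate = curve-estimate γ (ι (γ , side)) (germ (γ , side)) r 0<r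
          in ω , 0<ω , λ σ near → let side′ , close = estimate σ near in
             side′ , ball⊆V (ι (σ , side′))
               (distᴷ (map proj₁ (ι (γ , side))) (map proj₁ (ι (σ , side′))) ,
                (1# , 0<1 , λ _ _ → refl) , close (ι (σ , side′)) (germ (σ , side′)))

      arc-curve-continuous : Continuous (𝔪-topology n) (𝒢±-topology a i sgn) arc-curve
      arc-curve-continuous V (U , U-open , V⇔U) xs v =
        let r , 0<r , ball⊆U = U-open (proj₁ (arc-curve xs)) (to (V⇔U (arc-curve xs)) v)
            ω , 0<ω , estimate = path-estimate xs r 0<r
        in ω , 0<ω , λ ys (d , d≈ , d<ω) → from (V⇔U (arc-curve ys)) (ball⊆U (proj₁ (arc-curve ys))
             (estimate ys (eventually-map₂ (λ {s} e h → subst (_< fn ω s) (sym e) h) d≈ d<ω)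
               (arc-curve-germ xs) (arc-curve-germ ys)))

    ι-homeomorphism : IsHomeomorphism (𝒢± a i sgn) (𝔪^ n) (𝒢±-topology a i sgn) (𝔪-topology n) ι
    ι-homeomorphism = arc-curve , isInverse , ι-continuous , arc-curve-continuous

proposition6p4 : ExcludedMiddle 0ℓ →
    (L : Language) (T : Theory L) (hT : StandingAssumptions T) →
    (M : Structure L) (M⊨T : M ⊨ᵀ T) →
    let open Germs M (StandingAssumptions.realClosed hT M M⊨T) in
    (n : ℕ) (a : Vec (Structure.Carrier M) (suc n)) (i : Fin (suc n)) (sgn : Sign) →
    (∃ λ ι → IsNormalization a i sgn ι) ×
    (∀ ι → IsNormalization a i sgn ι →
    IsHomeomorphism (𝒢± a i sgn) (𝔪^ n) (𝒢±-topology a i sgn) (𝔪-topology n) ι)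
proposition6p4 em L T hT M M⊨T n a i sgn = ι-exists , ι-homeomorphism
  where
  open StandingAssumptions hT
  open Homeomorphism em M (realClosed M M⊨T) (oMinimal M M⊨T) a i sgn
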